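{- Let $m$ be a positive integer, let $(K,\partial_0,\dots,\partial_{m-1})$ be a field with $m$ commuting derivations, and let $r$ and $n$ be positive integers. Then there is a positive integer $s\ge r$ such that: if a field extension $K(a_h^{\xi}\colon|\xi|\le s\land h<n)$ of $K$ meets the differential condition, then $(K,\partial_0,\dots,\partial_{m-1})$ has an extension $(M,D_0,\dots,D_{m-1})$ (a field $M\supseteq K$ with $m$ commuting derivations extending the $\partial_i$) compatible with $K(a_h^{\xi}\colon|\xi|\le r\land h<n)$, i.e. $K(a_h^{\xi}\colon|\xi|\le r\land h<n)\subseteq M$ and $D_ia_k^{\sigma}=a_k^{\sigma+\varepsilon_i}$ whenever $i<m$, $k<n$ and $|\sigma|+1\le r$.
   Context: $n$ denotes also $\{0,\dots,n-1\}$. For $\sigma\in\mathbb{N}^m$, $|\sigma|=\sum_{i<m}\sigma(i)$; $\varepsilon_i$ is the characteristic function of $\{i\}$ in $\mathbb{N}^m$. The total order $\unlhd$ on $\mathbb{N}^m\times n$: $(\xi,k)\unlhd(\eta,g)$ iff $(|\xi|,k,\xi(0),\dots,\xi(m-2))$ is lexicographically $\le(|\eta|,g,\eta(0),\dots,\eta(m-2))$. The extension $K(a_h^{\xi}\colon|\xi|\le s\land h<n)$ meets the differential condition if: whenever $i<m$, $k<n$, $|\sigma|+1\le s$, and $f$ is a polynomial over $K$ in variables $(x_h^{\xi}\colon(\xi,h)\unlhd(\sigma,k))$ vanishing at $a=(a_h^{\xi}\colon(\xi,h)\unlhd(\sigma,k))$, then $\sum_{(\eta,g)\unlhd(\sigma,k)}\frac{\partial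 f}{\partial x_g^{\eta}}(a)\,a_g^{\eta+\varepsilon_i}+f^{\partial_i}(a)=0$, with $f^{\partial_i}$ being $f$ with $\partial_i$ applied to its coefficients. -}

module Defs where

open import Algebra.Bundles using (RawRing; Semiring; CommutativeRing)
open import Algebra.Definitions using (Invertible)
import Algebra.Definitions.RawSemiring as RawSemiringDefinitions
import Algebra.Morphism.RingMonomorphism as RingMonomorphism
open import Algebra.Morphism.Structures using (IsRingMonomorphism)
open import Data.Fin.Base using (Fin; zero; suc; toℕ)
open import Data.List.Base as List
  using (List; []; _∷_; length; filter; cartesianProduct; cartesianProductWith; upTo; allFin)
open import Data.List.Membership.Propositional using (_∈_)
open import Data.List.Membership.Propositional.Properties
  using (∈-filter⁺; ∈-filter⁻; ∈-lookup; ∈-cartesianProduct⁺; ∈-cartesianProductWith⁺;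
         ∈-upTo⁺; ∈-allFin)
open import Data.List.Relation.Binary.Lex.NonStrict using (Lex-≤; ≤-decidable; this; next)
open import Data.List.Relation.Unary.Any using (here)
open import Data.List.Relation.Unary.Unique.Propositional using (Unique; []; _∷_)
import Data.List.Relation.Unary.All as All
import Data.List.Relation.Unary.Unique.Propositional.Properties as Unique
open import Data.Nat.Base using (ℕ; zero; suc; pred; _+_; _∸_; _≤_; s≤s)
import Data.Nat.Properties as ℕ
open import Data.Product.Base using (Σ; ∃; _×_; _,_; proj₁; proj₂; map₁)
open import Data.Vec.Base as Vec using (Vec; []; _∷_; zipWith; replicate; _[_]≔_; updateAt; toList)
open import Data.Vec.Properties using (∷-injective)
open import Function.Base using (_∘_)
open import Level using (Level; _⊔_) renaming (suc to lsuc)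
open import Relation.Binary.PropositionalEquality as ≡ using (_≡_; cong; cong₂)
open import Relation.Nullary using (¬_; Dec)

private
  variable
    c ℓ : Level
    m n N r s : ℕ

-- Fields in the classical sense (no apartness, equality not assumed decidable),
-- of arbitrary characteristic.
record Field (c ℓ : Level) : Set (lsuc (c ⊔ ℓ)) where
  field
    commutativeRing : CommutativeRing c ℓ
  open CommutativeRing commutativeRing public
  field
    0≉1        : ¬ (0# ≈ 1#)
    invertible : ∀ x → ¬ (x ≈ 0#) → Invertible _≈_ 1# _*_ x

-- L as an extension of K, along a given embedding.
infix 4 _↪_
record _↪_ (K L : Field ℓ ℓ) : Set ℓ where
  private
    module K = Field K
    module L = Field L
  field
    ⟦_⟧                : K.Carrier → L.Carrier
    isRingMonomorphism : IsRingMonomorphism K.rawRing L.rawRing ⟦_⟧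
  open IsRingMonomorphism isRingMonomorphism public

record IsDerivation (R : CommutativeRing c ℓ)
                    (D : CommutativeRing.Carrier R → CommutativeRing.Carrier R)
                    : Set (c ⊔ ℓ) where
  open CommutativeRing R using (_≈_) renaming (_+_ to _⊕_; _*_ to _⊛_)
  field
    D-cong  : ∀ {x y} → x ≈ y → D x ≈ D y
    +-rule  : ∀ x y → D (x ⊕ y) ≈ (D x ⊕ D y)
    leibniz : ∀ x y → D (x ⊛ y) ≈ ((D x ⊛ y) ⊕ (x ⊛ D y))

record DifferentialField (m : ℕ) (ℓ : Level) : Set (lsuc ℓ) where
  field
    underlying : Field ℓ ℓ
  open Field underlying public
  field
    ∂            : Fin m → Carrier → Carrier
    isDerivation : ∀ i → IsDerivation commutativeRing (∂ i)
    ∂-comm       : ∀ i j x → ∂ i (∂ j x) ≈ ∂ j (∂ i x)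

open DifferentialField using (underlying)

infix 4 _↪ᵈ_
record _↪ᵈ_ (K M : DifferentialField m ℓ) : Set ℓ where
  private
    module K = DifferentialField K
    module M = DifferentialField M
  field
    embedding : underlying K ↪ underlying M
  open _↪_ embedding public
  field
    extends : ∀ i x → M.∂ i ⟦ x ⟧ M.≈ ⟦ K.∂ i x ⟧

module _ {K L : Field ℓ ℓ} (ι : K ↪ L) {I : Set} (a : I → Field.Carrier L) where
  private
    module K = Field K
    module L = Field L
    module ι = _↪_ ι

  -- Membership in the subfield K(a) of L; adjoin ι a is that subfield.
  data Generated : L.Carrier → Set ℓ where
    base : ∀ x → Generated ι.⟦ x ⟧
    gen  : ∀ i → Generated (a i)
    add  : ∀ {x y} → Generated x → Generated y → Generated (x L.+ y)
    neg  : ∀ {x} → Generated x → Generated (L.- x)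
    mul  : ∀ {x y} → Generated x → Generated y → Generated (x L.* y)
    inv  : ∀ {x y} → Generated x → x L.* y L.≈ L.1# → Generated y
    resp : ∀ {x y} → x L.≈ y → Generated x → Generated y

  private
    rawAdjoin : RawRing ℓ ℓ
    rawAdjoin = record
      { Carrier = Σ L.Carrier Generated
      ; _≈_     = λ x y → proj₁ x L.≈ proj₁ y
      ; _+_     = λ x y → proj₁ x L.+ proj₁ y , add (proj₂ x) (proj₂ y)
      ; _*_     = λ x y → proj₁ x L.* proj₁ y , mul (proj₂ x) (proj₂ y)
      ; -_      = λ x → L.- proj₁ x , neg (proj₂ x)
      ; 0#      = L.0# , resp ι.0#-homo (base K.0#)
      ; 1#      = L.1# , resp ι.1#-homo (base K.1#)
      }

    inclusion : IsRingMonomorphism rawAdjoin L.rawRing proj₁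
    inclusion = record
      { isRingHomomorphism = record
        { isSemiringHomomorphism = record
          { isNearSemiringHomomorphism = record
            { +-isMonoidHomomorphism = record
              { isMagmaHomomorphism = record
                { isRelHomomorphism = record { cong = λ p → p }
                ; homo              = λ _ _ → L.refl
                }
              ; ε-homo = L.refl
              }
            ; *-homo = λ _ _ → L.refl
            }
          ; 1#-homo = L.refl
          }
        ; -‿homo = λ _ → L.refl
        }
      ; injective = λ p → p
      }

  adjoin : Field ℓ ℓ
  adjoin = record
    { commutativeRing = record
      { isCommutativeRing =
          RingMonomorphism.isCommutativeRing inclusion L.isCommutativeRing
      }
    ; 0≉1        = L.0≉1
    ; invertible = λ (x , p) x≉0 →
        let (y , yx≈1 , xy≈1) = L.invertible x x≉0
        in (y , inv p xy≈1) , yx≈1 , xy≈1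
    }

-- The entry (c , e) stands for the term c·x₀^e₀⋯x_{N-1}^e_{N-1}.
-- Exponent vectors may repeat and coefficients may be zero, so a polynomial
-- has many representations; coefficientwise derivation, partial derivatives
-- and evaluation do not depend on the choice.
Polynomial : Set c → ℕ → Set c
Polynomial A N = List (A × Vec ℕ N)

mapCoefficients : {A : Set c} {B : Set ℓ} → (A → B) → Polynomial A N → Polynomial B N
mapCoefficients φ = List.map (map₁ φ)

module _ (F : Field c ℓ) where
  open Field F using (Carrier; 0#; semiring) renaming (_+_ to _⊕_; _*_ to _⊛_)
  open RawSemiringDefinitions (Semiring.rawSemiring semiring)
    using (_^_; product) renaming (_×_ to _·_)

  evaluate : Polynomial Carrier N → (Fin N → Carrier) → Carrier
  evaluate []            x = 0#
  evaluate ((b , e) ∷ f) x = (b ⊛ product (λ j → x j ^ Vec.lookup e j)) ⊕ evaluate f x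

  partialDerivative : Fin N → Polynomial Carrier N → Polynomial Carrier N
  partialDerivative j = List.map λ (b , e) → (Vec.lookup e j · b) , updateAt e j pred

∣_∣ : Vec ℕ m → ℕ
∣_∣ = Vec.sum

ε : Fin m → Vec ℕ m
ε i = replicate _ 0 [ i ]≔ 1

infixl 6 _⊞_
_⊞_ : Vec ℕ m → Vec ℕ m → Vec ℕ m
_⊞_ = zipWith _+_

-- (|ξ|, k, ξ(0), …, ξ(m-2))
key : Vec ℕ m × Fin n → List ℕ
key {m = m} (ξ , k) = ∣ ξ ∣ ∷ toℕ k ∷ List.take (m ∸ 1) (toList ξ)

infix 4 _⊴_ _⊴?_
_⊴_ : Vec ℕ m × Fin n → Vec ℕ m × Fin n → Set
u ⊴ v = Lex-≤ _≡_ _≤_ (key u) (key v)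

_⊴?_ : (u v : Vec ℕ m × Fin n) → Dec (u ⊴ v)
u ⊴? v = ≤-decidable ℕ._≟_ ℕ._≤?_ (key u) (key v)

-- The vectors in ℕᵐ all of whose entries are at most d.
box : ∀ m → ℕ → List (Vec ℕ m)
box zero    d = [] ∷ []
box (suc m) d = cartesianProductWith _∷_ (upTo (suc d)) (box m d)

-- The pairs (ξ , h) ⊴ v, each listed once: see ∈-below⁺, ∈-below⁻, below-unique.
below : Vec ℕ m × Fin n → List (Vec ℕ m × Fin n)
below {m} {n} v = filter (_⊴? v) (cartesianProduct (box m ∣ proj₁ v ∣) (allFin n))

⊴⇒∣∣≤ : {u v : Vec ℕ m × Fin n} → u ⊴ v → ∣ proj₁ u ∣ ≤ ∣ proj₁ v ∣
⊴⇒∣∣≤ (this (p , _)) = p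
⊴⇒∣∣≤ (next p _)     = ℕ.≤-reflexive p

∈-box : ∀ {d} (ξ : Vec ℕ m) → ∣ ξ ∣ ≤ d → ξ ∈ box m d
∈-box []      _ = here ≡.refl
∈-box (x ∷ ξ) p = ∈-cartesianProductWith⁺ _∷_
  (∈-upTo⁺ (s≤s (ℕ.≤-trans (ℕ.m≤m+n x _) p)))
  (∈-box ξ (ℕ.≤-trans (ℕ.m≤n+m _ x) p))

∈-below⁺ : {u v : Vec ℕ m × Fin n} → u ⊴ v → u ∈ below v
∈-below⁺ {u = ξ , h} {v} p =
  ∈-filter⁺ (_⊴? v) (∈-cartesianProduct⁺ (∈-box ξ (⊴⇒∣∣≤ {u = ξ , h} {v} p)) (∈-allFin h)) p

∈-below⁻ : {u v : Vec ℕ m × Fin n} → u ∈ below v → u ⊴ v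
∈-below⁻ {m} {n} {v = v} p =
  proj₂ (∈-filter⁻ (_⊴? v) {xs = cartesianProduct (box m ∣ proj₁ v ∣) (allFin n)} p)

box-unique : ∀ m d → Unique (box m d)
box-unique zero    d = All.[] ∷ []
box-unique (suc m) d =
  Unique.cartesianProductWith⁺ _∷_ ∷-injective (Unique.upTo⁺ (suc d)) (box-unique m d)

below-unique : (v : Vec ℕ m × Fin n) → Unique (below v)
below-unique {m} {n} v = Unique.filter⁺ (_⊴? v)
  (Unique.cartesianProduct⁺ (box-unique m ∣ proj₁ v ∣) (Unique.allFin⁺ n))

∣⊞ε∣ : (σ : Vec ℕ m) (i : Fin m) → ∣ σ ⊞ ε i ∣ ≡ ∣ σ ∣ + 1
∣⊞ε∣ {suc m} (x ∷ σ) zero = begin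
  x + 1 + ∣ σ ⊞ replicate m 0 ∣ ≡⟨ cong (x + 1 +_) (∣⊞0∣ σ) ⟩
  x + 1 + ∣ σ ∣                 ≡⟨ ℕ.+-assoc x 1 ∣ σ ∣ ⟩
  x + (1 + ∣ σ ∣)               ≡⟨ cong (x +_) (ℕ.+-comm 1 ∣ σ ∣) ⟩
  x + (∣ σ ∣ + 1)               ≡⟨ ℕ.+-assoc x ∣ σ ∣ 1 ⟨
  x + ∣ σ ∣ + 1                 ∎
  where
  open ≡.≡-Reasoning
  ∣⊞0∣ : ∀ {m} (τ : Vec ℕ m) → ∣ τ ⊞ replicate m 0 ∣ ≡ ∣ τ ∣
  ∣⊞0∣ []      = ≡.refl
  ∣⊞0∣ (y ∷ τ) = cong₂ _+_ (ℕ.+-identityʳ y) (∣⊞0∣ τ)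
∣⊞ε∣ (x ∷ σ) (suc i) = begin
  x + 0 + ∣ σ ⊞ ε i ∣ ≡⟨ cong₂ _+_ (ℕ.+-identityʳ x) (∣⊞ε∣ σ i) ⟩
  x + (∣ σ ∣ + 1)     ≡⟨ ℕ.+-assoc x ∣ σ ∣ 1 ⟨
  x + ∣ σ ∣ + 1       ∎
  where open ≡.≡-Reasoning

-- Indices (ξ , h) with |ξ| ≤ s and h < n of a family (a_h^ξ).
record Index (m n s : ℕ) : Set where
  constructor index
  field
    exponent  : Vec ℕ m
    component : Fin n
    .bound    : ∣ exponent ∣ ≤ s

weaken : .(r ≤ s) → Index m n r → Index m n s
weaken r≤s (index ξ h p) = index ξ h (ℕ.≤-trans p r≤s)

here-index : (σ : Vec ℕ m) (k : Fin n) → .(∣ σ ∣ + 1 ≤ s) → Index m n s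
here-index σ k p = index σ k (ℕ.≤-trans (ℕ.m≤m+n ∣ σ ∣ 1) p)

shift-index : Fin m → (σ : Vec ℕ m) (k : Fin n) → .(∣ σ ∣ + 1 ≤ s) → Index m n s
shift-index i σ k p = index (σ ⊞ ε i) k (ℕ.≤-trans (ℕ.≤-reflexive (∣⊞ε∣ σ i)) p)

-- The indices (η , g) ⊴ (σ , k), in the order of the list below (σ , k), and
-- the corresponding (η + ε_i , g).
module _ (σ : Vec ℕ m) (k : Fin n) .(p : ∣ σ ∣ + 1 ≤ s) where

  private
    below-bound : ∀ j → ∣ proj₁ (List.lookup (below (σ , k)) j) ∣ + 1 ≤ ∣ σ ∣ + 1
    below-bound j = ℕ.+-monoˡ-≤ 1
      (⊴⇒∣∣≤ {u = List.lookup (below (σ , k)) j} {σ , k} (∈-below⁻ (∈-lookup j)))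

  below-index : Fin (length (below (σ , k))) → Index m n s
  below-index j = let (η , g) = List.lookup (below (σ , k)) j
                  in here-index η g (ℕ.≤-trans (below-bound j) p)

  shifted-below-index : Fin m → Fin (length (below (σ , k))) → Index m n s
  shifted-below-index i j = let (η , g) = List.lookup (below (σ , k)) j
                            in shift-index i η g (ℕ.≤-trans (below-bound j) p)

module _ (K : DifferentialField m ℓ) {L : Field ℓ ℓ} (ι : underlying K ↪ L) where
  private
    module K = DifferentialField K
    module L = Field L
    module ι = _↪_ ι
  open RawSemiringDefinitions (Semiring.rawSemiring L.semiring) using (sum)

  evaluateAt : Polynomial K.Carrier N → (Fin N → L.Carrier) → L.Carrier
  evaluateAt f x = evaluate L (mapCoefficients ι.⟦_⟧ f) x

  DifferentialCondition : (Index m n s → L.Carrier) → Set ℓ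
  DifferentialCondition {n} {s} a =
    (i : Fin m) (k : Fin n) (σ : Vec ℕ m) (p : ∣ σ ∣ + 1 ≤ s)
    (f : Polynomial K.Carrier (length (below (σ , k)))) →
    let x = a ∘ below-index σ k p in
    evaluateAt f x L.≈ L.0# →
    sum (λ j → evaluateAt (partialDerivative (underlying K) j f) x
                 L.* a (shifted-below-index σ k p i j))
      L.+ evaluateAt (mapCoefficients (K.∂ i) f) x
      L.≈ L.0#

  -- K ⊆ K(a) ⊆ M, with a_k^σ ↦ a_k^{σ+ε_i} under the i-th derivation of M.
  record Compatible {M : DifferentialField m ℓ} (κ : K ↪ᵈ M)
                    (a : Index m n r → L.Carrier) : Set ℓ where
    private
      module M = DifferentialField M
      module κ = _↪ᵈ_ κ
    field
      embedding : adjoin ι a ↪ underlying M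
    open _↪_ embedding public
    field
      over-K : ∀ x → ⟦ ι.⟦ x ⟧ , base x ⟧ M.≈ κ.⟦ x ⟧
      shifts : ∀ i k σ (p : ∣ σ ∣ + 1 ≤ r) →
               let u = here-index σ k p
                   v = shift-index i σ k p
               in M.∂ i ⟦ a u , gen u ⟧ M.≈ ⟦ a v , gen v ⟧

{-# OPTIONS --safe #-}

-- Write a_v for a_h^ξ, v = (ξ , h), and call v a leader if some polynomial f over K in the variables up to v
-- vanishes at a while its separant ∂f/∂x_v does not. If 2r′ + 1 ≤ s and every leader of order at most 2r′ + 1 lies
-- above one of order at most r′ (by Dickson's lemma some r′ ≥ r is like that, if s is large in terms of r, m and n),
-- then the values a_v of order at most 2r′ extend to a generic solution x with values in a domain B ⊇ L: if v lies
-- above a leader ρ, then x_v is obtained from the equation ∂^{v-ρ} f_ρ = 0, which is linear in x_v, and otherwise x_v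
-- is a new transcendental. The field M consists of the fractions of differential polynomials, compared by their
-- values at x. For this to be a differential field, the differential polynomials vanishing at x must be closed
-- under the ∂_i, which is proved by induction along the order ⊴. The critical case is that of two leaders ρ, ρ′
-- below v: since |ρ| + |ρ′| ≤ 2r′ < |v|, both are below some v − ε_i, and two polynomials with leader v − ε_i that
-- vanish at x have proportional separants and ∂_i-derivatives, so both equations define the same x_v.

module Submission where

open import Defs
open import Algebra.Bundles using (CommutativeRing; RawRing; Semiring)
import Algebra.Definitions.RawSemiring as RawSemiringDefinitions
import Algebra.Morphism.RingMonomorphism as RingMonomorphism
open import Algebra.Morphism.Structures using (IsRingHomomorphism; IsRingMonomorphism)
import Algebra.Properties.CommutativeMonoid.Sum
import Algebra.Properties.Group
import Algebra.Properties.Ring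
import Algebra.Properties.Semiring.Exp
import Algebra.Properties.Semiring.Mult
import Algebra.Properties.Semiring.Sum
import Algebra.Solver.Ring
open import Algebra.Solver.Ring.AlmostCommutativeRing using (fromCommutativeRing; _-Raw-AlmostCommutative⟶_)
open import Axiom.ExcludedMiddle using (ExcludedMiddle)
open import Data.Fin.Base using (Fin; zero; suc; toℕ; opposite)
import Data.Fin.Properties as Fin
open import Data.List.Base as List using (List; []; _∷_; length; _++_; allFin; cartesianProduct)
open import Data.List.Membership.Propositional using (_∈_)
open import Data.List.Membership.Propositional.Properties using (∈-∃++; ∈-++⁻; ∈-++⁺ˡ; ∈-++⁺ʳ; ∈-cartesianProduct⁺; ∈-allFin)
import Data.List.Properties as List
import Data.List.Relation.Binary.Lex.NonStrict as Lex
open import Data.List.Relation.Binary.Lex.NonStrict using (Lex-≤; base; this; next)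
import Data.List.Relation.Binary.Pointwise as ListPointwise
open import Data.List.Relation.Binary.Pointwise using ([]; _∷_)
open import Data.List.Relation.Unary.All as All using (All; []; _∷_)
import Data.List.Relation.Unary.Any as Any
open import Data.List.Relation.Unary.Any using (here; there)
import Data.List.Relation.Unary.Any.Properties as Any
open import Data.List.Relation.Unary.Unique.Propositional using (Unique; []; _∷_)
open import Data.Maybe.Base using (Maybe; just; nothing)
import Data.Nat as ℕ
open import Data.Nat using (ℕ; NonZero; zero; suc; _≤_; _<_; z≤n; s≤s)
import Data.Nat.Properties as ℕ
open import Data.Product using (Σ; Σ-syntax; ∃; ∃-syntax; _×_; _,_; proj₁; proj₂; map₁)
open import Data.Sum as Sum using (_⊎_; inj₁; inj₂)
open import Data.Unit using (tt)
open import Data.Vec.Base as Vec using (Vec; []; _∷_; lookup; replicate; toList; updateAt; zipWith)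
open import Data.Vec.Relation.Binary.Pointwise.Inductive as Pointwise using (Pointwise; []; _∷_)
open import Function using (_∘_; _on_)
open import Level using (Level; _⊔_; Lift; lift) renaming (suc to lsuc)
open import Relation.Binary.Definitions using (Tri; tri<; tri≈; tri>)
open import Relation.Binary.PropositionalEquality as ≡ using (_≡_; _≢_)
import Relation.Binary.Reasoning.Setoid
open import Relation.Nullary using (¬_; Dec; yes; no; contradiction; recompute)
open import Algebra.Properties.CommutativeSemigroup ℕ.+-commutativeSemigroup using () renaming (interchange to +-interchange)

-- The order 2r′ is where consistency changes hands. Two leaders of order at most r′ below a
-- variable of order at most 2r′ need not share a predecessor of it, so there the given values have
-- to reconcile the equations; beyond that order values can be chosen one after another. The given
-- values of order 2r′ + 1 are discarded and serve only as evidence: they show that the derivatives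
-- of relations of order 2r′ form a solvable affine system, and that its pivots are leaders. The
-- obstacle is inseparability. In characteristic p a variable of order 2r′ can be algebraic over its
-- predecessors without being a leader. No equation then determines its derivatives, yet the
-- derivatives of its minimal polynomial restrict variables of order 2r′ + 1 whose values were
-- chosen without regard to it. B is given no derivation; only differential polynomials are
-- differentiated, which is why M is built from terms. B consists of iterated power series because
-- lowest coefficients show at once that there are no zero divisors, without degrees or normal
-- forms.

-- The coefficient (p , q) stands for the integer p − q; sums and products are reduced to p = 0 or q = 0,
-- because the solver compares normal forms up to definitional equality.
reduce : ℕ × ℕ → ℕ × ℕ
reduce (p , q) = p ℕ.∸ q , q ℕ.∸ p

differences : RawRing _ _
differences = record
  { Carrier = ℕ × ℕ
  ; _≈_     = _≡_
  ; _+_     = λ (p , q) (u , v) → reduce (p ℕ.+ u , q ℕ.+ v)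
  ; _*_     = λ (p , q) (u , v) → reduce (p ℕ.* u ℕ.+ q ℕ.* v , p ℕ.* v ℕ.+ q ℕ.* u)
  ; -_      = λ (p , q) → q , p
  ; 0#      = 0 , 0
  ; 1#      = 1 , 0
  }

-- Ring identities with integer coefficients

module RingSolver {c ℓ : Level} (R : CommutativeRing c ℓ) where
  open CommutativeRing R
  open Algebra.Properties.Ring ring
  open Algebra.Properties.Semiring.Mult semiring using (×-homo-+; ×1-homo-*) renaming (_×_ to _·_)
  open Relation.Binary.Reasoning.Setoid setoid

  private
    ⟦_⟧ : ℕ × ℕ → Carrier
    ⟦ p , q ⟧ = p · 1# - q · 1#

    swap-middle : ∀ w x y z → (w + x) + (y + z) ≈ (w + y) + (x + z)
    swap-middle w x y z = begin
      (w + x) + (y + z) ≈⟨ +-assoc w x (y + z) ⟩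
      w + (x + (y + z)) ≈⟨ +-congˡ (sym (+-assoc x y z)) ⟩
      w + ((x + y) + z) ≈⟨ +-congˡ (+-congʳ (+-comm x y)) ⟩
      w + ((y + x) + z) ≈⟨ +-congˡ (+-assoc y x z) ⟩
      w + (y + (x + z)) ≈⟨ sym (+-assoc w y (x + z)) ⟩
      (w + y) + (x + z) ∎

    ≈-from-balance : ∀ p q u v → p ℕ.+ v ≡ u ℕ.+ q → ⟦ p , q ⟧ ≈ ⟦ u , v ⟧
    ≈-from-balance p q u v e = begin
      P - Q                     ≈⟨ sym (+-identityʳ _) ⟩
      (P - Q) + 0#              ≈⟨ +-congˡ (sym (-‿inverseʳ V)) ⟩
      (P - Q) + (V - V)         ≈⟨ swap-middle P (- Q) V (- V) ⟩
      (P + V) + (- Q - V)       ≈⟨ +-congʳ (sym (×-homo-+ 1# p v)) ⟩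
      (p ℕ.+ v) · 1# + (- Q - V) ≡⟨ ≡.cong (λ k → k · 1# + (- Q - V)) e ⟩
      (u ℕ.+ q) · 1# + (- Q - V) ≈⟨ +-congʳ (×-homo-+ 1# u q) ⟩
      (U + Q) + (- Q - V)       ≈⟨ +-congˡ (+-comm _ _) ⟩
      (U + Q) + (- V - Q)       ≈⟨ swap-middle U Q (- V) (- Q) ⟩
      (U - V) + (Q - Q)         ≈⟨ +-congˡ (-‿inverseʳ Q) ⟩
      (U - V) + 0#              ≈⟨ +-identityʳ _ ⟩
      U - V                     ∎
      where
      P = p · 1#
      Q = q · 1#
      U = u · 1#
      V = v · 1#

    ⟦reduce⟧ : ∀ x → ⟦ reduce x ⟧ ≈ ⟦ x ⟧
    ⟦reduce⟧ (p , q) = ≈-from-balance (p ℕ.∸ q) (q ℕ.∸ p) p q (balance p q)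
      where
      balance : ∀ p q → p ℕ.∸ q ℕ.+ q ≡ p ℕ.+ (q ℕ.∸ p)
      balance zero    zero    = ≡.refl
      balance zero    (suc q) = ≡.refl
      balance (suc p) zero    = ≡.refl
      balance (suc p) (suc q) = ≡.trans (ℕ.+-suc (p ℕ.∸ q) q) (≡.cong suc (balance p q))

    ⟦⟧-+ : ∀ x y → ⟦ RawRing._+_ differences x y ⟧ ≈ ⟦ x ⟧ + ⟦ y ⟧
    ⟦⟧-+ (p , q) (u , v) = trans (⟦reduce⟧ (p ℕ.+ u , q ℕ.+ v)) (begin
      (p ℕ.+ u) · 1# - (q ℕ.+ v) · 1#             ≈⟨ +-cong (×-homo-+ 1# p u) (-‿cong (×-homo-+ 1# q v)) ⟩
      (p · 1# + u · 1#) - (q · 1# + v · 1#)       ≈⟨ +-congˡ (sym (-‿+-comm _ _)) ⟩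
      (p · 1# + u · 1#) + (- (q · 1#) - (v · 1#)) ≈⟨ swap-middle _ _ _ _ ⟩
      (p · 1# - q · 1#) + (u · 1# - v · 1#)       ∎)

    ⟦⟧-* : ∀ x y → ⟦ RawRing._*_ differences x y ⟧ ≈ ⟦ x ⟧ * ⟦ y ⟧
    ⟦⟧-* (p , q) (u , v) = trans (⟦reduce⟧ (p ℕ.* u ℕ.+ q ℕ.* v , p ℕ.* v ℕ.+ q ℕ.* u)) (begin
      (p ℕ.* u ℕ.+ q ℕ.* v) · 1# - (p ℕ.* v ℕ.+ q ℕ.* u) · 1#
        ≈⟨ +-cong (×-homo-+ 1# (p ℕ.* u) (q ℕ.* v)) (-‿cong (×-homo-+ 1# (p ℕ.* v) (q ℕ.* u))) ⟩
      ((p ℕ.* u) · 1# + (q ℕ.* v) · 1#) - ((p ℕ.* v) · 1# + (q ℕ.* u) · 1#)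
        ≈⟨ +-cong (+-cong (×1-homo-* p u) (×1-homo-* q v)) (-‿cong (+-cong (×1-homo-* p v) (×1-homo-* q u))) ⟩
      (P * U + Q * V) - (P * V + Q * U)
        ≈⟨ +-congˡ (sym (-‿+-comm _ _)) ⟩
      (P * U + Q * V) + (- (P * V) - Q * U)
        ≈⟨ swap-middle _ _ _ _ ⟩
      (P * U - P * V) + (Q * V - Q * U)
        ≈⟨ +-cong (+-congˡ (-‿distribʳ-* P V)) (+-comm _ _) ⟩
      (P * U + P * - V) + (- (Q * U) + Q * V)
        ≈⟨ +-cong (sym (distribˡ P U (- V))) (+-cong (-‿distribˡ-* Q U) (sym (-x*-y≈x*y Q V))) ⟩
      P * (U - V) + (- Q * U + - Q * - V)
        ≈⟨ +-congˡ (sym (distribˡ (- Q) U (- V))) ⟩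
      P * (U - V) + - Q * (U - V)
        ≈⟨ sym (distribʳ (U - V) P (- Q)) ⟩
      (P - Q) * (U - V) ∎)
      where
      P = p · 1#
      Q = q · 1#
      U = u · 1#
      V = v · 1#
      -x*-y≈x*y : ∀ x y → - x * - y ≈ x * y
      -x*-y≈x*y x y = begin
        - x * - y     ≈⟨ sym (-‿distribˡ-* x (- y)) ⟩
        - (x * - y)   ≈⟨ -‿cong (sym (-‿distribʳ-* x y)) ⟩
        - - (x * y)   ≈⟨ -‿involutive (x * y) ⟩
        x * y         ∎

    ⟦⟧-- : ∀ x → ⟦ RawRing.-_ differences x ⟧ ≈ - ⟦ x ⟧
    ⟦⟧-- (p , q) = begin
      q · 1# - p · 1#       ≈⟨ +-comm _ _ ⟩
      - (p · 1#) + q · 1#   ≈⟨ +-congˡ (sym (-‿involutive _)) ⟩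
      - (p · 1#) - - (q · 1#) ≈⟨ -‿+-comm _ _ ⟩
      - (p · 1# - q · 1#)   ∎

    -- ⟦_⟧ with 0 and 1 sent to 0# and 1# on the nose, so that the solver can use them as constants.
    ⟦_⟧₁ : ℕ × ℕ → Carrier
    ⟦ 0 , 0 ⟧₁ = 0#
    ⟦ 1 , 0 ⟧₁ = 1#
    ⟦ x ⟧₁     = ⟦ x ⟧

    ⟦⟧₁≈⟦⟧ : ∀ x → ⟦ x ⟧₁ ≈ ⟦ x ⟧
    ⟦⟧₁≈⟦⟧ (0 , 0)                       = sym (-‿inverseʳ 0#)
    ⟦⟧₁≈⟦⟧ (1 , 0)                       = sym (trans (+-cong (+-identityʳ 1#) -0#≈0#) (+-identityʳ 1#))
    ⟦⟧₁≈⟦⟧ (0 , suc _)                   = refl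
    ⟦⟧₁≈⟦⟧ (1 , suc _)                   = refl
    ⟦⟧₁≈⟦⟧ (suc (suc _) , _)             = refl

    morphism : differences -Raw-AlmostCommutative⟶ fromCommutativeRing R
    morphism = record
      { ⟦_⟧    = ⟦_⟧₁
      ; +-homo = λ x y → trans (⟦⟧₁≈⟦⟧ (RawRing._+_ differences x y)) (trans (⟦⟧-+ x y) (sym (+-cong (⟦⟧₁≈⟦⟧ x) (⟦⟧₁≈⟦⟧ y))))
      ; *-homo = λ x y → trans (⟦⟧₁≈⟦⟧ (RawRing._*_ differences x y)) (trans (⟦⟧-* x y) (sym (*-cong (⟦⟧₁≈⟦⟧ x) (⟦⟧₁≈⟦⟧ y))))
      ; -‿homo = λ x → trans (⟦⟧₁≈⟦⟧ (RawRing.-_ differences x)) (trans (⟦⟧-- x) (sym (-‿cong (⟦⟧₁≈⟦⟧ x))))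
      ; 0-homo = refl
      ; 1-homo = refl
      }

    _≈?_ : ∀ x y → Maybe (⟦ x ⟧₁ ≈ ⟦ y ⟧₁)
    (p , q) ≈? (u , v) with p ℕ.+ v ℕ.≟ u ℕ.+ q
    ... | yes e = just (trans (⟦⟧₁≈⟦⟧ (p , q)) (trans (≈-from-balance p q u v e) (sym (⟦⟧₁≈⟦⟧ (u , v)))))
    ... | no _  = nothing

  private
    module Solver = Algebra.Solver.Ring differences (fromCommutativeRing R) morphism _≈?_
  open Solver public using (solve; _:=_; _:+_; _:*_; :-_; _:-_)

  :0 :1 : ∀ {n} → Solver.Polynomial n
  :0 = Solver.con (0 , 0)
  :1 = Solver.con (1 , 0)

-- Multi-indices and the componentwise order

infix 4 _≼_
_≼_ : ∀ {m} → Vec ℕ m → Vec ℕ m → Set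
_≼_ = Pointwise _≤_

≼⊞ε : ∀ {m} (ξ : Vec ℕ m) i → ξ ≼ ξ ⊞ ε i
≼⊞ε (x ∷ ξ) zero    = ℕ.m≤m+n x 1 ∷ ≼⊞0 ξ
  where
  ≼⊞0 : ∀ {m} (ξ : Vec ℕ m) → ξ ≼ ξ ⊞ replicate m 0
  ≼⊞0 []      = []
  ≼⊞0 (x ∷ ξ) = ℕ.m≤m+n x 0 ∷ ≼⊞0 ξ
≼⊞ε (x ∷ ξ) (suc i) = ℕ.m≤m+n x 0 ∷ ≼⊞ε ξ i

≼-trans : ∀ {m} {ξ η ζ : Vec ℕ m} → ξ ≼ η → η ≼ ζ → ξ ≼ ζ
≼-trans = Pointwise.trans ℕ.≤-trans

0≼ : ∀ {m} (ξ : Vec ℕ m) → replicate m 0 ≼ ξ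
0≼ []      = []
0≼ (x ∷ ξ) = z≤n ∷ 0≼ ξ

∣0∣ : ∀ m → ∣ replicate m 0 ∣ ≡ 0
∣0∣ zero    = ≡.refl
∣0∣ (suc m) = ∣0∣ m

≼-antisym-∣∣ : ∀ {m} {ξ η : Vec ℕ m} → ξ ≼ η → ∣ η ∣ ≤ ∣ ξ ∣ → ξ ≡ η
≼-antisym-∣∣ []                       _ = ≡.refl
≼-antisym-∣∣ {ξ = x ∷ ξ} {y ∷ η} (p ∷ ps) q with ℕ.m≤n⇒m<n∨m≡n p
... | inj₁ x<y  = contradiction (ℕ.+-mono-<-≤ x<y (∣∣-mono ps)) (ℕ.≤⇒≯ q)
  where
  ∣∣-mono : ∀ {m} {ξ η : Vec ℕ m} → ξ ≼ η → ∣ ξ ∣ ≤ ∣ η ∣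
  ∣∣-mono []       = z≤n
  ∣∣-mono (p ∷ ps) = ℕ.+-mono-≤ p (∣∣-mono ps)
... | inj₂ ≡.refl = ≡.cong (x ∷_) (≼-antisym-∣∣ ps (ℕ.+-cancelˡ-≤ x _ _ q))

⊞0 : ∀ {m} (ξ : Vec ℕ m) → ξ ⊞ replicate m 0 ≡ ξ
⊞0 []      = ≡.refl
⊞0 (x ∷ ξ) = ≡.cong₂ _∷_ (ℕ.+-identityʳ x) (⊞0 ξ)

-- If every coordinate of τ agreed with that of ξ or of η, then |τ| would be at most |ξ| + |η|. So
-- some coordinate exceeds both and can be lowered by one. With η = 0 this yields a predecessor of τ
-- above ξ.
common-predecessor : ∀ {m} {ξ η τ : Vec ℕ m} → ξ ≼ τ → η ≼ τ → ∣ ξ ∣ ℕ.+ ∣ η ∣ < ∣ τ ∣ →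
                     ∃ λ i → ∃ λ σ → τ ≡ σ ⊞ ε i × ξ ≼ σ × η ≼ σ
common-predecessor {ξ = x ∷ ξ} {y ∷ η} {t ∷ τ} (p ∷ ps) (q ∷ qs) lt = step t p q lt (x ℕ.<? t) (y ℕ.<? t)
  where
  Goal : ℕ → Set
  Goal t = ∃ λ i → ∃ λ σ → t ∷ τ ≡ σ ⊞ ε i × x ∷ ξ ≼ σ × y ∷ η ≼ σ
  -- The right side loses t, at most the x + y that the left side loses, so the strict inequality
  -- passes to the tails.
  skip : ∀ t → x ≤ t → y ≤ t → (x ℕ.+ ∣ ξ ∣) ℕ.+ (y ℕ.+ ∣ η ∣) < t ℕ.+ ∣ τ ∣ → t ≤ x ℕ.+ y → Goal t
  skip t p q lt t≤ with common-predecessor ps qs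
      (ℕ.+-cancelˡ-< t _ _ (ℕ.≤-<-trans (ℕ.+-monoˡ-≤ _ t≤)
        (≡.subst (_< t ℕ.+ ∣ τ ∣) (+-interchange x _ y _) lt)))
  ... | i , σ , e , u , v = suc i , t ∷ σ , ≡.cong₂ _∷_ (≡.sym (ℕ.+-identityʳ t)) e , p ∷ u , q ∷ v
  step : ∀ t → x ≤ t → y ≤ t → (x ℕ.+ ∣ ξ ∣) ℕ.+ (y ℕ.+ ∣ η ∣) < t ℕ.+ ∣ τ ∣ →
         Dec (x < t) → Dec (y < t) → Goal t
  step (suc t) _ _ _ (yes x<t) (yes y<t) =
    zero , t ∷ τ , ≡.cong₂ _∷_ (ℕ.+-comm 1 t) (≡.sym (⊞0 τ)) , ℕ.≤-pred x<t ∷ ps , ℕ.≤-pred y<t ∷ qs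
  step t p q lt (no x≮t) _        = skip t p q lt (ℕ.≤-trans (ℕ.≮⇒≥ x≮t) (ℕ.m≤m+n x y))
  step t p q lt (yes _)  (no y≮t) = skip t p q lt (ℕ.≤-trans (ℕ.≮⇒≥ y≮t) (ℕ.m≤n+m y x))

∸-⊞ε : ∀ {m} {ρ σ : Vec ℕ m} i → ρ ≼ σ → zipWith ℕ._∸_ (σ ⊞ ε i) ρ ≡ zipWith ℕ._∸_ σ ρ ⊞ ε i
∸-⊞ε {ρ = r ∷ ρ} {s ∷ σ} zero    (p ∷ ps) = ≡.cong₂ _∷_ (ℕ.+-∸-comm 1 p)
  (≡.trans (≡.cong (λ ξ → zipWith ℕ._∸_ ξ ρ) (⊞0 σ)) (≡.sym (⊞0 _)))
∸-⊞ε {ρ = r ∷ ρ} {s ∷ σ} (suc i) (p ∷ ps) = ≡.cong₂ _∷_ (ℕ.+-∸-comm 0 p) (∸-⊞ε i ps)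

∸-self : ∀ {m} (ρ : Vec ℕ m) → zipWith ℕ._∸_ ρ ρ ≡ replicate m 0
∸-self []      = ≡.refl
∸-self (r ∷ ρ) = ≡.cong₂ _∷_ (ℕ.n∸n≡0 r) (∸-self ρ)

⊞ε-comm : ∀ {m} (ξ : Vec ℕ m) i j → (ξ ⊞ ε i) ⊞ ε j ≡ (ξ ⊞ ε j) ⊞ ε i
⊞ε-comm ξ i j = swap ξ (ε i) (ε j)
  where
  swap : ∀ {m} (ξ η ζ : Vec ℕ m) → (ξ ⊞ η) ⊞ ζ ≡ (ξ ⊞ ζ) ⊞ η
  swap []      []      []      = ≡.refl
  swap (x ∷ ξ) (y ∷ η) (z ∷ ζ) = ≡.cong₂ _∷_
    (≡.trans (ℕ.+-assoc x y z) (≡.trans (≡.cong (x ℕ.+_) (ℕ.+-comm y z)) (≡.sym (ℕ.+-assoc x z y))))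
    (swap ξ η ζ)

-- Almost-full relations (Vytiniotis–Coquand–Wahlstedt), an inductive form of well-quasi-orders

data AlmostFull {X : Set} : (X → X → Set) → Set₁ where
  now   : ∀ {R} → (∀ x y → R x y) → AlmostFull R
  later : ∀ {R} → (∀ x → AlmostFull (λ y z → R y z ⊎ R x y)) → AlmostFull R

module _ {X : Set} where

  af-mono : {R S : X → X → Set} → (∀ x y → R x y → S x y) → AlmostFull R → AlmostFull S
  af-mono R⊆S (now r)   = now (λ x y → R⊆S x y (r x y))
  af-mono R⊆S (later f) = later λ x → af-mono (λ y z → Sum.map (R⊆S y z) (R⊆S x y)) (f x)

  private
    -- `A` and `B` are what R and S may offer instead of C. Once x is fixed, C y z is widened by C x
    -- y, so that the induction hypothesis still fits.
    af-nullary : {R S C : X → X → Set} {A B : Set} →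
                 AlmostFull R → (∀ x y → R x y → C x y ⊎ A) →
                 AlmostFull S → (∀ x y → S x y → C x y ⊎ B) →
                 AlmostFull (λ x y → C x y ⊎ (A × B))
    af-nullary (now r) R⊆ afS S⊆ = af-mono
      (λ x y s → Sum.[ inj₁ , (λ b → Sum.map₂ (_, b) (R⊆ x y (r x y))) ]′ (S⊆ x y s)) afS
    af-nullary {R} {S} {C} {A} {B} (later f) R⊆ afS S⊆ = later λ x → af-mono
      (λ y z → Sum.[ Sum.map inj₁ inj₁ , inj₁ ∘ inj₂ ]′)
      (af-nullary {C = λ y z → C y z ⊎ C x y} (f x)
        (λ y z → Sum.[ Sum.map₁ inj₁ ∘ R⊆ y z , Sum.map₁ inj₂ ∘ R⊆ x y ]′)
        afS (λ y z → Sum.map₁ inj₁ ∘ S⊆ y z))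

    -- Here the alternatives depend on the first element of the pair. For a fixed x, unfolding R
    -- leaves the spare alternative A x and unfolding S leaves B x; neither mentions y or z, so
    -- `af-nullary` joins them to A x × B x.
    af-unary : {R S C : X → X → Set} {A B : X → Set} →
               AlmostFull R → (∀ x y → R x y → C x y ⊎ A x) →
               AlmostFull S → (∀ x y → S x y → C x y ⊎ B x) →
               AlmostFull (λ x y → C x y ⊎ (A x × B x))
    af-unary (now r) R⊆ afS S⊆ = af-mono
      (λ x y s → Sum.[ inj₁ , (λ b → Sum.map₂ (_, b) (R⊆ x y (r x y))) ]′ (S⊆ x y s)) afS
    af-unary afR@(later _) R⊆ (now s) S⊆ = af-mono
      (λ x y r → Sum.[ inj₁ , (λ a → Sum.map₂ (a ,_) (S⊆ x y (s x y))) ]′ (R⊆ x y r)) afR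
    af-unary {R} {S} {C} {A} {B} afR@(later f) R⊆ afS@(later g) S⊆ = later λ x → af-mono
      (λ y z → Sum.[ id′ , inj₂ ∘ inj₂ ]′)
      (af-nullary {C = λ y z → (C y z ⊎ (A y × B y)) ⊎ (C x y ⊎ (A x × B x))} {A x} {B x}
        (af-unary {C = λ y z → C y z ⊎ (C x y ⊎ A x)} {A} {B} (f x)
          (λ y z → Sum.[ Sum.map₁ inj₁ ∘ R⊆ y z , inj₁ ∘ inj₂ ∘ R⊆ x y ]′)
          afS (λ y z → Sum.map₁ inj₁ ∘ S⊆ y z))
        (λ y z → Sum.[ Sum.[ inj₁ ∘ inj₁ ∘ inj₁ , Sum.[ inj₁ ∘ inj₂ ∘ inj₁ , inj₂ ]′ ]′ , inj₁ ∘ inj₁ ∘ inj₂ ]′)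
        (af-unary {C = λ y z → C y z ⊎ (C x y ⊎ B x)} {A} {B} afR
          (λ y z → Sum.map₁ inj₁ ∘ R⊆ y z)
          (g x) (λ y z → Sum.[ Sum.map₁ inj₁ ∘ S⊆ y z , inj₁ ∘ inj₂ ∘ S⊆ x y ]′))
        (λ y z → Sum.[ Sum.[ inj₁ ∘ inj₁ ∘ inj₁ , Sum.[ inj₁ ∘ inj₂ ∘ inj₁ , inj₂ ]′ ]′ , inj₁ ∘ inj₁ ∘ inj₂ ]′))
      where
      id′ : ∀ {Y : Set} → Y → Y
      id′ y = y

  -- The Ramsey argument behind Dickson's lemma: after x, the alternatives to R y z and S y z are R
  -- x y and S x y, predicates of y alone, and `af-unary` combines them.
  af-∩ : {R S : X → X → Set} → AlmostFull R → AlmostFull S → AlmostFull (λ x y → R x y × S x y)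
  af-∩ (now r)         afS     = af-mono (λ x y s → r x y , s) afS
  af-∩ afR@(later _)   (now s) = af-mono (λ x y r → r , s x y) afR
  af-∩ {R} {S} afR@(later f) afS@(later g) = later λ x → af-unary
    (af-∩ (f x) afS) (λ y z → λ { (inj₁ r , s) → inj₁ (r , s) ; (inj₂ r , _) → inj₂ r })
    (af-∩ afR (g x)) (λ y z → λ { (r , inj₁ s) → inj₁ (r , s) ; (_ , inj₂ s) → inj₂ s })

  af-on : {Y : Set} {R : X → X → Set} (f : Y → X) → AlmostFull R → AlmostFull (R on f)
  af-on f (now r)   = now (λ x y → r (f x) (f y))
  af-on f (later g) = later λ x → af-on f (g (f x))

-- An element x that is not at most the next one is replaced by that smaller number; k bounds the
-- number of replacements.
af-≤ : AlmostFull _≤_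
af-≤ = later λ x → from x x ℕ.≤-refl
  where
  from : ∀ k x → x ≤ k → AlmostFull (λ y z → y ≤ z ⊎ x ≤ y)
  from k       zero    _         = now (λ _ _ → inj₂ z≤n)
  from (suc k) (suc x) (s≤s x≤k) = later λ y → step y (suc x ℕ.≤? y)
    where
    step : ∀ y → Dec (suc x ≤ y) → AlmostFull (λ u v → (u ≤ v ⊎ suc x ≤ u) ⊎ (y ≤ u ⊎ suc x ≤ y))
    step y (yes x<y) = now (λ _ _ → inj₂ (inj₂ x<y))
    step y (no x≮y)  = af-mono (λ _ _ → Sum.map inj₁ inj₁)
      (from k y (ℕ.≤-trans (ℕ.≤-pred (ℕ.≰⇒> x≮y)) x≤k))

af-≼ : ∀ m → AlmostFull (_≼_ {m})
af-≼ zero    = now λ { [] [] → [] }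
af-≼ (suc m) = af-mono (λ { (x ∷ ξ) (y ∷ η) (p , ps) → p ∷ ps })
  (af-∩ (af-on Vec.head af-≤) (af-on Vec.tail (af-≼ m)))

opposite-≤⇒≥ : ∀ {n} (i j : Fin n) → toℕ (opposite i) ≤ toℕ (opposite j) → toℕ j ≤ toℕ i
opposite-≤⇒≥ {n} i j p = ℕ.≮⇒≥ λ i<j → ℕ.<⇒≱
  (≡.subst (λ k → k < n ℕ.∸ suc (toℕ i)) (≡.sym (Fin.opposite-prop j)) (ℕ.∸-monoʳ-< (s≤s i<j) (Fin.toℕ<n j)))
  (≡.subst (_≤ toℕ (opposite j)) (Fin.opposite-prop i) p)

-- Equality is the conjunction of ≤ and ≥, and the reversal `opposite` turns ≥ into ≤.
af-≡ : ∀ n → AlmostFull (_≡_ {A = Fin n})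
af-≡ n = af-mono (λ i j (p , q) → Fin.toℕ-injective (ℕ.≤-antisym p (opposite-≤⇒≥ i j q)))
  (af-∩ (af-on toℕ af-≤) (af-on (toℕ ∘ opposite) af-≤))

-- Variables and the stabilisation of leaders

module Variables (m n : ℕ) where

  Var : Set
  Var = Vec ℕ m × Fin n

  ord : Var → ℕ
  ord (ξ , _) = ∣ ξ ∣

  infix 4 _≤ᵛ_
  -- The variable on the right is a derivative, possibly of order zero, of the one on the left.
  _≤ᵛ_ : Var → Var → Set
  (ξ , h) ≤ᵛ (η , k) = ξ ≼ η × h ≡ k

  infixl 6 _↑_
  _↑_ : Var → Fin m → Var
  (ξ , h) ↑ i = ξ ⊞ ε i , h

  af-≤ᵛ : AlmostFull _≤ᵛ_
  af-≤ᵛ = af-∩ (af-on proj₁ (af-≼ m)) (af-on proj₂ (af-≡ n))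

  Covered : {ℓ : Level} → (Var → Set ℓ) → ℕ → Var → Set ℓ
  Covered P r v = ∃ λ u → P u × ord u ≤ r × u ≤ᵛ v

  module _ {ℓ : Level} (em : ExcludedMiddle ℓ) where

    private
      -- The least order above all sums of two orders that are at most r.
      d : ℕ → ℕ
      d r = suc (r ℕ.+ r)

      r≤d : ∀ r → r ≤ d r
      r≤d r = ℕ.≤-trans (ℕ.m≤m+n r r) (ℕ.n≤1+n _)

      Stable : ℕ → ℕ → (Var → Set ℓ) → Set ℓ
      Stable r s P = ∃ λ r′ → r ≤ r′ × d r′ ≤ s × (∀ v → P v → ord v ≤ d r′ → Covered P r′ v)

      -- The invariant of `search`: R is ≤ᵛ widened by alternatives that compare earlier
      -- counterexamples with y, and each of these puts y above such a counterexample.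
      Traced : (Var → Var → Set) → ℕ → (Var → Set ℓ) → Set ℓ
      Traced R r P = ∀ y z → R y z → y ≤ᵛ z ⊎ Covered P r y

      Escape : (Var → Set ℓ) → ℕ → Set ℓ
      Escape P r = ∃ λ v → P v × ord v ≤ d r × ¬ Covered P r v

      covered-mono : ∀ {P : Var → Set ℓ} {r r′ v} → r ≤ r′ → Covered P r v → Covered P r′ v
      covered-mono r≤r′ (u , p , q , w) = u , p , ℕ.≤-trans q r≤r′ , w

      stable-here : ∀ {P r s} → d r ≤ s → ¬ Escape P r → Stable r s P
      stable-here {P} {r} d≤s ¬e = r , ℕ.≤-refl , d≤s , λ v p q → covered v p q em
        where
        covered : ∀ v → P v → ord v ≤ d r → Dec (Covered P r v) → Covered P r v
        covered v p q (yes c) = c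
        covered v p q (no ¬c) = contradiction (v , p , q , ¬c) ¬e

      vars≤ : ℕ → List Var
      vars≤ k = cartesianProduct (box m k) (allFin n)

      maximum : (Var → ℕ) → List Var → ℕ
      maximum f []       = 0
      maximum f (v ∷ vs) = f v ℕ.⊔ maximum f vs

      ≤-maximum : ∀ f {v vs} → v ∈ vs → f v ≤ maximum f vs
      ≤-maximum f (here ≡.refl) = ℕ.m≤m⊔n _ _
      ≤-maximum f (there p)   = ℕ.≤-trans (≤-maximum f p) (ℕ.m≤n⊔m _ _)

      search : ∀ {R} → AlmostFull R → ∀ r → ∃ λ s → ∀ P → Traced R r P → Stable r s P
      -- A counterexample v at r now lies below every w. So stability holds at `d r`, which bounds
      -- the order of v; hence the bound `d (d r)`.
      search (now full) r = d (d r) , λ P tr → decide P tr em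
        where
        decide : ∀ P → Traced _ r P → Dec (Escape P r) → Stable r (d (d r)) P
        decide P tr (no ¬e) = stable-here (r≤d (d r)) ¬e
        decide P tr (yes (v , p , q , ¬c)) = d r , r≤d r , ℕ.≤-refl ,
          λ w _ _ → Sum.[ (λ v≤w → v , p , q , v≤w) , (λ c → contradiction c ¬c) ]′ (tr v w (full v w))
      search {R} (later f) r = d r ℕ.⊔ S , λ P tr → decide P tr em
        where
        -- The counterexample depends on P, which is given only after the bound; so the maximum runs
        -- over all variables that could be one.
        S = maximum (λ v → proj₁ (search (f v) (d r))) (vars≤ (d r))
        decide : ∀ P → Traced R r P → Dec (Escape P r) → Stable r (d r ℕ.⊔ S) P
        decide P tr (no ¬e) = stable-here (ℕ.m≤m⊔n (d r) S) ¬e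
        decide P tr (yes (v@(ξ , h) , p , q , ¬c)) = widen (proj₂ (search (f v) (d r)) P tr′)
          where
          tr′ : Traced (λ y z → R y z ⊎ R v y) (d r) P
          tr′ y z (inj₁ Ryz) = Sum.map₂ (covered-mono {P} (r≤d r)) (tr y z Ryz)
          tr′ y z (inj₂ Rvy) = Sum.[ (λ v≤y → inj₂ (v , p , q , v≤y)) , (λ c → contradiction c ¬c) ]′ (tr v y Rvy)
          widen : Stable (d r) (proj₁ (search (f v) (d r))) P → Stable r (d r ℕ.⊔ S) P
          widen (r′ , d≤r′ , ≤s , st) = r′ , ℕ.≤-trans (r≤d r) d≤r′ ,
            ℕ.≤-trans ≤s (ℕ.≤-trans
              (≤-maximum (λ v → proj₁ (search (f v) (d r))) (∈-cartesianProduct⁺ (∈-box ξ q) (∈-allFin h)))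
              (ℕ.m≤n⊔m (d r) S)) ,
            st

    -- A counterexample to stability at r′ is an element of order at most 2r′ + 1 above none of the elements of
    -- order at most r′, in particular above no earlier counterexample; recursion on almost-fullness of ≤ᵛ bounds
    -- how often this can happen, and there are finitely many candidates each time.
    stability-bound : ∀ r → ∃ λ s → ∀ (P : Var → Set ℓ) →
      ∃ λ r′ → r ≤ r′ × suc (r′ ℕ.+ r′) ≤ s × (∀ v → P v → ord v ≤ suc (r′ ℕ.+ r′) → Covered P r′ v)
    stability-bound r with s , st ← search af-≤ᵛ r = s , λ P → st P (λ _ _ → inj₁)

-- The order on variables and its numbering

unique-⊆⇒length≤ : {A : Set} {xs ys : List A} → Unique xs → (∀ {x} → x ∈ xs → x ∈ ys) → length xs ≤ length ys
unique-⊆⇒length≤ []            _     = z≤n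
unique-⊆⇒length≤ {A} {x ∷ xs} (x∉ ∷ u) xs⊆ys with ys , zs , ≡.refl ← ∈-∃++ (xs⊆ys (here ≡.refl)) =
  ≡.subst (suc (length xs) ≤_) (≡.sym lengths) (s≤s (unique-⊆⇒length≤ u without))
  where
  without : ∀ {y} → y ∈ xs → y ∈ ys List.++ zs
  without {y} p with ∈-++⁻ ys (xs⊆ys (there p))
  ... | inj₁ q           = ∈-++⁺ˡ q
  ... | inj₂ (here ≡.refl) = contradiction ≡.refl (All.lookup x∉ p)
  ... | inj₂ (there q)   = ∈-++⁺ʳ ys q
  lengths : length (ys List.++ x ∷ zs) ≡ suc (length (ys List.++ zs))
  lengths = ≡.trans (List.length-++ ys) (≡.trans (ℕ.+-suc (length ys) (length zs)) (≡.cong suc (≡.sym (List.length-++ ys))))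

module Numbering (m n : ℕ) where
  open Variables m n

  private
    lex-refl : ∀ ks → Lex-≤ _≡_ _≤_ ks ks
    lex-refl []       = base tt
    lex-refl (k ∷ ks) = next ≡.refl (lex-refl ks)

    ⊴-trans : {u v w : Var} → u ⊴ v → v ⊴ w → u ⊴ w
    ⊴-trans = Lex.≤-transitive ℕ.≤-isPartialOrder

    ⊴-total : (u v : Var) → u ⊴ v ⊎ v ⊴ u
    ⊴-total u v = Lex.≤-total ≡.sym ℕ._≟_ ℕ.≤-antisym ℕ.≤-total (key u) (key v)

    -- The key leaves out the last coordinate, which the sum of all coordinates restores.
    vector-injective : ∀ {m} (ξ η : Vec ℕ m) → ∣ ξ ∣ ≡ ∣ η ∣ →
      List.take (m ℕ.∸ 1) (toList ξ) ≡ List.take (m ℕ.∸ 1) (toList η) → ξ ≡ η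
    vector-injective []       []       _ _ = ≡.refl
    vector-injective (x ∷ []) (y ∷ []) e _ =
      ≡.cong (_∷ []) (≡.trans (≡.sym (ℕ.+-identityʳ x)) (≡.trans e (ℕ.+-identityʳ y)))
    vector-injective (x ∷ ξ@(_ ∷ _)) (y ∷ η@(_ ∷ _)) e f = ≡.cong₂ _∷_ x≡y
      (vector-injective ξ η (ℕ.+-cancelˡ-≡ x _ _ (≡.trans e (≡.cong (ℕ._+ _) (≡.sym x≡y)))) (List.∷-injectiveʳ f))
      where x≡y = List.∷-injectiveˡ f

    ⊴-antisym : {u v : Var} → u ⊴ v → v ⊴ u → u ≡ v
    ⊴-antisym {ξ , h} {η , k} p q with e ← ListPointwise.Pointwise-≡⇒≡ (Lex.≤-antisymmetric ≡.sym ℕ.≤-antisym p q)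
      with ≡.refl ← Fin.toℕ-injective (List.∷-injectiveˡ (List.∷-injectiveʳ e)) =
      ≡.cong (_, h) (vector-injective ξ η (List.∷-injectiveˡ e) (List.∷-injectiveʳ (List.∷-injectiveʳ e)))

    lex-⊞ : ∀ k {m} (ξ η ζ : Vec ℕ m) → Lex-≤ _≡_ _≤_ (List.take k (toList ξ)) (List.take k (toList η)) →
            Lex-≤ _≡_ _≤_ (List.take k (toList (ξ ⊞ ζ))) (List.take k (toList (η ⊞ ζ)))
    lex-⊞ zero    _       _       _       p = p
    lex-⊞ (suc k) []      []      []      p = p
    lex-⊞ (suc k) (x ∷ ξ) (y ∷ η) (z ∷ ζ) (this (x≤y , x≢y)) =
      this (ℕ.+-monoˡ-≤ z x≤y , x≢y ∘ ℕ.+-cancelʳ-≡ z x y)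
    lex-⊞ (suc k) (x ∷ ξ) (y ∷ η) (z ∷ ζ) (next ≡.refl p) = next ≡.refl (lex-⊞ k ξ η ζ p)

    -- Both orders grow by one, the components stay, and the same vector is added to both exponents,
    -- so the first difference of the keys stays where it is.
    ⊴-↑ : {u v : Var} → ∀ i → u ⊴ v → u ↑ i ⊴ v ↑ i
    ⊴-↑ {ξ , h} {η , k} i (this (p , ξ≢η)) rewrite ∣⊞ε∣ ξ i | ∣⊞ε∣ η i =
      this (ℕ.+-monoˡ-≤ 1 p , ξ≢η ∘ ℕ.+-cancelʳ-≡ 1 _ _)
    ⊴-↑ {ξ , h} {η , k} i (next e (this p)) rewrite ∣⊞ε∣ ξ i | ∣⊞ε∣ η i =
      next (≡.cong (ℕ._+ 1) e) (this p)
    ⊴-↑ {ξ , h} {η , k} i (next e (next e′ p)) rewrite ∣⊞ε∣ ξ i | ∣⊞ε∣ η i =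
      next (≡.cong (ℕ._+ 1) e) (next e′ (lex-⊞ (m ℕ.∸ 1) ξ η (ε i) p))

  abstract
    -- ⊴ has order type ω, so # embeds it into the natural numbers.
    # : Var → ℕ
    # v = length (below v)

    ⊴⇒#≤ : {u v : Var} → u ⊴ v → # u ≤ # v
    ⊴⇒#≤ {u} u⊴v = unique-⊆⇒length≤ (below-unique u) (λ p → ∈-below⁺ (⊴-trans (∈-below⁻ {v = u} p) u⊴v))

    ⊴∧≢⇒#< : {u v : Var} → u ⊴ v → u ≢ v → # u < # v
    ⊴∧≢⇒#< {u} {v} u⊴v u≢v = unique-⊆⇒length≤ {xs = v ∷ below u} (All.tabulate v∉ ∷ below-unique u) λ where
        (here ≡.refl) → ∈-below⁺ (lex-refl (key v))
        (there p)   → ∈-below⁺ (⊴-trans (∈-below⁻ {v = u} p) u⊴v)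
      where
      v∉ : ∀ {w} → w ∈ below u → v ≢ w
      v∉ w∈ ≡.refl = u≢v (⊴-antisym u⊴v (∈-below⁻ {v = u} w∈))

  #≤⇒⊴ : {u v : Var} → # u ≤ # v → u ⊴ v
  #≤⇒⊴ {u} {v} p with ⊴-total u v | u ⊴? v
  ... | inj₁ u⊴v | _       = u⊴v
  ... | inj₂ v⊴u | yes u⊴v = u⊴v
  ... | inj₂ v⊴u | no ¬u⊴v = contradiction p (ℕ.<⇒≱ (⊴∧≢⇒#< v⊴u λ { ≡.refl → ¬u⊴v v⊴u }))

  #-injective : {u v : Var} → # u ≡ # v → u ≡ v
  #-injective {u} {v} e = ⊴-antisym (#≤⇒⊴ (ℕ.≤-reflexive e)) (#≤⇒⊴ (ℕ.≤-reflexive (≡.sym e)))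

  #≤⇒ord≤ : {u v : Var} → # u ≤ # v → ord u ≤ ord v
  #≤⇒ord≤ {u} {v} p = ⊴⇒∣∣≤ {u = u} {v} (#≤⇒⊴ p)

  ord<⇒#< : {u v : Var} → ord u < ord v → # u < # v
  ord<⇒#< {u} {v} p = ⊴∧≢⇒#< {u} {v} (this (ℕ.<⇒≤ p , ℕ.<⇒≢ p)) λ { ≡.refl → ℕ.<-irrefl ≡.refl p }

  #-↑-mono-≤ : ∀ i {u v : Var} → # u ≤ # v → # (u ↑ i) ≤ # (v ↑ i)
  #-↑-mono-≤ i {u} {v} p = ⊴⇒#≤ (⊴-↑ {u} {v} i (#≤⇒⊴ p))

  ↑-injective : ∀ i {u v : Var} → u ↑ i ≡ v ↑ i → u ≡ v
  ↑-injective i {ξ , h} {η , k} e = ≡.cong₂ _,_ (cancel ξ η (ε i) (≡.cong proj₁ e)) (≡.cong proj₂ e)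
    where
    cancel : ∀ {m} (ξ η ζ : Vec ℕ m) → ξ ⊞ ζ ≡ η ⊞ ζ → ξ ≡ η
    cancel []      []      []      _ = ≡.refl
    cancel (x ∷ ξ) (y ∷ η) (z ∷ ζ) e =
      ≡.cong₂ _∷_ (ℕ.+-cancelʳ-≡ z x y (≡.cong Vec.head e)) (cancel ξ η ζ (≡.cong Vec.tail e))

  #-↑-mono-< : ∀ i {u v : Var} → # u < # v → # (u ↑ i) < # (v ↑ i)
  #-↑-mono-< i {u} {v} p = ℕ.≤∧≢⇒< (#-↑-mono-≤ i (ℕ.<⇒≤ p)) λ e →
    ℕ.<-irrefl (≡.cong # (↑-injective i (#-injective {u ↑ i} {v ↑ i} e))) p

  #-↑-cancel-≤ : ∀ i {u v : Var} → # (u ↑ i) ≤ # (v ↑ i) → # u ≤ # v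
  #-↑-cancel-≤ i p = ℕ.≮⇒≥ λ q → ℕ.<⇒≱ (#-↑-mono-< i q) p

  ord-↑ : ∀ v i → ord (v ↑ i) ≡ suc (ord v)
  ord-↑ (ξ , _) i = ≡.trans (∣⊞ε∣ ξ i) (ℕ.+-comm ∣ ξ ∣ 1)

  #<#-↑ : ∀ v i → # v < # (v ↑ i)
  #<#-↑ v i = ord<⇒#< {v} {v ↑ i} (ℕ.≤-reflexive (≡.sym (ord-↑ v i)))

  infix 4 _≟ᵛ_
  _≟ᵛ_ : (u v : Var) → Dec (u ≡ v)
  u ≟ᵛ v with # u ℕ.≟ # v
  ... | yes e = yes (#-injective e)
  ... | no ¬e = no (¬e ∘ ≡.cong #)

-- Homomorphisms, Horner evaluation and derivations

module _ {a b c d : Level} (A : CommutativeRing a b) (B : CommutativeRing c d) where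
  private
    module A = CommutativeRing A
    module B = CommutativeRing B
  open Algebra.Properties.Ring B.ring using (+-identityʳ-unique; +-inverseʳ-unique)

  ringHomomorphism : {f : A.Carrier → B.Carrier} →
    (∀ {x y} → x A.≈ y → f x B.≈ f y) →
    (∀ x y → f (x A.+ y) B.≈ f x B.+ f y) →
    (∀ x y → f (x A.* y) B.≈ f x B.* f y) →
    f A.1# B.≈ B.1# →
    IsRingHomomorphism A.rawRing B.rawRing f
  ringHomomorphism {f} f-cong f-+ f-* f-1 = record
    { isSemiringHomomorphism = record
      { isNearSemiringHomomorphism = record
        { +-isMonoidHomomorphism = record
          { isMagmaHomomorphism = record { isRelHomomorphism = record { cong = f-cong } ; homo = f-+ }
          ; ε-homo = f-0 }
        ; *-homo = f-* }
      ; 1#-homo = f-1 }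
    ; -‿homo = λ x → +-inverseʳ-unique (f x) (f (A.- x))
        (B.trans (B.sym (f-+ x (A.- x))) (B.trans (f-cong (A.-‿inverseʳ x)) f-0))
    }
    where
    f-0 : f A.0# B.≈ B.0#
    f-0 = +-identityʳ-unique (f A.0#) (f A.0#)
      (B.trans (B.sym (f-+ A.0# A.0#)) (f-cong (A.+-identityʳ A.0#)))

module _ {a b : Level} (A : CommutativeRing a b) where
  open CommutativeRing A

  NoZeroDivisors : Set (a ⊔ b)
  NoZeroDivisors = ∀ x y → x * y ≈ 0# → x ≈ 0# ⊎ y ≈ 0#

  horner : List Carrier → Carrier → Carrier
  horner []       z = 0#
  horner (x ∷ xs) z = x + z * horner xs z

  horner-cong : ∀ {xs ys} z → ListPointwise.Pointwise _≈_ xs ys → horner xs z ≈ horner ys z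
  horner-cong z []       = refl
  horner-cong z (p ∷ ps) = +-cong p (*-congˡ (horner-cong z ps))

module _ {a b c d : Level} (A : CommutativeRing a b) (B : CommutativeRing c d)
         {f : CommutativeRing.Carrier A → CommutativeRing.Carrier B}
         (isHom : IsRingHomomorphism (CommutativeRing.rawRing A) (CommutativeRing.rawRing B) f) where
  private
    module A = CommutativeRing A
    module B = CommutativeRing B
  open IsRingHomomorphism isHom

  horner-homo : ∀ xs z → f (horner A xs z) B.≈ horner B (List.map f xs) (f z)
  horner-homo []       z = 0#-homo
  horner-homo (x ∷ xs) z =
    B.trans (+-homo x _) (B.+-congˡ (B.trans (*-homo z _) (B.*-congˡ (horner-homo xs z))))

module DerivationProperties {a b : Level} (A : CommutativeRing a b) {D : CommutativeRing.Carrier A → CommutativeRing.Carrier A}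
                            (isDerivation : IsDerivation A D) where
  open CommutativeRing A
  open IsDerivation isDerivation
  open Algebra.Properties.Ring ring using (+-identityʳ-unique; +-inverseʳ-unique)

  D-0 : D 0# ≈ 0#
  D-0 = +-identityʳ-unique _ _ (trans (sym (+-rule 0# 0#)) (D-cong (+-identityʳ 0#)))

  D-1 : D 1# ≈ 0#
  D-1 = +-identityʳ-unique _ _ (trans (+-cong (sym (*-identityʳ _)) (sym (*-identityˡ _)))
    (trans (sym (leibniz 1# 1#)) (D-cong (*-identityˡ 1#))))

  D-neg : ∀ x → D (- x) ≈ - D x
  D-neg x = +-inverseʳ-unique _ _ (trans (sym (+-rule x (- x))) (trans (D-cong (-‿inverseʳ x)) D-0))

-- Formal power series

module PowerSeries {ℓ : Level} (A : CommutativeRing ℓ ℓ) where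
  private
    module A = CommutativeRing A
  open A using (Carrier; _≈_; _+_; _*_; -_; 0#; 1#)
  open RingSolver A using (solve; _:=_; _:+_; _:*_; :-_; _:-_; :0; :1)

  Series : Set ℓ
  Series = ℕ → Carrier

  infix 4 _≋_
  _≋_ : Series → Series → Set ℓ
  f ≋ g = ∀ n → f n ≈ g n

  tail : Series → Series
  tail f n = f (suc n)

  infixl 7 _⊛_
  -- The Cauchy product, computed from f = f₀ + Y · `tail f`.
  _⊛_ : Series → Series → Series
  (f ⊛ g) zero    = f 0 * g 0
  (f ⊛ g) (suc n) = f 0 * g (suc n) + (tail f ⊛ g) n

  const : Carrier → Series
  const c zero    = c
  const c (suc _) = 0#

  Y : Series
  Y zero    = 0#
  Y (suc n) = const 1# n

  private
    zeros : Series
    zeros _ = 0#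

    ⊛-cong : ∀ {f g h k} → f ≋ g → h ≋ k → f ⊛ h ≋ g ⊛ k
    ⊛-cong p q zero    = A.*-cong (p 0) (q 0)
    ⊛-cong p q (suc n) = A.+-cong (A.*-cong (p 0) (q (suc n))) (⊛-cong (λ i → p (suc i)) q n)

    0⊛ : ∀ g → zeros ⊛ g ≋ zeros
    0⊛ g zero    = A.zeroˡ (g 0)
    0⊛ g (suc n) = A.trans (A.+-cong (A.zeroˡ _) (0⊛ g n)) (A.+-identityʳ 0#)

    -- The definition of `⊛` peels off the first factor; this is the mirrored recursion, on which
    -- commutativity rests.
    ⊛-sucʳ : ∀ f g n → (f ⊛ g) (suc n) ≈ (f ⊛ tail g) n + f (suc n) * g 0
    ⊛-sucʳ f g zero    = A.refl
    ⊛-sucʳ f g (suc n) = A.trans (A.+-congˡ (⊛-sucʳ (tail f) g n)) (A.sym (A.+-assoc _ _ _))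

    ⊛-comm : ∀ f g → f ⊛ g ≋ g ⊛ f
    ⊛-comm f g zero    = A.*-comm (f 0) (g 0)
    ⊛-comm f g (suc n) = A.trans (A.+-cong (A.*-comm _ _) (⊛-comm (tail f) g n))
      (A.trans (A.+-comm _ _) (A.sym (⊛-sucʳ g f n)))

    ⊛-distribʳ : ∀ h f g → (λ n → f n + g n) ⊛ h ≋ λ n → (f ⊛ h) n + (g ⊛ h) n
    ⊛-distribʳ h f g zero    = A.distribʳ _ _ _
    ⊛-distribʳ h f g (suc n) = A.trans (A.+-congˡ (⊛-distribʳ h (tail f) (tail g) n))
      (solve 5 (λ a b c u v → (a :+ b) :* c :+ (u :+ v) := (a :* c :+ u) :+ (b :* c :+ v)) A.refl _ _ _ _ _)

    ⊛-scale : ∀ c f g → (λ n → c * f n) ⊛ g ≋ λ n → c * (f ⊛ g) n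
    ⊛-scale c f g zero    = A.*-assoc c (f 0) (g 0)
    ⊛-scale c f g (suc n) = A.trans (A.+-congˡ (⊛-scale c (tail f) g n))
      (solve 4 (λ c a b u → c :* a :* b :+ c :* u := c :* (a :* b :+ u)) A.refl _ _ _ _)

    ⊛-assoc : ∀ f g h → (f ⊛ g) ⊛ h ≋ f ⊛ (g ⊛ h)
    ⊛-assoc f g h zero    = A.*-assoc (f 0) (g 0) (h 0)
    ⊛-assoc f g h (suc n) = A.trans
      (A.+-congˡ (A.trans (⊛-distribʳ h (λ i → f 0 * g (suc i)) (tail f ⊛ g) n)
        (A.+-cong (⊛-scale (f 0) (tail g) h n) (⊛-assoc (tail f) g h n))))
      (solve 5 (λ a b c u v → a :* b :* c :+ (a :* u :+ v) := a :* (b :* c :+ u) :+ v) A.refl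
        (f 0) (g 0) (h (suc n)) ((tail g ⊛ h) n) ((tail f ⊛ (g ⊛ h)) n))

  const-⊛ : ∀ c f n → (const c ⊛ f) n ≈ c * f n
  const-⊛ c f zero    = A.refl
  const-⊛ c f (suc n) = A.trans (A.+-congˡ (0⊛ f n)) (A.+-identityʳ _)

  private
    ⊛-identityˡ : ∀ f → const 1# ⊛ f ≋ f
    ⊛-identityˡ f n = A.trans (const-⊛ 1# f n) (A.*-identityˡ (f n))

  commutativeRing : CommutativeRing ℓ ℓ
  commutativeRing = record
    { Carrier = Series
    ; _≈_ = _≋_
    ; _+_ = λ f g n → f n + g n
    ; _*_ = _⊛_
    ; -_  = λ f n → - f n
    ; 0#  = zeros
    ; 1#  = const 1#
    ; isCommutativeRing = record
      { isRing = record
        { +-isAbelianGroup = record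
          { isGroup = record
            { isMonoid = record
              { isSemigroup = record
                { isMagma = record
                  { isEquivalence = record
                    { refl  = λ n → A.refl
                    ; sym   = λ p n → A.sym (p n)
                    ; trans = λ p q n → A.trans (p n) (q n)
                    }
                  ; ∙-cong = λ p q n → A.+-cong (p n) (q n)
                  }
                ; assoc = λ f g h n → A.+-assoc (f n) (g n) (h n)
                }
              ; identity = (λ f n → A.+-identityˡ (f n)) , (λ f n → A.+-identityʳ (f n))
              }
            ; inverse = (λ f n → A.-‿inverseˡ (f n)) , (λ f n → A.-‿inverseʳ (f n))
            ; ⁻¹-cong = λ p n → A.-‿cong (p n)
            }
          ; comm = λ f g n → A.+-comm (f n) (g n)
          }
        ; *-cong     = ⊛-cong
        ; *-assoc    = ⊛-assoc
        ; *-identity = ⊛-identityˡ , (λ f n → A.trans (⊛-comm f (const 1#) n) (⊛-identityˡ f n))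
        ; distrib    = (λ f g h n → A.trans (⊛-comm f (λ i → g i + h i) n)
                          (A.trans (⊛-distribʳ f g h n) (A.+-cong (⊛-comm g f n) (⊛-comm h f n))))
                     , ⊛-distribʳ
        }
      ; *-comm = ⊛-comm
      }
    }

  const-isHom : IsRingHomomorphism A.rawRing (CommutativeRing.rawRing commutativeRing) const
  const-isHom = ringHomomorphism A commutativeRing
    (λ { p zero → p ; p (suc n) → A.refl })
    (λ { x y zero → A.refl ; x y (suc n) → A.sym (A.+-identityʳ 0#) })
    (λ { x y zero → A.refl ; x y (suc n) → A.sym (A.trans (const-⊛ x (const y) (suc n)) (A.zeroʳ x)) })
    (λ n → A.refl)

  private
    Y⊛-suc : ∀ f n → (Y ⊛ f) (suc n) ≈ f n
    Y⊛-suc f n = A.trans (A.+-cong (A.zeroˡ _) (⊛-identityˡ f n)) (A.+-identityˡ (f n))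

  -- In c + Y · p the lowest coefficient is c and the tail is p, so the coefficients can be read off
  -- one after another.
  Y-transcendental : ∀ cs → horner commutativeRing (List.map const cs) Y ≋ (λ _ → 0#) → All (_≈ 0#) cs
  Y-transcendental []       _ = []
  Y-transcendental (c ∷ cs) e =
    A.trans (A.sym (A.trans (A.+-congˡ (A.zeroˡ _)) (A.+-identityʳ c))) (e 0) ∷
    Y-transcendental cs λ n → A.trans (A.sym (A.trans (A.+-identityˡ _) (Y⊛-suc _ n))) (e (suc n))

  module _ (em : ExcludedMiddle ℓ) (domain : NoZeroDivisors A) where
    private
      cancel : ∀ {x y} → ¬ x ≈ 0# → x * y ≈ 0# → y ≈ 0#
      cancel {x} {y} x≉0 e with domain x y e
      ... | inj₁ x≈0 = contradiction x≈0 x≉0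
      ... | inj₂ y≈0 = y≈0

      -- Zeros in front of the first nonzero coefficient of f are dropped; after that, each
      -- coefficient of the product forces one more coefficient of g to vanish.
      coefficient-zero : ∀ i j f g → ¬ f i ≈ 0# → f ⊛ g ≋ zeros → g j ≈ 0#
      coefficient-zero zero    zero    f g f≉0 e = cancel f≉0 (e 0)
      coefficient-zero zero    (suc j) f g f≉0 e = coefficient-zero zero j f (tail g) f≉0 λ n → A.trans
        (A.sym (A.trans (⊛-sucʳ f g n)
          (A.trans (A.+-congˡ (A.trans (A.*-congˡ (cancel f≉0 (e 0))) (A.zeroʳ _))) (A.+-identityʳ _))))
        (e (suc n))
      coefficient-zero (suc i) j f g f≉0 e with em {f 0 ≈ 0#}
      ... | no f₀≉0  = coefficient-zero zero j f g f₀≉0 e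
      ... | yes f₀≈0 = coefficient-zero i j (tail f) g f≉0 λ n → A.trans
        (A.sym (A.trans (A.+-congʳ (A.trans (A.*-congʳ f₀≈0) (A.zeroˡ _))) (A.+-identityˡ _)))
        (e (suc n))

    noZeroDivisors : NoZeroDivisors commutativeRing
    noZeroDivisors f g e with em {∃ λ i → ¬ f i ≈ 0#}
    ... | yes (i , fᵢ≉0) = inj₂ λ j → coefficient-zero i j f g fᵢ≉0 e
    ... | no all         = inj₁ λ i → vanish i em
      where
      vanish : ∀ i → Dec (f i ≈ 0#) → f i ≈ 0#
      vanish i (yes p) = p
      vanish i (no ¬p) = contradiction (i , ¬p) all

-- Independent transcendentals over a domain

-- The union of L ⊆ L[[y₀]] ⊆ L[[y₀]][[y₁]] ⊆ ⋯, as eventually coherent sequences.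
module Tower {ℓ : Level} (L : CommutativeRing ℓ ℓ) where

  stage : ℕ → CommutativeRing ℓ ℓ
  stage zero    = L
  stage (suc N) = PowerSeries.commutativeRing (stage N)

  private
    module S (N : ℕ) = CommutativeRing (stage N)

    up : ∀ N → S.Carrier N → S.Carrier (suc N)
    up N = PowerSeries.const (stage N)

    module Up (N : ℕ) = IsRingHomomorphism (PowerSeries.const-isHom (stage N))

    up-injective : ∀ N {x y} → S._≈_ (suc N) (up N x) (up N y) → S._≈_ N x y
    up-injective N e = e 0

    Eventually : (ℕ → Set ℓ) → Set ℓ
    Eventually P = ∃ λ N₀ → ∀ N → N₀ ≤ N → P N

    eventually₂ : {P Q R : ℕ → Set ℓ} → (∀ N → P N → Q N → R N) → Eventually P → Eventually Q → Eventually R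
    eventually₂ f (M , p) (N , q) = M ℕ.⊔ N , λ k M⊔N≤k →
      f k (p k (ℕ.≤-trans (ℕ.m≤m⊔n M N) M⊔N≤k)) (q k (ℕ.≤-trans (ℕ.m≤n⊔m M N) M⊔N≤k))

    eventually₁ : {P R : ℕ → Set ℓ} → (∀ N → P N → R N) → Eventually P → Eventually R
    eventually₁ f (M , p) = M , λ k M≤k → f k (p k M≤k)

    always : {P : ℕ → Set ℓ} → (∀ N → P N) → Eventually P
    always p = 0 , λ N _ → p N

    Sequence : Set ℓ
    Sequence = ∀ N → S.Carrier N

    Coherent : Sequence → Set ℓ
    Coherent f = Eventually λ N → S._≈_ (suc N) (f (suc N)) (up N (f N))

    infix 4 _≃_
    record _≃_ (u v : Σ Sequence Coherent) : Set ℓ where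
      constructor from
      field to : Eventually λ N → S._≈_ N (proj₁ u N) (proj₁ v N)
    open _≃_

  ring : CommutativeRing ℓ ℓ
  ring = record
    { Carrier = Σ Sequence Coherent
    ; _≈_ = _≃_
    ; _+_ = λ (f , p) (g , q) → (λ N → S._+_ N (f N) (g N)) ,
        eventually₂ (λ N p q → S.trans (suc N) (S.+-cong (suc N) p q) (S.sym (suc N) (Up.+-homo N _ _))) p q
    ; _*_ = λ (f , p) (g , q) → (λ N → S._*_ N (f N) (g N)) ,
        eventually₂ (λ N p q → S.trans (suc N) (S.*-cong (suc N) p q) (S.sym (suc N) (Up.*-homo N _ _))) p q
    ; -_  = λ (f , p) → (λ N → S.-_ N (f N)) ,
        eventually₁ (λ N p → S.trans (suc N) (S.-‿cong (suc N) p) (S.sym (suc N) (Up.-‿homo N _))) p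
    ; 0#  = S.0# , always λ N → S.sym (suc N) (Up.0#-homo N)
    ; 1#  = S.1# , always λ N → S.sym (suc N) (Up.1#-homo N)
    ; isCommutativeRing = record
      { isRing = record
        { +-isAbelianGroup = record
          { isGroup = record
            { isMonoid = record
              { isSemigroup = record
                { isMagma = record
                  { isEquivalence = record
                    { refl  = from (always λ N → S.refl N)
                    ; sym   = λ p → from (eventually₁ (λ N → S.sym N) (to p))
                    ; trans = λ p q → from (eventually₂ (λ N → S.trans N) (to p) (to q))
                    }
                  ; ∙-cong = λ p q → from (eventually₂ (λ N → S.+-cong N) (to p) (to q))
                  }
                ; assoc = λ (f , _) (g , _) (h , _) → from (always λ N → S.+-assoc N (f N) (g N) (h N))
                }
              ; identity = (λ (f , _) → from (always λ N → S.+-identityˡ N (f N)))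
                         , (λ (f , _) → from (always λ N → S.+-identityʳ N (f N)))
              }
            ; inverse = (λ (f , _) → from (always λ N → S.-‿inverseˡ N (f N)))
                      , (λ (f , _) → from (always λ N → S.-‿inverseʳ N (f N)))
            ; ⁻¹-cong = λ p → from (eventually₁ (λ N → S.-‿cong N) (to p))
            }
          ; comm = λ (f , _) (g , _) → from (always λ N → S.+-comm N (f N) (g N))
          }
        ; *-cong     = λ p q → from (eventually₂ (λ N → S.*-cong N) (to p) (to q))
        ; *-assoc    = λ (f , _) (g , _) (h , _) → from (always λ N → S.*-assoc N (f N) (g N) (h N))
        ; *-identity = (λ (f , _) → from (always λ N → S.*-identityˡ N (f N)))
                     , (λ (f , _) → from (always λ N → S.*-identityʳ N (f N)))
        ; distrib    = (λ (f , _) (g , _) (h , _) → from (always λ N → S.distribˡ N (f N) (g N) (h N)))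
                     , (λ (f , _) (g , _) (h , _) → from (always λ N → S.distribʳ N (f N) (g N) (h N)))
        }
      ; *-comm = λ (f , _) (g , _) → from (always λ N → S.*-comm N (f N) (g N))
      }
    }

  private
    module B = CommutativeRing ring

    vanish-up : (f : Sequence) → ∀ M → (∀ N → M ≤ N → S._≈_ (suc N) (f (suc N)) (up N (f N))) →
                S._≈_ M (f M) (S.0# M) → ∀ N → M ≤ N → S._≈_ N (f N) (S.0# N)
    vanish-up f M p e N M≤N with ℕ.≤⇒≤′ M≤N
    ... | M≤′N = go M≤′N
      where
      go : ∀ {N} → M ℕ.≤′ N → S._≈_ N (f N) (S.0# N)
      go ℕ.≤′-refl = e
      go (ℕ.≤′-step {N} q) = S.trans (suc N) (p N (ℕ.≤′⇒≤ q))
        (S.trans (suc N) (Up.⟦⟧-cong N (go q)) (Up.0#-homo N))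

  module _ (em : ExcludedMiddle ℓ) (domain : NoZeroDivisors L) where
    private
      stage-domain : ∀ N → NoZeroDivisors (stage N)
      stage-domain zero    = domain
      stage-domain (suc N) = PowerSeries.noZeroDivisors (stage N) em (stage-domain N)

    -- At a stage O from which both sequences are coherent and the product vanishes, one factor is
    -- zero because that stage is a domain. Coherence carries this zero to all later stages.
    noZeroDivisors : NoZeroDivisors ring
    noZeroDivisors (f , M , p) (g , N , q) (from (k , e)) with stage-domain O (f O) (g O) (e O k≤O)
      where
      O = M ℕ.⊔ N ℕ.⊔ k
      k≤O = ℕ.m≤n⊔m (M ℕ.⊔ N) k
    ... | inj₁ z = inj₁ (from (O , vanish-up f O (λ i O≤i → p i (ℕ.≤-trans M≤O O≤i)) z))
      where
      O = M ℕ.⊔ N ℕ.⊔ k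
      M≤O = ℕ.≤-trans (ℕ.m≤m⊔n M N) (ℕ.m≤m⊔n (M ℕ.⊔ N) k)
    ... | inj₂ z = inj₂ (from (O , vanish-up g O (λ i O≤i → q i (ℕ.≤-trans N≤O O≤i)) z))
      where
      O = M ℕ.⊔ N ℕ.⊔ k
      N≤O = ℕ.≤-trans (ℕ.m≤n⊔m M N) (ℕ.m≤m⊔n (M ℕ.⊔ N) k)

  private
    -- The entries below stage N are junk.
    along : ∀ N → S.Carrier N → Sequence
    along N x zero with N ℕ.≟ 0
    ... | yes ≡.refl = x
    ... | no _       = S.0# 0
    along N x (suc M) with N ℕ.≟ suc M
    ... | yes ≡.refl = x
    ... | no _       = up M (along N x M)

    along-self : ∀ N x → S._≈_ N (along N x N) x
    along-self zero    x = S.refl 0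
    along-self (suc N) x with suc N ℕ.≟ suc N
    ... | yes ≡.refl = S.refl (suc N)
    ... | no ¬e      = contradiction ≡.refl ¬e

    along-step : ∀ N x M → N ≤ M → S._≈_ (suc M) (along N x (suc M)) (up M (along N x M))
    along-step N x M N≤M with N ℕ.≟ suc M
    ... | yes ≡.refl = contradiction N≤M ℕ.1+n≰n
    ... | no _       = S.refl (suc M)

  inject : ∀ N → S.Carrier N → B.Carrier
  inject N x = along N x , N , along-step N x

  private
    determined : ∀ {u v} N → (∀ M → N ≤ M → S._≈_ (suc M) (proj₁ u (suc M)) (up M (proj₁ u M))) →
                 (∀ M → N ≤ M → S._≈_ (suc M) (proj₁ v (suc M)) (up M (proj₁ v M))) →
                 S._≈_ N (proj₁ u N) (proj₁ v N) → u B.≈ v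
    determined {f , _} {g , _} N p q e = from (N , λ M N≤M → go (ℕ.≤⇒≤′ N≤M))
      where
      go : ∀ {M} → N ℕ.≤′ M → S._≈_ M (f M) (g M)
      go ℕ.≤′-refl = e
      go (ℕ.≤′-step {M} r) = S.trans (suc M) (p M (ℕ.≤′⇒≤ r))
        (S.trans (suc M) (Up.⟦⟧-cong M (go r)) (S.sym (suc M) (q M (ℕ.≤′⇒≤ r))))

  inject-isHom : ∀ N → IsRingHomomorphism (S.rawRing N) B.rawRing (inject N)
  inject-isHom N = ringHomomorphism (stage N) ring
    (λ {x} {y} e → determined {inject N x} {inject N y} N (along-step N x) (along-step N y)
      (S.trans N (along-self N x) (S.trans N e (S.sym N (along-self N y)))))
    (λ x y → determined {inject N (S._+_ N x y)} {inject N x B.+ inject N y} N (along-step N _)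
      (λ M r → S.trans (suc M) (S.+-cong (suc M) (along-step N x M r) (along-step N y M r))
        (S.sym (suc M) (Up.+-homo M _ _)))
      (S.trans N (along-self N _) (S.sym N (S.+-cong N (along-self N x) (along-self N y)))))
    (λ x y → determined {inject N (S._*_ N x y)} {inject N x B.* inject N y} N (along-step N _)
      (λ M r → S.trans (suc M) (S.*-cong (suc M) (along-step N x M r) (along-step N y M r))
        (S.sym (suc M) (Up.*-homo M _ _)))
      (S.trans N (along-self N _) (S.sym N (S.*-cong N (along-self N x) (along-self N y)))))
    (determined {inject N (S.1# N)} {B.1#} N (along-step N _) (λ M _ → S.sym (suc M) (Up.1#-homo M)) (along-self N _))

  inject-up : ∀ N x → inject N x B.≈ inject (suc N) (up N x)
  inject-up N x = determined {inject N x} {inject (suc N) (up N x)} (suc N)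
    (λ M r → along-step N x M (ℕ.≤-trans (ℕ.n≤1+n N) r)) (along-step (suc N) (up N x))
    (S.trans (suc N) (along-step N x N ℕ.≤-refl)
      (S.trans (suc N) (Up.⟦⟧-cong N (along-self N x)) (S.sym (suc N) (along-self (suc N) (up N x)))))

  inject-injective : ∀ N {x y} → inject N x B.≈ inject N y → S._≈_ N x y
  inject-injective N {x} {y} (from (k , e)) =
    S.trans N (S.sym N (along-self N x)) (S.trans N (down (ℕ.≤⇒≤′ (ℕ.m≤m⊔n N k)) (e (N ℕ.⊔ k) (ℕ.m≤n⊔m N k))) (along-self N y))
    where
    down : ∀ {M} → N ℕ.≤′ M → S._≈_ M (along N x M) (along N y M) → S._≈_ N (along N x N) (along N y N)
    down ℕ.≤′-refl e = e
    down (ℕ.≤′-step {M} r) e = down r (up-injective M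
      (S.trans (suc M) (S.sym (suc M) (along-step N x M (ℕ.≤′⇒≤ r)))
        (S.trans (suc M) e (along-step N y M (ℕ.≤′⇒≤ r)))))

  module Inject (N : ℕ) = IsRingHomomorphism (inject-isHom N)

  In : ℕ → B.Carrier → Set ℓ
  In N x = ∃ λ c → x B.≈ inject N c

  In-resp : ∀ {N x y} → x B.≈ y → In N x → In N y
  In-resp e (c , p) = c , B.trans (B.sym e) p

  In-+ : ∀ {N x y} → In N x → In N y → In N (x B.+ y)
  In-+ {N} (c , p) (d , q) = S._+_ N c d , B.trans (B.+-cong p q) (B.sym (Inject.+-homo N c d))

  In-* : ∀ {N x y} → In N x → In N y → In N (x B.* y)
  In-* {N} (c , p) (d , q) = S._*_ N c d , B.trans (B.*-cong p q) (B.sym (Inject.*-homo N c d))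

  In-neg : ∀ {N x} → In N x → In N (B.- x)
  In-neg {N} (c , p) = S.-_ N c , B.trans (B.-‿cong p) (B.sym (Inject.-‿homo N c))

  In-suc : ∀ {N x} → In N x → In (suc N) x
  In-suc {N} (c , p) = up N c , B.trans p (inject-up N c)

  In-mono : ∀ {M N x} → M ≤ N → In M x → In N x
  In-mono M≤N p = go (ℕ.≤⇒≤′ M≤N) p
    where
    go : ∀ {M N x} → M ℕ.≤′ N → In M x → In N x
    go ℕ.≤′-refl     p = p
    go (ℕ.≤′-step q) p = In-suc (go q p)

  generator : ℕ → B.Carrier
  generator N = inject (suc N) (PowerSeries.Y (stage N))

  In-generator : ∀ N → In (suc N) (generator N)
  In-generator N = PowerSeries.Y (stage N) , B.refl

  -- The coefficients come from stage N, so in the next stage they are constant power series and the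
  -- generator is `Y`; since `inject` is injective, `Y-transcendental` applies there.
  generator-transcendental : ∀ N {cs} → All (In N) cs → horner ring cs (generator N) B.≈ B.0# → All (B._≈ B.0#) cs
  generator-transcendental N {cs} ins e = descend ins (PowerSeries.Y-transcendental (stage N) (preimages ins)
      (inject-injective (suc N) {horner (stage (suc N)) (List.map (up N) (preimages ins)) (PowerSeries.Y (stage N))} {S.0# (suc N)}
        (B.trans (horner-homo (stage (suc N)) ring (inject-isHom (suc N)) (List.map (up N) (preimages ins)) (PowerSeries.Y (stage N)))
          (B.trans (B.sym (horner-cong ring (generator N) (lifts ins))) (B.trans e (B.sym (Inject.0#-homo (suc N))))))))
    where
    preimages : ∀ {cs} → All (In N) cs → List (S.Carrier N)
    preimages []             = []
    preimages ((c , _) ∷ ps) = c ∷ preimages ps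
    lifts : ∀ {cs} (ps : All (In N) cs) → ListPointwise.Pointwise B._≈_ cs (List.map (inject (suc N)) (List.map (up N) (preimages ps)))
    lifts []             = []
    lifts ((c , p) ∷ ps) = B.trans p (inject-up N c) ∷ lifts ps
    descend : ∀ {cs} (ps : All (In N) cs) → All (λ c → S._≈_ N c (S.0# N)) (preimages ps) → All (B._≈ B.0#) cs
    descend []             []       = []
    descend ((c , p) ∷ ps) (z ∷ zs) =
      B.trans p (B.trans (Inject.⟦⟧-cong N z) (Inject.0#-homo N)) ∷ descend ps zs

-- Independent transcendentals y₀, y₁, … over L; In N x says that x involves only y₀, …, y_{N-1}.
record FreeExtension {ℓ : Level} (L : CommutativeRing ℓ ℓ) : Set (lsuc ℓ) where
  private
    module L = CommutativeRing L
  field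
    ring : CommutativeRing ℓ ℓ
  open CommutativeRing ring hiding (ring)
  field
    noZeroDivisors : NoZeroDivisors ring
    emb            : L.Carrier → Carrier
    emb-isMono     : IsRingMonomorphism L.rawRing rawRing emb
    In             : ℕ → Carrier → Set ℓ
    In-resp        : ∀ {N x y} → x ≈ y → In N x → In N y
    In-+           : ∀ {N x y} → In N x → In N y → In N (x + y)
    In-*           : ∀ {N x y} → In N x → In N y → In N (x * y)
    In-neg         : ∀ {N x} → In N x → In N (- x)
    In-emb         : ∀ N b → In N (emb b)
    In-suc         : ∀ {N x} → In N x → In (suc N) x
    generator      : ℕ → Carrier
    In-generator   : ∀ N → In (suc N) (generator N)
    transcendental : ∀ N {cs} → All (In N) cs → horner ring cs (generator N) ≈ 0# → All (_≈ 0#) cs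

freeExtension : {ℓ : Level} → ExcludedMiddle ℓ → (L : CommutativeRing ℓ ℓ) → NoZeroDivisors L → FreeExtension L
freeExtension em L domain = record
  { ring           = ring
  ; noZeroDivisors = noZeroDivisors em domain
  ; emb            = inject 0
  ; emb-isMono     = record { isRingHomomorphism = inject-isHom 0 ; injective = inject-injective 0 }
  ; In             = In
  ; In-resp        = In-resp
  ; In-+           = In-+
  ; In-*           = In-*
  ; In-neg         = In-neg
  ; In-emb         = λ N b → In-mono {0} {N} z≤n (b , CommutativeRing.refl ring)
  ; In-suc         = In-suc
  ; generator      = generator
  ; In-generator   = In-generator
  ; transcendental = generator-transcendental
  }
  where open Tower L

-- Differential polynomials

module DifferentialPolynomials {m : ℕ} {ℓ : Level} (K : DifferentialField m ℓ) (n : ℕ) where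
  open Variables m n
  open Numbering m n
  private
    module K = DifferentialField K
    module ∂ (i : Fin m) = IsDerivation (K.isDerivation i)

  infixl 6 _⊕_
  infixl 7 _⊗_
  infix  8 ⊖_
  -- Syntax without imposed equations: `D` and `sep` become plain recursions, and identities are
  -- stated either by `∼` or between values at a point.
  data Term : Set ℓ where
    con     : K.Carrier → Term
    var     : Var → Term
    _⊕_ _⊗_ : Term → Term → Term
    ⊖_      : Term → Term

  D : Fin m → Term → Term
  D i (con c) = con (K.∂ i c)
  D i (var v) = var (v ↑ i)
  D i (t ⊕ u) = D i t ⊕ D i u
  D i (t ⊗ u) = D i t ⊗ u ⊕ t ⊗ D i u
  D i (⊖ t)   = ⊖ D i t

  -- ∂t/∂x_v, which is the separant of t if v is its leader.
  sep : Var → Term → Term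
  sep v (con c) = con K.0#
  sep v (var u) with u ≟ᵛ v
  ... | yes _   = con K.1#
  ... | no _    = con K.0#
  sep v (t ⊕ u) = sep v t ⊕ sep v u
  sep v (t ⊗ u) = sep v t ⊗ u ⊕ t ⊗ sep v u
  sep v (⊖ t)   = ⊖ sep v t

  data Over (P : Var → Set) : Term → Set ℓ where
    con : ∀ {c} → Over P (con c)
    var : ∀ {v} → P v → Over P (var v)
    _⊕_ : ∀ {t u} → Over P t → Over P u → Over P (t ⊕ u)
    _⊗_ : ∀ {t u} → Over P t → Over P u → Over P (t ⊗ u)
    ⊖_  : ∀ {t} → Over P t → Over P (⊖ t)

  module _ {P Q : Var → Set} where

    Over-map : (∀ v → P v → Q v) → ∀ {t} → Over P t → Over Q t
    Over-map f con     = con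
    Over-map f (var p) = var (f _ p)
    Over-map f (p ⊕ q) = Over-map f p ⊕ Over-map f q
    Over-map f (p ⊗ q) = Over-map f p ⊗ Over-map f q
    Over-map f (⊖ p)   = ⊖ Over-map f p

    Over-D : ∀ i → (∀ v → P v → Q v) → (∀ v → P v → Q (v ↑ i)) → ∀ {t} → Over P t → Over Q (D i t)
    Over-D i f g con     = con
    Over-D i f g (var p) = var (g _ p)
    Over-D i f g (p ⊕ q) = Over-D i f g p ⊕ Over-D i f g q
    Over-D i f g (p ⊗ q) = Over-D i f g p ⊗ Over-map f q ⊕ Over-map f p ⊗ Over-D i f g q
    Over-D i f g (⊖ p)   = ⊖ Over-D i f g p

  module _ {P : Var → Set} where

    Over-sep : ∀ v {t} → Over P t → Over P (sep v t)
    Over-sep v con             = con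
    Over-sep v (var {u} _) with u ≟ᵛ v
    ... | yes _                = con
    ... | no _                 = con
    Over-sep v (p ⊕ q)         = Over-sep v p ⊕ Over-sep v q
    Over-sep v (p ⊗ q)         = Over-sep v p ⊗ q ⊕ p ⊗ Over-sep v q
    Over-sep v (⊖ p)           = ⊖ Over-sep v p

  -- The part of ring equality that makes the D i commute; unlike equality of values at a point,
  -- it is respected by D and sep for trivial reasons.
  infix 4 _∼_
  data _∼_ : Term → Term → Set ℓ where
    ∼-refl  : ∀ {t} → t ∼ t
    ∼-sym   : ∀ {t u} → t ∼ u → u ∼ t
    ∼-trans : ∀ {t u v} → t ∼ u → u ∼ v → t ∼ v
    con     : ∀ {c d} → c K.≈ d → con c ∼ con d
    _⊕_     : ∀ {t u v w} → t ∼ u → v ∼ w → t ⊕ v ∼ u ⊕ w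
    _⊗_     : ∀ {t u v w} → t ∼ u → v ∼ w → t ⊗ v ∼ u ⊗ w
    ⊖_      : ∀ {t u} → t ∼ u → ⊖ t ∼ ⊖ u
    middle  : ∀ t u v w → (t ⊕ u) ⊕ (v ⊕ w) ∼ (t ⊕ v) ⊕ (u ⊕ w)

  ∼-reflexive : ∀ {t u} → t ≡ u → t ∼ u
  ∼-reflexive ≡.refl = ∼-refl

  D-cong : ∀ i {t u} → t ∼ u → D i t ∼ D i u
  D-cong i ∼-refl           = ∼-refl
  D-cong i (∼-sym p)        = ∼-sym (D-cong i p)
  D-cong i (∼-trans p q)    = ∼-trans (D-cong i p) (D-cong i q)
  D-cong i (con e)          = con (∂.D-cong i e)
  D-cong i (p ⊕ q)          = D-cong i p ⊕ D-cong i q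
  D-cong i (p ⊗ q)          = D-cong i p ⊗ q ⊕ p ⊗ D-cong i q
  D-cong i (⊖ p)            = ⊖ D-cong i p
  D-cong i (middle t u v w) = middle (D i t) (D i u) (D i v) (D i w)

  sep-cong : ∀ v {t u} → t ∼ u → sep v t ∼ sep v u
  sep-cong v ∼-refl           = ∼-refl
  sep-cong v (∼-sym p)        = ∼-sym (sep-cong v p)
  sep-cong v (∼-trans p q)    = ∼-trans (sep-cong v p) (sep-cong v q)
  sep-cong v (con e)          = ∼-refl
  sep-cong v (p ⊕ q)          = sep-cong v p ⊕ sep-cong v q
  sep-cong v (p ⊗ q)          = sep-cong v p ⊗ q ⊕ p ⊗ sep-cong v q
  sep-cong v (⊖ p)            = ⊖ sep-cong v p
  sep-cong v (middle t u w z) = middle (sep v t) (sep v u) (sep v w) (sep v z)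

  -- The rules of `∼` rearrange summands but never create or cancel any, so both sides contain the
  -- same variables.
  Over-∼ : ∀ {P t u} → t ∼ u → (Over P t → Over P u) × (Over P u → Over P t)
  Over-∼ ∼-refl           = (λ p → p) , (λ p → p)
  Over-∼ (∼-sym e)        = proj₂ (Over-∼ e) , proj₁ (Over-∼ e)
  Over-∼ (∼-trans e f)    = proj₁ (Over-∼ f) ∘ proj₁ (Over-∼ e) , proj₂ (Over-∼ e) ∘ proj₂ (Over-∼ f)
  Over-∼ (con _)          = (λ { con → con }) , (λ { con → con })
  Over-∼ (e ⊕ f)          = (λ { (p ⊕ q) → proj₁ (Over-∼ e) p ⊕ proj₁ (Over-∼ f) q })
                          , (λ { (p ⊕ q) → proj₂ (Over-∼ e) p ⊕ proj₂ (Over-∼ f) q })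
  Over-∼ (e ⊗ f)          = (λ { (p ⊗ q) → proj₁ (Over-∼ e) p ⊗ proj₁ (Over-∼ f) q })
                          , (λ { (p ⊗ q) → proj₂ (Over-∼ e) p ⊗ proj₂ (Over-∼ f) q })
  Over-∼ (⊖ e)            = (λ { (⊖ p) → ⊖ proj₁ (Over-∼ e) p }) , (λ { (⊖ p) → ⊖ proj₂ (Over-∼ e) p })
  Over-∼ (middle t u v w) = (λ { ((p ⊕ q) ⊕ (r ⊕ s)) → (p ⊕ r) ⊕ (q ⊕ s) })
                          , (λ { ((p ⊕ q) ⊕ (r ⊕ s)) → (p ⊕ r) ⊕ (q ⊕ s) })

  D-comm : ∀ i j t → D i (D j t) ∼ D j (D i t)
  D-comm i j (con c)       = con (K.∂-comm i j c)
  D-comm i j (var (ξ , h)) = ∼-reflexive (≡.cong (λ η → var (η , h)) (⊞ε-comm ξ j i))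
  D-comm i j (t ⊕ u)       = D-comm i j t ⊕ D-comm i j u
  -- The two mixed products occur as the middle summands, in opposite orders.
  D-comm i j (t ⊗ u)       = ∼-trans
    ((D-comm i j t ⊗ ∼-refl ⊕ ∼-refl) ⊕ (∼-refl ⊕ ∼-refl ⊗ D-comm i j u))
    (middle (D j (D i t) ⊗ u) (D j t ⊗ D i u) (D i t ⊗ D j u) (t ⊗ D j (D i u)))
  D-comm i j (⊖ t)         = ⊖ D-comm i j t

  private
    iterate : (Term → Term) → ℕ → Term → Term
    iterate δ zero    t = t
    iterate δ (suc k) t = δ (iterate δ k t)

    iterate-cong : {δ : Term → Term} → (∀ {t u} → t ∼ u → δ t ∼ δ u) → ∀ k {t u} → t ∼ u → iterate δ k t ∼ iterate δ k u
    iterate-cong δ-cong zero    p = p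
    iterate-cong δ-cong (suc k) p = δ-cong (iterate-cong δ-cong k p)

    iterate-comm : {δ δ′ : Term → Term} → (∀ {t u} → t ∼ u → δ t ∼ δ u) → (∀ t → δ (δ′ t) ∼ δ′ (δ t)) →
                   ∀ k t → iterate δ k (δ′ t) ∼ δ′ (iterate δ k t)
    iterate-comm δ-cong comm zero    t = ∼-refl
    iterate-comm δ-cong comm (suc k) t = ∼-trans (δ-cong (iterate-comm δ-cong comm k t)) (comm _)

    power : ∀ {k} → (Fin k → Term → Term) → Vec ℕ k → Term → Term
    power δ []      t = t
    power δ (a ∷ α) t = iterate (δ zero) a (power (δ ∘ suc) α t)

    power-0 : ∀ {k} (δ : Fin k → Term → Term) t → power δ (replicate k 0) t ≡ t
    power-0 {zero}  δ t = ≡.refl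
    power-0 {suc k} δ t = power-0 (δ ∘ suc) t

    -- `power` applies the derivations in a fixed order, so an additional δ i has to move outwards
    -- past the iterates of those with smaller index.
    power-⊞ε : ∀ {k} (δ : Fin k → Term → Term) → (∀ i {t u} → t ∼ u → δ i t ∼ δ i u) →
               (∀ i j t → δ i (δ j t) ∼ δ j (δ i t)) →
               ∀ α i t → power δ (α ⊞ ε i) t ∼ δ i (power δ α t)
    power-⊞ε δ δ-cong comm (a ∷ α) zero t rewrite ℕ.+-comm a 1 | ⊞0 α = ∼-refl
    power-⊞ε δ δ-cong comm (a ∷ α) (suc i) t rewrite ℕ.+-identityʳ a = ∼-trans
      (iterate-cong (δ-cong zero) a (power-⊞ε (δ ∘ suc) (δ-cong ∘ suc) (λ i j → comm (suc i) (suc j)) α i t))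
      (iterate-comm (δ-cong zero) (comm zero (suc i)) a _)

  -- The derivative ∂^{τ-ρ} f, meant for ρ ≼ τ, where truncated subtraction is exact.
  prolong : Vec ℕ m → Vec ℕ m → Term → Term
  prolong ρ τ f = power D (zipWith ℕ._∸_ τ ρ) f

  prolong-self : ∀ ρ f → prolong ρ ρ f ≡ f
  prolong-self ρ f = ≡.trans (≡.cong (λ α → power D α f) (∸-self ρ)) (power-0 D f)

  prolong-step : ∀ {ρ σ} i f → ρ ≼ σ → prolong ρ (σ ⊞ ε i) f ∼ D i (prolong ρ σ f)
  prolong-step {ρ} {σ} i f ρ≼σ = ∼-trans
    (∼-reflexive (≡.cong (λ α → power D α f) (∸-⊞ε i ρ≼σ)))
    (power-⊞ε D D-cong D-comm (zipWith ℕ._∸_ σ ρ) i f)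

  -- Every τ above ρ other than ρ itself is σ ⊞ ε i with σ still above ρ. Φ has to respect `∼`
  -- because the derivation that is last on this path need not be the one that `prolong` applies
  -- last.
  prolong-induction : ∀ {p} (Φ : Vec ℕ m → Term → Set p) (ρ : Vec ℕ m) (f : Term) →
    (∀ {τ t u} → t ∼ u → Φ τ u → Φ τ t) →
    Φ ρ f → (∀ σ i t → ρ ≼ σ → Φ σ t → Φ (σ ⊞ ε i) (D i t)) →
    ∀ τ → ρ ≼ τ → Φ τ (prolong ρ τ f)
  prolong-induction Φ ρ f transport z s τ ρ≼τ = go ∣ τ ∣ τ ℕ.≤-refl ρ≼τ
    where
    go : ∀ k τ → ∣ τ ∣ ≤ k → ρ ≼ τ → Φ τ (prolong ρ τ f)
    go k τ τ≤k ρ≼τ with ∣ ρ ∣ ℕ.<? ∣ τ ∣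
    ... | no ρ≮τ with ≡.refl ← ≼-antisym-∣∣ ρ≼τ (ℕ.≮⇒≥ ρ≮τ) = transport (∼-reflexive (prolong-self ρ f)) z
    go k τ τ≤k ρ≼τ | yes ρ<τ
      with common-predecessor ρ≼τ (0≼ τ) (≡.subst (_< ∣ τ ∣) (≡.sym (≡.trans (≡.cong (∣ ρ ∣ ℕ.+_) (∣0∣ m)) (ℕ.+-identityʳ _))) ρ<τ)
    go zero .(σ ⊞ ε i) τ≤k ρ≼τ | yes ρ<τ | i , σ , ≡.refl , ρ≼σ , _ = contradiction (ℕ.≤-trans ρ<τ τ≤k) λ ()
    go (suc k) .(σ ⊞ ε i) τ≤k ρ≼τ | yes ρ<τ | i , σ , ≡.refl , ρ≼σ , _ =
      transport (prolong-step i f ρ≼σ) (s σ i _ ρ≼σ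
        (go k σ (ℕ.≤-pred (≡.subst (_≤ suc k) (≡.trans (∣⊞ε∣ σ i) (ℕ.+-comm _ 1)) τ≤k)) ρ≼σ))

  _≤#_ _<#_ : Var → Var → Set
  u ≤# v = # u ≤ # v
  u <# v = # u < # v

  Over-D-≤ : ∀ i v {t} → Over (_≤# v) t → Over (_≤# (v ↑ i)) (D i t)
  Over-D-≤ i v = Over-D i (λ u u≤v → ℕ.≤-trans u≤v (ℕ.<⇒≤ (#<#-↑ v i))) (λ u → #-↑-mono-≤ i {u} {v})

  Over-prolong : ∀ {ρ k f} → Over (_≤# (ρ , k)) f → ∀ τ → ρ ≼ τ → Over (_≤# (τ , k)) (prolong ρ τ f)
  Over-prolong {ρ} {k} {f} o = prolong-induction (λ τ t → Over (_≤# (τ , k)) t) ρ f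
    (λ e → proj₂ (Over-∼ e)) o (λ σ i t _ → Over-D-≤ i (σ , k))

  module Evaluation (B : CommutativeRing ℓ ℓ) {κ : K.Carrier → CommutativeRing.Carrier B}
                    (κ-isHom : IsRingHomomorphism K.rawRing (CommutativeRing.rawRing B) κ) where
    open CommutativeRing B
    open RingSolver B using (solve; _:=_; _:+_; _:*_; :-_; _:-_; :0; :1)
    private
      module κ = IsRingHomomorphism κ-isHom

    eval : (Var → Carrier) → Term → Carrier
    eval x (con c) = κ c
    eval x (var v) = x v
    eval x (t ⊕ u) = eval x t + eval x u
    eval x (t ⊗ u) = eval x t * eval x u
    eval x (⊖ t)   = - eval x t

    eval-agree : ∀ {P x y} → (∀ v → P v → x v ≈ y v) → ∀ {t} → Over P t → eval x t ≈ eval y t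
    eval-agree e con     = refl
    eval-agree e (var p) = e _ p
    eval-agree e (p ⊕ q) = +-cong (eval-agree e p) (eval-agree e q)
    eval-agree e (p ⊗ q) = *-cong (eval-agree e p) (eval-agree e q)
    eval-agree e (⊖ p)   = -‿cong (eval-agree e p)

    eval-∼ : ∀ x {t u} → t ∼ u → eval x t ≈ eval x u
    eval-∼ x ∼-refl           = refl
    eval-∼ x (∼-sym p)        = sym (eval-∼ x p)
    eval-∼ x (∼-trans p q)    = trans (eval-∼ x p) (eval-∼ x q)
    eval-∼ x (con e)          = κ.⟦⟧-cong e
    eval-∼ x (p ⊕ q)          = +-cong (eval-∼ x p) (eval-∼ x q)
    eval-∼ x (p ⊗ q)          = *-cong (eval-∼ x p) (eval-∼ x q)
    eval-∼ x (⊖ p)            = -‿cong (eval-∼ x p)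
    eval-∼ x (middle t u v w) = solve 4 (λ a b c d → (a :+ b) :+ (c :+ d) := (a :+ c) :+ (b :+ d)) refl _ _ _ _

    sep-free : ∀ x v {t} → Over (_≢ v) t → eval x (sep v t) ≈ 0#
    sep-free x v con         = κ.0#-homo
    sep-free x v (var {u} p) with u ≟ᵛ v
    ... | yes e              = contradiction e p
    ... | no _               = κ.0#-homo
    sep-free x v (p ⊕ q)     = trans (+-cong (sep-free x v p) (sep-free x v q)) (+-identityʳ 0#)
    sep-free x v (p ⊗ q)     = trans (+-cong (*-congʳ (sep-free x v p)) (*-congˡ (sep-free x v q)))
      (solve 2 (λ a b → :0 :* a :+ b :* :0 := :0) refl _ _)
    sep-free x v (⊖ p)       = trans (-‿cong (sep-free x v p)) (solve 0 (:- :0 := :0) refl)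

    private
      ≤⇒≢↑ : ∀ i v {t} → Over (_≤# v) t → Over (_≢ v ↑ i) t
      ≤⇒≢↑ i v = Over-map λ { u u≤v ≡.refl → ℕ.<⇒≱ (#<#-↑ v i) u≤v }

    -- Among the variables up to v only v itself is moved to v ↑ i, since shifting is injective; and
    -- a factor that is not differentiated is too low to contain v ↑ i.
    sep-D : ∀ x i v {t} → Over (_≤# v) t → eval x (sep (v ↑ i) (D i t)) ≈ eval x (sep v t)
    sep-D x i v con         = refl
    sep-D x i v (var {u} _) with u ≟ᵛ v | u ↑ i ≟ᵛ v ↑ i
    ... | yes _      | yes _ = refl
    ... | no _       | no _  = refl
    ... | yes ≡.refl | no ¬e = contradiction ≡.refl ¬e
    ... | no ¬e      | yes e = contradiction (↑-injective i e) ¬e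
    sep-D x i v (p ⊕ q)     = +-cong (sep-D x i v p) (sep-D x i v q)
    sep-D x i v {t ⊗ u} (p ⊗ q) = trans
      (+-cong (+-cong (*-congʳ (sep-D x i v p)) (*-congˡ (sep-free x (v ↑ i) (≤⇒≢↑ i v q))))
              (+-cong (*-congʳ (sep-free x (v ↑ i) (≤⇒≢↑ i v p))) (*-congˡ (sep-D x i v q))))
      (solve 6 (λ a b c d e f → (a :* b :+ c :* :0) :+ (:0 :* d :+ e :* f) := a :* b :+ e :* f) refl _ _ _ _ _ _)
    sep-D x i v (⊖ p)       = -‿cong (sep-D x i v p)

    -- D i t is linear in its leader v ↑ i: replace the value of the leader by 0.
    D-leader : ∀ {x y} i v → (∀ u → u <# (v ↑ i) → x u ≈ y u) → y (v ↑ i) ≈ 0# → ∀ {t} → Over (_≤# v) t →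
               eval x (D i t) ≈ eval y (D i t) + eval x (sep v t) * x (v ↑ i)
    D-leader {x} {y} i v agree zero-at = go
      where
      same : ∀ {t} → Over (_≤# v) t → eval x t ≈ eval y t
      same = eval-agree (λ u u≤v → agree u (ℕ.≤-<-trans u≤v (#<#-↑ v i)))
      go : ∀ {t} → Over (_≤# v) t → eval x (D i t) ≈ eval y (D i t) + eval x (sep v t) * x (v ↑ i)
      go con = sym (trans (+-congˡ (trans (*-congʳ κ.0#-homo) (zeroˡ _))) (+-identityʳ _))
      go (var {u} p) with u ≟ᵛ v
      ... | yes ≡.refl = sym (trans (+-cong zero-at (*-congʳ κ.1#-homo)) (solve 1 (λ a → :0 :+ :1 :* a := a) refl _))
      ... | no u≢v = trans (agree (u ↑ i) (ℕ.≤∧≢⇒< (#-↑-mono-≤ i {u} {v} p) (λ e → u≢v (↑-injective i (#-injective e)))))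
        (sym (trans (+-congˡ (trans (*-congʳ κ.0#-homo) (zeroˡ _))) (+-identityʳ _)))
      go (p ⊕ q) = trans (+-cong (go p) (go q))
        (solve 5 (λ a b c d w → (a :+ b :* w) :+ (c :+ d :* w) := (a :+ c) :+ (b :+ d) :* w) refl _ _ _ _ _)
      go (p ⊗ q) = trans
        (+-cong (*-congʳ (go p)) (*-congˡ (go q)))
        (trans
          (solve 7 (λ a b c d t u w → (a :+ b :* w) :* u :+ t :* (c :+ d :* w) := (a :* u :+ t :* c) :+ (b :* u :+ t :* d) :* w)
            refl _ _ _ _ _ _ _)
          (+-congʳ (+-cong (*-congˡ (same q)) (*-congʳ (same p)))))
      go (⊖ p) = trans (-‿cong (go p)) (solve 3 (λ a b w → :- (a :+ b :* w) := :- a :+ :- b :* w) refl _ _ _)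

    -- By `sep-D` no differentiation changes the value of the separant. So all equations obtained
    -- from a leader are solvable once the leader's own separant is nonzero.
    sep-prolong : ∀ x {ρ k f} → Over (_≤# (ρ , k)) f → ∀ τ → ρ ≼ τ →
                  eval x (sep (τ , k) (prolong ρ τ f)) ≈ eval x (sep (ρ , k) f)
    sep-prolong x {ρ} {k} {f} o τ ρ≼τ = proj₂ (prolong-induction
      (λ τ t → Over (_≤# (τ , k)) t × eval x (sep (τ , k) t) ≈ eval x (sep (ρ , k) f)) ρ f
      (λ {τ} e (p , q) → proj₂ (Over-∼ e) p , trans (eval-∼ x (sep-cong (τ , k) e)) q)
      (o , refl)
      (λ σ i t _ (p , q) → Over-D-≤ i (σ , k) p , trans (sep-D x i (σ , k) p) q)
      τ ρ≼τ)

  module _ (A B : CommutativeRing ℓ ℓ)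
           {κ : K.Carrier → CommutativeRing.Carrier A} {f : CommutativeRing.Carrier A → CommutativeRing.Carrier B}
           {κ′ : K.Carrier → CommutativeRing.Carrier B}
           (κ-isHom : IsRingHomomorphism K.rawRing (CommutativeRing.rawRing A) κ)
           (κ′-isHom : IsRingHomomorphism K.rawRing (CommutativeRing.rawRing B) κ′)
           (f-isHom : IsRingHomomorphism (CommutativeRing.rawRing A) (CommutativeRing.rawRing B) f)
           (κ′≈f∘κ : ∀ c → CommutativeRing._≈_ B (κ′ c) (f (κ c))) where
    private
      module A = Evaluation A κ-isHom
      module B = Evaluation B κ′-isHom
      module f = IsRingHomomorphism f-isHom
    open CommutativeRing B

    eval-homo : ∀ {P x y} → (∀ v → P v → y v ≈ f (x v)) → ∀ {t} → Over P t → B.eval y t ≈ f (A.eval x t)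
    eval-homo e con     = κ′≈f∘κ _
    eval-homo e (var p) = e _ p
    eval-homo e (p ⊕ q) = trans (+-cong (eval-homo e p) (eval-homo e q)) (sym (f.+-homo _ _))
    eval-homo e (p ⊗ q) = trans (*-cong (eval-homo e p) (eval-homo e q)) (sym (f.*-homo _ _))
    eval-homo e (⊖ p)   = trans (-‿cong (eval-homo e p)) (sym (f.-‿homo _))

-- Elimination in the leading variable

-- Differential polynomials with leader at most v as polynomials in x v; lists hold the coefficients,
-- lowest degree first.
module Univariate {m : ℕ} {ℓ : Level} (K : DifferentialField m ℓ) (n : ℕ)
                  (B : CommutativeRing ℓ ℓ) {κ : DifferentialField.Carrier K → CommutativeRing.Carrier B}
                  (κ-isHom : IsRingHomomorphism (DifferentialField.rawRing K) (CommutativeRing.rawRing B) κ)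
                  (x : Variables.Var m n → CommutativeRing.Carrier B)
                  (v : Variables.Var m n) (i : Fin m) where
  open Variables m n
  open Numbering m n
  open DifferentialPolynomials K n
  open Evaluation B κ-isHom
  open CommutativeRing B
  open RingSolver B using (solve; _:=_; _:+_; _:*_; :-_; _:-_; :0; :1)
  open Algebra.Properties.Group +-group using (x∙y⁻¹≈ε⇒x≈y; x≈y⇒x∙y⁻¹≈ε)
  open Relation.Binary.Reasoning.Setoid setoid
  private
    module K = DifferentialField K
    module κ = IsRingHomomorphism κ-isHom
    module ∂ = DerivationProperties K.commutativeRing (K.isDerivation i)

  z w : Carrier
  z = x v
  w = x (v ↑ i)

  -- value is the value at x; the value of the D i-derivative is lower + slope * w.
  value lower slope : List Term → Carrier
  value []       = 0#
  value (c ∷ cs) = eval x c + z * value cs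
  lower []       = 0#
  lower (c ∷ cs) = eval x (D i c) + z * lower cs
  slope []       = 0#
  slope (c ∷ cs) = value cs + z * slope cs

  plus : List Term → List Term → List Term
  plus []       bs       = bs
  plus (a ∷ as) []       = a ∷ as
  plus (a ∷ as) (b ∷ bs) = a ⊕ b ∷ plus as bs

  scale : Term → List Term → List Term
  scale c = List.map (c ⊗_)

  minus : List Term → List Term
  minus = List.map ⊖_

  times : List Term → List Term → List Term
  times []       bs = []
  times (a ∷ as) bs = plus (scale a bs) (con K.0# ∷ times as bs)

  private
    value-plus : ∀ as bs → value (plus as bs) ≈ value as + value bs
    value-plus []       bs       = sym (+-identityˡ _)
    value-plus (a ∷ as) []       = sym (+-identityʳ _)
    value-plus (a ∷ as) (b ∷ bs) = trans (+-congˡ (*-congˡ (value-plus as bs)))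
      (solve 5 (λ a b z p q → (a :+ b) :+ z :* (p :+ q) := (a :+ z :* p) :+ (b :+ z :* q)) refl _ _ _ _ _)

    lower-plus : ∀ as bs → lower (plus as bs) ≈ lower as + lower bs
    lower-plus []       bs       = sym (+-identityˡ _)
    lower-plus (a ∷ as) []       = sym (+-identityʳ _)
    lower-plus (a ∷ as) (b ∷ bs) = trans (+-congˡ (*-congˡ (lower-plus as bs)))
      (solve 5 (λ a b z p q → (a :+ b) :+ z :* (p :+ q) := (a :+ z :* p) :+ (b :+ z :* q)) refl _ _ _ _ _)

    slope-plus : ∀ as bs → slope (plus as bs) ≈ slope as + slope bs
    slope-plus []       bs       = sym (+-identityˡ _)
    slope-plus (a ∷ as) []       = sym (+-identityʳ _)
    slope-plus (a ∷ as) (b ∷ bs) = trans (+-cong (value-plus as bs) (*-congˡ (slope-plus as bs)))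
      (solve 5 (λ a b z p q → (a :+ b) :+ z :* (p :+ q) := (a :+ z :* p) :+ (b :+ z :* q)) refl _ _ _ _ _)

    value-scale : ∀ c bs → value (scale c bs) ≈ eval x c * value bs
    value-scale c []       = sym (zeroʳ _)
    value-scale c (b ∷ bs) = trans (+-congˡ (*-congˡ (value-scale c bs)))
      (solve 4 (λ c b z p → c :* b :+ z :* (c :* p) := c :* (b :+ z :* p)) refl _ _ _ _)

    lower-scale : ∀ c bs → lower (scale c bs) ≈ eval x (D i c) * value bs + eval x c * lower bs
    lower-scale c []       = solve 2 (λ a b → :0 := a :* :0 :+ b :* :0) refl _ _
    lower-scale c (b ∷ bs) = trans (+-congˡ (*-congˡ (lower-scale c bs)))
      (solve 7 (λ c c′ b b′ z p q → (c′ :* b :+ c :* b′) :+ z :* (c′ :* p :+ c :* q) :=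
        c′ :* (b :+ z :* p) :+ c :* (b′ :+ z :* q)) refl _ _ _ _ _ _ _)

    slope-scale : ∀ c bs → slope (scale c bs) ≈ eval x c * slope bs
    slope-scale c []       = sym (zeroʳ _)
    slope-scale c (b ∷ bs) = trans (+-cong (value-scale c bs) (*-congˡ (slope-scale c bs)))
      (solve 4 (λ c b z p → c :* b :+ z :* (c :* p) := c :* (b :+ z :* p)) refl _ _ _ _)

    neg-horner : ∀ a z p → - a + z * - p ≈ - (a + z * p)
    neg-horner = solve 3 (λ a z p → :- a :+ z :* :- p := :- (a :+ z :* p)) refl

    -0≈0 : 0# ≈ - 0#
    -0≈0 = solve 0 (:0 := :- :0) refl

    value-minus : ∀ bs → value (minus bs) ≈ - value bs
    value-minus []       = -0≈0
    value-minus (b ∷ bs) = trans (+-congˡ (*-congˡ (value-minus bs))) (neg-horner _ _ _)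

    lower-minus : ∀ bs → lower (minus bs) ≈ - lower bs
    lower-minus []       = -0≈0
    lower-minus (b ∷ bs) = trans (+-congˡ (*-congˡ (lower-minus bs))) (neg-horner _ _ _)

    slope-minus : ∀ bs → slope (minus bs) ≈ - slope bs
    slope-minus []       = -0≈0
    slope-minus (b ∷ bs) = trans (+-cong (value-minus bs) (*-congˡ (slope-minus bs))) (neg-horner _ _ _)

    value-times : ∀ as bs → value (times as bs) ≈ value as * value bs
    value-times []       bs = sym (zeroˡ _)
    value-times (a ∷ as) bs = trans (value-plus (scale a bs) (con K.0# ∷ times as bs))
      (trans (+-cong (value-scale a bs) (+-cong κ.0#-homo (*-congˡ (value-times as bs))))
        (solve 4 (λ a b z p → a :* b :+ (:0 :+ z :* (p :* b)) := (a :+ z :* p) :* b) refl _ _ _ _))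

    κ∂0≈0 : κ (K.∂ i K.0#) ≈ 0#
    κ∂0≈0 = trans (κ.⟦⟧-cong ∂.D-0) κ.0#-homo

    κ∂1≈0 : κ (K.∂ i K.1#) ≈ 0#
    κ∂1≈0 = trans (κ.⟦⟧-cong ∂.D-1) κ.0#-homo

    lower-times : ∀ as bs → lower (times as bs) ≈ lower as * value bs + value as * lower bs
    lower-times []       bs = solve 2 (λ a b → :0 := :0 :* a :+ :0 :* b) refl _ _
    lower-times (a ∷ as) bs = trans (lower-plus (scale a bs) (con K.0# ∷ times as bs))
      (trans (+-cong (lower-scale a bs) (+-cong κ∂0≈0 (*-congˡ (lower-times as bs))))
        (solve 7 (λ a a′ b b′ z p q → (a′ :* b :+ a :* b′) :+ (:0 :+ z :* (q :* b :+ p :* b′)) :=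
          (a′ :+ z :* q) :* b :+ (a :+ z :* p) :* b′) refl _ _ _ _ _ _ _))

    slope-times : ∀ as bs → slope (times as bs) ≈ slope as * value bs + value as * slope bs
    slope-times []       bs = solve 2 (λ a b → :0 := :0 :* a :+ :0 :* b) refl _ _
    slope-times (a ∷ as) bs = trans (slope-plus (scale a bs) (con K.0# ∷ times as bs))
      (trans (+-cong (slope-scale a bs) (+-cong (value-times as bs) (*-congˡ (slope-times as bs))))
        (solve 6 (λ a b s z p q → a :* s :+ (p :* b :+ z :* (q :* b :+ p :* s)) :=
          (p :+ z :* q) :* b :+ (a :+ z :* p) :* s) refl _ _ _ _ _ _))

  Low : Term → Set ℓ
  Low = Over (_<# v)

  private
    low-plus : ∀ {as bs} → All Low as → All Low bs → All Low (plus as bs)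
    low-plus []       qs       = qs
    low-plus (p ∷ ps) []       = p ∷ ps
    low-plus (p ∷ ps) (q ∷ qs) = p ⊕ q ∷ low-plus ps qs

    low-scale : ∀ {c bs} → Low c → All Low bs → All Low (scale c bs)
    low-scale p []       = []
    low-scale p (q ∷ qs) = p ⊗ q ∷ low-scale p qs

    low-minus : ∀ {bs} → All Low bs → All Low (minus bs)
    low-minus []       = []
    low-minus (q ∷ qs) = ⊖ q ∷ low-minus qs

    low-times : ∀ {as bs} → All Low as → All Low bs → All Low (times as bs)
    low-times []       qs = []
    low-times (p ∷ ps) qs = low-plus (low-scale p qs) (con ∷ low-times ps qs)

  coefficients : Term → List Term
  coefficients (con c)     = con c ∷ []
  coefficients (var u) with u ≟ᵛ v
  ... | yes _              = con K.0# ∷ con K.1# ∷ []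
  ... | no _               = var u ∷ []
  coefficients (t ⊕ u)     = plus (coefficients t) (coefficients u)
  coefficients (t ⊗ u)     = times (coefficients t) (coefficients u)
  coefficients (⊖ t)       = minus (coefficients t)

  private
    constant : ∀ a → a + z * 0# ≈ a
    constant a = trans (+-congˡ (zeroʳ z)) (+-identityʳ a)

    linear : ∀ {a b} → a ≈ 0# → b ≈ 1# → a + z * (b + z * 0#) ≈ z
    linear p q = trans (+-cong p (*-congˡ (+-congʳ q))) (solve 1 (λ z → :0 :+ z :* (:1 :+ z :* :0) := z) refl z)

  value-coefficients : ∀ t → value (coefficients t) ≈ eval x t
  value-coefficients (con c) = constant _
  value-coefficients (var u) with u ≟ᵛ v
  ... | yes ≡.refl = linear κ.0#-homo κ.1#-homo
  ... | no _       = constant _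
  value-coefficients (t ⊕ u) = trans (value-plus (coefficients t) _) (+-cong (value-coefficients t) (value-coefficients u))
  value-coefficients (t ⊗ u) = trans (value-times (coefficients t) _) (*-cong (value-coefficients t) (value-coefficients u))
  value-coefficients (⊖ t)   = trans (value-minus (coefficients t)) (-‿cong (value-coefficients t))

  slope-coefficients : ∀ t → slope (coefficients t) ≈ eval x (sep v t)
  slope-coefficients (con c) = trans (constant 0#) (sym κ.0#-homo)
  slope-coefficients (var u) with u ≟ᵛ v
  ... | yes ≡.refl = trans
    (+-cong (constant _) (*-congˡ (constant 0#))) (constant _)
  ... | no _       = trans (constant 0#) (sym κ.0#-homo)
  slope-coefficients (t ⊕ u) = trans (slope-plus (coefficients t) _) (+-cong (slope-coefficients t) (slope-coefficients u))
  slope-coefficients (t ⊗ u) = trans (slope-times (coefficients t) _)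
    (+-cong (*-cong (slope-coefficients t) (value-coefficients u)) (*-cong (value-coefficients t) (slope-coefficients u)))
  slope-coefficients (⊖ t)   = trans (slope-minus (coefficients t)) (-‿cong (slope-coefficients t))

  derivative-coefficients : ∀ t → eval x (D i t) ≈ lower (coefficients t) + slope (coefficients t) * w
  derivative-coefficients (con c) = sym (trans (+-cong (constant _) (trans (*-congʳ (constant 0#)) (zeroˡ w))) (+-identityʳ _))
  derivative-coefficients (var u) with u ≟ᵛ v
  ... | yes ≡.refl = sym (trans
    (+-cong (+-cong κ∂0≈0 (*-congˡ (+-congʳ κ∂1≈0))) (*-congʳ (+-congʳ (+-congʳ κ.1#-homo))))
    (solve 2 (λ z w → (:0 :+ z :* (:0 :+ z :* :0)) :+ (:1 :+ z :* :0 :+ z :* (:0 :+ z :* :0)) :* w := w) refl z w))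
  ... | no _ = sym (trans (+-cong (constant _) (trans (*-congʳ (constant 0#)) (zeroˡ w))) (+-identityʳ _))
  derivative-coefficients (t ⊕ u) = trans (+-cong (derivative-coefficients t) (derivative-coefficients u))
    (sym (trans (+-cong (lower-plus (coefficients t) _) (*-congʳ (slope-plus (coefficients t) _)))
      (solve 5 (λ a b c d w → (a :+ c) :+ (b :+ d) :* w := (a :+ b :* w) :+ (c :+ d :* w)) refl _ _ _ _ _)))
  derivative-coefficients (t ⊗ u) = trans
    (+-cong (*-cong (derivative-coefficients t) (sym (value-coefficients u)))
            (*-cong (sym (value-coefficients t)) (derivative-coefficients u)))
    (sym (trans (+-cong (lower-times (coefficients t) _) (*-congʳ (slope-times (coefficients t) _)))
      (solve 7 (λ l s p l′ s′ p′ w → (l :* p′ :+ p :* l′) :+ (s :* p′ :+ p :* s′) :* w :=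
        (l :+ s :* w) :* p′ :+ p :* (l′ :+ s′ :* w)) refl _ _ _ _ _ _ _)))
  derivative-coefficients (⊖ t) = trans (-‿cong (derivative-coefficients t))
    (sym (trans (+-cong (lower-minus (coefficients t)) (*-congʳ (slope-minus (coefficients t))))
      (solve 3 (λ l s w → :- l :+ :- s :* w := :- (l :+ s :* w)) refl _ _ _)))

  low-coefficients : ∀ {t} → Over (_≤# v) t → All Low (coefficients t)
  low-coefficients con         = con ∷ []
  low-coefficients (var {u} p) with u ≟ᵛ v
  ... | yes _                  = con ∷ con ∷ []
  ... | no u≢v                 = var (ℕ.≤∧≢⇒< p (u≢v ∘ #-injective)) ∷ []
  low-coefficients (p ⊕ q)     = low-plus (low-coefficients p) (low-coefficients q)
  low-coefficients (p ⊗ q)     = low-times (low-coefficients p) (low-coefficients q)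
  low-coefficients (⊖ p)       = low-minus (low-coefficients p)

  -- `low-D` will be supplied by the induction along the order: below v, vanishing at x passes to
  -- derivatives.
  module _ (low-D : ∀ {t} → Low t → eval x t ≈ 0# → eval x (D i t) ≈ 0#) where

    -- Transcendence makes every coefficient vanish, and then its derivative vanishes by `low-D`;
    -- both the lower part and the slope are built from these values.
    transcendental-derivative : (∀ {cs} → All Low cs → value cs ≈ 0# → All (λ c → eval x c ≈ 0#) cs) →
      ∀ {t} → Over (_≤# v) t → eval x t ≈ 0# → eval x (D i t) ≈ 0#
    transcendental-derivative tr {t} o e = trans (derivative-coefficients t)
      (trans (+-cong (lower-zero lows zeros) (*-congʳ (slope-zero zeros)))
        (trans (+-congˡ (zeroˡ w)) (+-identityʳ 0#)))
      where
      lows  = low-coefficients o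
      zeros = tr lows (trans (value-coefficients t) e)
      lower-zero : ∀ {cs} → All Low cs → All (λ c → eval x c ≈ 0#) cs → lower cs ≈ 0#
      lower-zero []       []       = refl
      lower-zero (p ∷ ps) (e ∷ es) = trans (+-cong (low-D p e) (*-congˡ (lower-zero ps es))) (constant 0#)
      value-zero : ∀ {cs} → All (λ c → eval x c ≈ 0#) cs → value cs ≈ 0#
      value-zero []       = refl
      value-zero (e ∷ es) = trans (+-cong e (*-congˡ (value-zero es))) (constant 0#)
      slope-zero : ∀ {cs} → All (λ c → eval x c ≈ 0#) cs → slope cs ≈ 0#
      slope-zero []       = refl
      slope-zero (e ∷ es) = trans (+-cong (value-zero es) (*-congˡ (slope-zero es))) (constant 0#)

    module _ (em : ExcludedMiddle ℓ) (domain : NoZeroDivisors B) where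
      private
        cancel : ∀ {a b} → ¬ a ≈ 0# → a * b ≈ 0# → b ≈ 0#
        cancel {a} {b} a≉0 e with domain a b e
        ... | inj₁ a≈0 = contradiction a≈0 a≉0
        ... | inj₂ b≈0 = b≈0

        length-plus : ∀ {k} as bs → length as ≤ k → length bs ≤ k → length (plus as bs) ≤ k
        length-plus []       bs       p       q       = q
        length-plus (a ∷ as) []       p       q       = p
        length-plus (a ∷ as) (b ∷ bs) (s≤s p) (s≤s q) = s≤s (length-plus as bs p q)

        x-y≈0⇒x≈y : ∀ {x y} → x - y ≈ 0# → x ≈ y
        x-y≈0⇒x≈y = x∙y⁻¹≈ε⇒x≈y _ _

        x≈y⇒x-y≈0 : ∀ {x y} → x ≈ y → x - y ≈ 0#
        x≈y⇒x-y≈0 = x≈y⇒x∙y⁻¹≈ε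

        -- `proportional` cancels z, so z = 0 is treated apart. There a polynomial has the value of
        -- its constant coefficient, to which `low-D` applies.
        lower-vanishes : z ≈ 0# → ∀ {cs} → All Low cs → value cs ≈ 0# → lower cs ≈ 0#
        lower-vanishes z≈0 []       e = refl
        lower-vanishes z≈0 (p ∷ ps) e = drop (low-D p (trans (sym (drop refl)) e))
          where
          drop : ∀ {a b c} → a ≈ b → a + z * c ≈ b
          drop q = trans (+-cong q (trans (*-congʳ z≈0) (zeroˡ _))) (+-identityʳ _)

        -- Two polynomials vanishing at z generate, up to nonzero factors, a principal ideal; this is
        -- Euclid's algorithm, cancelling the lowest coefficients instead of the highest ones.
        proportional : ¬ z ≈ 0# → ∀ k as bs → length as ℕ.+ length bs ≤ k → All Low as → All Low bs →
                       value as ≈ 0# → value bs ≈ 0# → slope as * lower bs ≈ slope bs * lower as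
        proportional z≉0 k []       bs       _ _ _ _ _ = trans (zeroˡ _) (sym (zeroʳ _))
        proportional z≉0 k (a ∷ as) []       _ _ _ _ _ = trans (zeroʳ _) (sym (zeroˡ _))
        proportional z≉0 (suc k) (a ∷ as) (b ∷ bs) (s≤s len) (p ∷ ps) (q ∷ qs) e f =
          step em em (ℕ.≤-total (length as) (length bs))
          where
          A = eval x a
          A′ = eval x (D i a)
          E = eval x b
          E′ = eval x (D i b)
          Sa = slope (a ∷ as)
          La = lower (a ∷ as)
          Sb = slope (b ∷ bs)
          Lb = lower (b ∷ bs)
          -- This is (a · (b ∷ bs) - b · (a ∷ as)) / z, as the constant coefficients cancel. Both
          -- polynomials vanish at z, hence so does u, and up to the factor z its slope and lower
          -- part are the same combination of theirs.
          u = plus (scale a bs) (minus (scale b as))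
          z*value : ∀ {c v} → c + z * v ≈ 0# → z * v ≈ - c
          z*value {c} {v} h = trans (solve 2 (λ c y → y := (c :+ y) :- c) refl c (z * v)) (trans (+-congʳ h) (+-identityˡ _))
          value-u : value u ≈ 0#
          value-u = cancel z≉0 (begin
            z * value u
              ≈⟨ *-congˡ (trans (value-plus (scale a bs) _) (+-cong (value-scale a bs) (trans (value-minus (scale b as)) (-‿cong (value-scale b as))))) ⟩
            z * (A * value bs - E * value as)
              ≈⟨ solve 5 (λ z A p E r → z :* (A :* p :- E :* r) := A :* (z :* p) :- E :* (z :* r)) refl z A _ E _ ⟩
            A * (z * value bs) - E * (z * value as)
              ≈⟨ +-cong (*-congˡ (z*value f)) (-‿cong (*-congˡ (z*value e))) ⟩
            A * - E - E * - A
              ≈⟨ solve 2 (λ A E → A :* :- E :- E :* :- A := :0) refl A E ⟩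
            0# ∎)
          slope-u : z * slope u ≈ A * Sb - E * Sa
          slope-u = sym (begin
            A * Sb - E * Sa
              ≈⟨ solve 7 (λ z A E p r s s′ → A :* (p :+ z :* s) :- E :* (r :+ z :* s′) :=
                   (A :* p :- E :* r) :+ z :* (A :* s :- E :* s′)) refl z A E (value bs) (value as) (slope bs) (slope as) ⟩
            (A * value bs - E * value as) + z * (A * slope bs - E * slope as)
              ≈⟨ +-cong
                   (sym (trans (value-plus (scale a bs) _) (+-cong (value-scale a bs) (trans (value-minus (scale b as)) (-‿cong (value-scale b as))))))
                   (*-congˡ (sym (trans (slope-plus (scale a bs) _) (+-cong (slope-scale a bs) (trans (slope-minus (scale b as)) (-‿cong (slope-scale b as))))))) ⟩
            value u + z * slope u
              ≈⟨ trans (+-congʳ value-u) (+-identityˡ _) ⟩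
            z * slope u ∎)
          lower-u : z * lower u ≈ A * Lb - E * La
          lower-u = begin
            z * lower u
              ≈⟨ *-congˡ (trans (lower-plus (scale a bs) _) (+-cong (lower-scale a bs) (trans (lower-minus (scale b as)) (-‿cong (lower-scale b as))))) ⟩
            z * ((A′ * value bs + A * lower bs) - (E′ * value as + E * lower as))
              ≈⟨ solve 9 (λ z A A′ E E′ p r l l′ → z :* ((A′ :* p :+ A :* l) :- (E′ :* r :+ E :* l′)) :=
                   (A′ :* (z :* p) :+ A :* (z :* l)) :- (E′ :* (z :* r) :+ E :* (z :* l′))) refl z A A′ E E′ (value bs) (value as) (lower bs) (lower as) ⟩
            (A′ * (z * value bs) + A * (z * lower bs)) - (E′ * (z * value as) + E * (z * lower as))
              ≈⟨ +-cong (+-congʳ (*-congˡ (z*value f))) (-‿cong (+-congʳ (*-congˡ (z*value e)))) ⟩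
            (A′ * - E + A * (z * lower bs)) - (E′ * - A + E * (z * lower as))
              ≈⟨ solve 6 (λ A A′ E E′ l l′ → (A′ :* :- E :+ A :* l) :- (E′ :* :- A :+ E :* l′) :=
                   A :* (E′ :+ l) :- E :* (A′ :+ l′)) refl A A′ E E′ (z * lower bs) (z * lower as) ⟩
            A * Lb - E * La ∎
          low-u : All Low u
          low-u = low-plus (low-scale p qs) (low-minus (low-scale q ps))
          Step : Set ℓ
          Step = Sa * Lb ≈ Sb * La
          step : Dec (A ≈ 0#) → Dec (E ≈ 0#) → length as ≤ length bs ⊎ length bs ≤ length as → Step
          -- A constant coefficient of value 0 has a derivative of value 0, so the polynomial may be
          -- replaced by its quotient by z.
          step (yes A≈0) _ _ = begin
            Sa * Lb                     ≈⟨ *-congʳ (trans (+-congʳ value-as) (+-identityˡ _)) ⟩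
            z * slope as * Lb           ≈⟨ *-assoc _ _ _ ⟩
            z * (slope as * Lb)         ≈⟨ *-congˡ (proportional z≉0 k as (b ∷ bs) len ps (q ∷ qs) value-as f) ⟩
            z * (Sb * lower as)         ≈⟨ solve 3 (λ z s l → z :* (s :* l) := s :* (:0 :+ z :* l)) refl _ _ _ ⟩
            Sb * (0# + z * lower as)    ≈⟨ *-congˡ (+-congʳ (sym (low-D p A≈0))) ⟩
            Sb * La                     ∎
            where
            value-as = cancel z≉0 (trans (z*value e) (trans (-‿cong A≈0) (sym -0≈0)))
          step (no _) (yes E≈0) _ = begin
            Sa * Lb                     ≈⟨ *-congˡ (+-congʳ (low-D q E≈0)) ⟩
            Sa * (0# + z * lower bs)    ≈⟨ solve 3 (λ z s l → s :* (:0 :+ z :* l) := z :* (s :* l)) refl _ _ _ ⟩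
            z * (Sa * lower bs)         ≈⟨ *-congˡ (proportional z≉0 k (a ∷ as) bs (ℕ.≤-trans (ℕ.≤-reflexive (≡.sym (ℕ.+-suc _ _))) len) (p ∷ ps) qs e value-bs) ⟩
            z * (slope bs * La)         ≈⟨ sym (*-assoc _ _ _) ⟩
            z * slope bs * La           ≈⟨ *-congʳ (sym (trans (+-congʳ value-bs) (+-identityˡ _))) ⟩
            Sb * La                     ∎
            where
            value-bs = cancel z≉0 (trans (z*value f) (trans (-‿cong E≈0) (sym -0≈0)))
          -- u takes the place of the longer list; its length is at most that of the longer tail, so
          -- the total length drops.
          step (no A≉0) (no _) (inj₁ as≤bs) = x-y≈0⇒x≈y (cancel A≉0 (begin
            A * (Sa * Lb - Sb * La)
              ≈⟨ solve 6 (λ A E Sa La Sb Lb → A :* (Sa :* Lb :- Sb :* La) :=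
                   Sa :* (A :* Lb :- E :* La) :- (A :* Sb :- E :* Sa) :* La) refl A E Sa La Sb Lb ⟩
            Sa * (A * Lb - E * La) - (A * Sb - E * Sa) * La
              ≈⟨ +-cong (*-congˡ (sym lower-u)) (-‿cong (*-congʳ (sym slope-u))) ⟩
            Sa * (z * lower u) - z * slope u * La
              ≈⟨ solve 5 (λ z Sa l s La → Sa :* (z :* l) :- z :* s :* La := z :* (Sa :* l :- s :* La)) refl z Sa _ _ La ⟩
            z * (Sa * lower u - slope u * La)
              ≈⟨ *-congˡ (x≈y⇒x-y≈0 (proportional z≉0 k (a ∷ as) u
                   (ℕ.≤-trans (ℕ.+-monoʳ-≤ (suc (length as)) (length-plus (scale a bs) _
                     (ℕ.≤-reflexive (List.length-map _ bs))
                     (ℕ.≤-trans (ℕ.≤-reflexive (≡.trans (List.length-map _ (scale b as)) (List.length-map _ as))) as≤bs)))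
                     (ℕ.≤-trans (ℕ.≤-reflexive (≡.sym (ℕ.+-suc _ _))) len))
                   (p ∷ ps) low-u e value-u)) ⟩
            z * 0# ≈⟨ zeroʳ z ⟩
            0# ∎))
          step (no _) (no E≉0) (inj₂ bs≤as) = x-y≈0⇒x≈y (cancel E≉0 (begin
            E * (Sa * Lb - Sb * La)
              ≈⟨ solve 6 (λ A E Sa La Sb Lb → E :* (Sa :* Lb :- Sb :* La) :=
                   Sb :* (A :* Lb :- E :* La) :- (A :* Sb :- E :* Sa) :* Lb) refl A E Sa La Sb Lb ⟩
            Sb * (A * Lb - E * La) - (A * Sb - E * Sa) * Lb
              ≈⟨ +-cong (*-congˡ (sym lower-u)) (-‿cong (*-congʳ (sym slope-u))) ⟩
            Sb * (z * lower u) - z * slope u * Lb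
              ≈⟨ solve 5 (λ z Sb l s Lb → Sb :* (z :* l) :- z :* s :* Lb := z :* (Sb :* l :- s :* Lb)) refl z Sb _ _ Lb ⟩
            z * (Sb * lower u - slope u * Lb)
              ≈⟨ *-congˡ (x≈y⇒x-y≈0 (sym (proportional z≉0 k u (b ∷ bs)
                   (ℕ.≤-trans (ℕ.+-monoˡ-≤ (suc (length bs)) (length-plus (scale a bs) _
                     (ℕ.≤-trans (ℕ.≤-reflexive (List.length-map _ bs)) bs≤as)
                     (ℕ.≤-reflexive (≡.trans (List.length-map _ (scale b as)) (List.length-map _ as)))))
                     len)
                   low-u (q ∷ qs) value-u f))) ⟩
            z * 0# ≈⟨ zeroʳ z ⟩
            0# ∎))

      -- On both sides w has the product of the two separants as its coefficient, so it cancels and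
      -- `proportional` remains.
      sep-proportional : ∀ {t u} → Over (_≤# v) t → Over (_≤# v) u → eval x t ≈ 0# → eval x u ≈ 0# →
                         eval x (sep v t) * eval x (D i u) ≈ eval x (sep v u) * eval x (D i t)
      sep-proportional {t} {u} p q e f = begin
        eval x (sep v t) * eval x (D i u)
          ≈⟨ *-cong (sym (slope-coefficients t)) (derivative-coefficients u) ⟩
        slope cs * (lower ds + slope ds * w)
          ≈⟨ solve 4 (λ s l s′ w → s :* (l :+ s′ :* w) := s :* l :+ s :* s′ :* w) refl _ _ _ _ ⟩
        slope cs * lower ds + slope cs * slope ds * w
          ≈⟨ +-congʳ (on-coefficients em) ⟩
        slope ds * lower cs + slope cs * slope ds * w
          ≈⟨ solve 4 (λ s l s′ w → s′ :* l :+ s :* s′ :* w := s′ :* (l :+ s :* w)) refl _ _ _ _ ⟩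
        slope ds * (lower cs + slope cs * w)
          ≈⟨ *-cong (slope-coefficients u) (sym (derivative-coefficients t)) ⟩
        eval x (sep v u) * eval x (D i t) ∎
        where
        cs = coefficients t
        ds = coefficients u
        value-cs = trans (value-coefficients t) e
        value-ds = trans (value-coefficients u) f
        on-coefficients : Dec (z ≈ 0#) → slope cs * lower ds ≈ slope ds * lower cs
        on-coefficients (no z≉0)  =
          proportional z≉0 _ cs ds ℕ.≤-refl (low-coefficients p) (low-coefficients q) value-cs value-ds
        on-coefficients (yes z≈0) = trans
          (*-congˡ (lower-vanishes z≈0 (low-coefficients q) value-ds))
          (trans (zeroʳ _) (sym (trans (*-congˡ (lower-vanishes z≈0 (low-coefficients p) value-cs)) (zeroʳ _))))

-- Leaders and the consistency of their equations

module Kernel {m : ℕ} {ℓ : Level} (K : DifferentialField m ℓ) (n : ℕ)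
              (L : Field ℓ ℓ) (ι : DifferentialField.underlying K ↪ L)
              (a : Variables.Var m n → Field.Carrier L) where
  open Variables m n
  open Numbering m n
  open DifferentialPolynomials K n
  private
    module L = Field L
    module ι = _↪_ ι
  open Evaluation L.commutativeRing ι.isRingHomomorphism public using () renaming (eval to evalᴸ)

  -- For a v algebraic over its predecessors, f is a separable equation; in characteristic p an inseparable a v has
  -- no such equation and is not a leader.
  Leader : Var → Set ℓ
  Leader v = ∃ λ f → Over (_≤# v) f × evalᴸ a f L.≈ L.0# × ¬ (evalᴸ a (sep v f) L.≈ L.0#)

  -- The equation depends on which leader below v the covering proof names; that all choices are
  -- compatible is the business of `Consistency`.
  equation : ∀ {r v} → Covered Leader r v → Term
  equation {v = τ , _} ((ρ , _) , (f , _) , _) = prolong ρ τ f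

-- The point x is known only through `known`, `solved` and `free`. For each v, `solved` promises the
-- equation of just one leader below v; those of the other leaders have to be deduced.
module Consistency {m : ℕ} {ℓ : Level} (em : ExcludedMiddle ℓ) (K : DifferentialField m ℓ) (n : ℕ)
    (L : Field ℓ ℓ) (ι : DifferentialField.underlying K ↪ L)
    (a : Variables.Var m n → Field.Carrier L) (r : ℕ)
    (prolongs : ∀ i {t} → DifferentialPolynomials.Over K n (λ v → Variables.ord m n v ≤ r ℕ.+ r) t →
      Field._≈_ L (Kernel.evalᴸ K n L ι a a t) (Field.0# L) →
      Field._≈_ L (Kernel.evalᴸ K n L ι a a (DifferentialPolynomials.D K n i t)) (Field.0# L))
    (stable : ∀ v → Kernel.Leader K n L ι a v → Variables.ord m n v ≤ suc (r ℕ.+ r) →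
      Variables.Covered m n (Kernel.Leader K n L ι a) r v)
    (B : CommutativeRing ℓ ℓ) (domain : NoZeroDivisors B)
    {emb : Field.Carrier L → CommutativeRing.Carrier B}
    (emb-isMono : IsRingMonomorphism (Field.rawRing L) (CommutativeRing.rawRing B) emb)
    (κ-isHom : IsRingHomomorphism (DifferentialField.rawRing K) (CommutativeRing.rawRing B) (emb ∘ _↪_.⟦_⟧ ι))
    (x : Variables.Var m n → CommutativeRing.Carrier B)
    (known : ∀ v → Variables.ord m n v ≤ r ℕ.+ r → CommutativeRing._≈_ B (x v) (emb (a v)))
    (solved : ∀ v → r ℕ.+ r < Variables.ord m n v → Variables.Covered m n (Kernel.Leader K n L ι a) r v →
      ∃ λ (c : Variables.Covered m n (Kernel.Leader K n L ι a) r v) →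
        CommutativeRing._≈_ B (DifferentialPolynomials.Evaluation.eval K n B κ-isHom x (Kernel.equation K n L ι a {r} {v} c))
          (CommutativeRing.0# B))
    (free : ∀ v → r ℕ.+ r < Variables.ord m n v → ¬ Variables.Covered m n (Kernel.Leader K n L ι a) r v →
      ∀ {cs} → All (DifferentialPolynomials.Over K n (λ u → DifferentialPolynomials._<#_ K n u v)) cs →
      CommutativeRing._≈_ B
        (horner B (List.map (DifferentialPolynomials.Evaluation.eval K n B κ-isHom x) cs) (x v)) (CommutativeRing.0# B) →
      All (λ c → CommutativeRing._≈_ B (DifferentialPolynomials.Evaluation.eval K n B κ-isHom x c) (CommutativeRing.0# B)) cs)
  where
  open Variables m n
  open Numbering m n
  open DifferentialPolynomials K n
  open Kernel K n L ι a
  open Evaluation B κ-isHom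
  open CommutativeRing B
  private
    module K = DifferentialField K
    module L = Field L
    module ι = _↪_ ι
    module emb = IsRingMonomorphism emb-isMono
    module κ = IsRingHomomorphism κ-isHom
    module Lᴿ = RingSolver L.commutativeRing
    module Lᴱ = Evaluation L.commutativeRing ι.isRingHomomorphism

    Cover : Var → Set ℓ
    Cover = Covered Leader r

    Small : Var → Set
    Small v = ord v ≤ r ℕ.+ r

    decide : (P : Set) → Dec P
    decide P with em {Lift ℓ P}
    ... | yes (lift p) = yes p
    ... | no ¬p        = no (¬p ∘ lift)

    cancel : ∀ {b c} → ¬ b ≈ 0# → b * c ≈ 0# → c ≈ 0#
    cancel {b} {c} b≉0 e with domain b c e
    ... | inj₁ b≈0 = contradiction b≈0 b≉0
    ... | inj₂ c≈0 = c≈0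

    eval-small : ∀ {t} → Over Small t → eval x t ≈ emb (evalᴸ a t)
    eval-small = eval-homo L.commutativeRing B ι.isRingHomomorphism κ-isHom emb.isRingHomomorphism
      (λ _ → refl) known

    zero-small : ∀ {t} → Over Small t → evalᴸ a t L.≈ L.0# → eval x t ≈ 0#
    zero-small o e = trans (eval-small o) (trans (emb.⟦⟧-cong e) emb.0#-homo)

    small-zero : ∀ {t} → Over Small t → eval x t ≈ 0# → evalᴸ a t L.≈ L.0#
    small-zero o e = emb.injective (trans (sym (eval-small o)) (trans e (sym emb.0#-homo)))

    ≤#-small : ∀ {v} → Small v → ∀ {t} → Over (_≤# v) t → Over Small t
    ≤#-small {v} p = Over-map λ u u≤v → ℕ.≤-trans (#≤⇒ord≤ {u} {v} u≤v) p

  equation-Over : ∀ {v} (c : Cover v) → Over (_≤# v) (equation {v = v} c)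
  equation-Over {τ , _} (_ , (_ , o , _) , _ , ρ≼τ , ≡.refl) = Over-prolong o τ ρ≼τ

  -- The separant has the value of that of the leader's own polynomial, which has order at most r,
  -- where x takes the given values.
  equation-sep : ∀ {v} (c : Cover v) → ¬ eval x (sep v (equation {v = v} c)) ≈ 0#
  equation-sep {τ , _} (u@(ρ , h) , (f , o , _ , s) , ρ≤r , ρ≼τ , ≡.refl) e =
    s (small-zero (Over-sep u (≤#-small {u} (ℕ.≤-trans ρ≤r (ℕ.m≤m+n r r)) o)) (trans (sym (sep-prolong x o τ ρ≼τ)) e))

  -- Each differentiation starts from order at most 2r, where `prolongs` applies; the last one may
  -- reach order 2r + 1.
  equation-L : ∀ {v} (c : Cover v) → ord v ≤ suc (r ℕ.+ r) → evalᴸ a (equation {v = v} c) L.≈ L.0#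
  equation-L {τ , k} ((ρ , _) , (f , o , e , _) , ρ≤r , ρ≼τ , ≡.refl) τ≤ = proj₂ (prolong-induction
    (λ τ t → Over (_≤# (τ , k)) t × (∣ τ ∣ ≤ suc (r ℕ.+ r) → evalᴸ a t L.≈ L.0#)) ρ f
    (λ t∼u (p , q) → proj₂ (Over-∼ t∼u) p , λ le → L.trans (Lᴱ.eval-∼ a t∼u) (q le))
    (o , λ _ → e)
    (λ σ i t _ (p , q) → Over-D-≤ i (σ , k) p , λ le →
      let σ≤ = ℕ.≤-pred (≡.subst (_≤ suc (r ℕ.+ r)) (ord-↑ (σ , k) i) le)
      in prolongs i (≤#-small {σ , k} σ≤ p) (q (ℕ.≤-trans σ≤ (ℕ.n≤1+n _))))
    τ ρ≼τ) τ≤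

  cover-↑ : ∀ {v} i → Cover v → Cover (v ↑ i)
  cover-↑ {σ , _} i (u , l , u≤r , ρ≼σ , e) = u , l , u≤r , ≼-trans ρ≼σ (≼⊞ε σ i) , e

  equation-↑ : ∀ {v} i (c : Cover v) → equation {v = v ↑ i} (cover-↑ {v} i c) ∼ D i (equation {v = v} c)
  equation-↑ {σ , _} i (u , (f , _) , _ , ρ≼σ , _) = prolong-step i f ρ≼σ

  private
    Top : Var → Set
    Top v = ord v ≡ suc (r ℕ.+ r)

    small≢top : ∀ {u v} → Small u → Top v → u ≢ v
    small≢top p q ≡.refl = ℕ.<⇒≱ (ℕ.≤-reflexive (≡.sym q)) p

    -- By the Leibniz rule the derivative of a polynomial of order 2r has at most one factor of
    -- order 2r + 1 in each product. N bounds the variables of order 2r + 1, which are eliminated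
    -- from the largest downwards.
    data Affine (N : ℕ) : Term → Set ℓ where
      small : ∀ {t} → Over Small t → Affine N t
      top   : ∀ {v} → Top v → # v < N → Affine N (var v)
      _⊕_   : ∀ {t u} → Affine N t → Affine N u → Affine N (t ⊕ u)
      _⊗ˡ_  : ∀ {t u} → Over Small t → Affine N u → Affine N (t ⊗ u)
      _⊗ʳ_  : ∀ {t u} → Affine N t → Over Small u → Affine N (t ⊗ u)
      ⊖_    : ∀ {t} → Affine N t → Affine N (⊖ t)

    Affine-D : ∀ i v → ord v ≡ r ℕ.+ r → ∀ {t} → Over (_≤# v) t → Affine (suc (# (v ↑ i))) (D i t)
    Affine-D i v e = go
      where
      low : ∀ {t} → Over (_≤# v) t → Over Small t
      low = ≤#-small {v} (ℕ.≤-reflexive e)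
      go : ∀ {t} → Over (_≤# v) t → Affine (suc (# (v ↑ i))) (D i t)
      go con         = small con
      go (var {u} p) with ℕ.m≤n⇒m<n∨m≡n (ℕ.≤-trans (#≤⇒ord≤ {u} {v} p) (ℕ.≤-reflexive e))
      ... | inj₁ u<  = small (var (≡.subst (_≤ r ℕ.+ r) (≡.sym (ord-↑ u i)) u<))
      ... | inj₂ u≡  = top (≡.trans (ord-↑ u i) (≡.cong suc u≡)) (s≤s (#-↑-mono-≤ i {u} {v} p))
      go (p ⊕ q)     = go p ⊕ go q
      go (p ⊗ q)     = (go p ⊗ʳ low q) ⊕ (low p ⊗ˡ go q)
      go (⊖ p)       = ⊖ go p

    Affine-Over : ∀ {N t} v → Top v → # v ≡ N → Affine N t → Over (_<# v) t
    Affine-Over v tv e (small p)    = Over-map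
      (λ u u-small → ord<⇒#< {u} {v} (ℕ.≤-trans (s≤s u-small) (ℕ.≤-reflexive (≡.sym tv)))) p
    Affine-Over v tv ≡.refl (top _ q) = var q
    Affine-Over v tv e (p ⊕ q)      = Affine-Over v tv e p ⊕ Affine-Over v tv e q
    Affine-Over v tv e (p ⊗ˡ q)     = Affine-Over v tv e (small p) ⊗ Affine-Over v tv e q
    Affine-Over v tv e (p ⊗ʳ q)     = Affine-Over v tv e p ⊗ Affine-Over v tv e (small q)
    Affine-Over v tv e (⊖ p)        = ⊖ Affine-Over v tv e p

    Affine-0 : ∀ {t} → Affine 0 t → Over Small t
    Affine-0 (small p) = p
    Affine-0 (p ⊕ q)   = Affine-0 p ⊕ Affine-0 q
    Affine-0 (p ⊗ˡ q)  = p ⊗ Affine-0 q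
    Affine-0 (p ⊗ʳ q)  = Affine-0 p ⊗ q
    Affine-0 (⊖ p)     = ⊖ Affine-0 p

    Affine-pred : ∀ {N t} → ¬ (∃ λ v → Top v × # v ≡ N) → Affine (suc N) t → Affine N t
    Affine-pred ¬e (small p)        = small p
    Affine-pred ¬e (top {v} tv v<N) = top tv (ℕ.≤∧≢⇒< (ℕ.≤-pred v<N) (λ e → ¬e (v , tv , e)))
    Affine-pred ¬e (p ⊕ q)          = Affine-pred ¬e p ⊕ Affine-pred ¬e q
    Affine-pred ¬e (p ⊗ˡ q)         = p ⊗ˡ Affine-pred ¬e q
    Affine-pred ¬e (p ⊗ʳ q)         = Affine-pred ¬e p ⊗ʳ q
    Affine-pred ¬e (⊖ p)            = ⊖ Affine-pred ¬e p

    erase : Var → Term → Term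
    erase v (con c) = con c
    erase v (var u) with u ≟ᵛ v
    ... | yes _     = con K.0#
    ... | no _      = var u
    erase v (t ⊕ u) = erase v t ⊕ erase v u
    erase v (t ⊗ u) = erase v t ⊗ erase v u
    erase v (⊖ t)   = ⊖ erase v t

    erase-Over : ∀ {P} v {t} → Over P t → Over P (erase v t)
    erase-Over v con         = con
    erase-Over v (var {u} p) with u ≟ᵛ v
    ... | yes _              = con
    ... | no _               = var p
    erase-Over v (p ⊕ q)     = erase-Over v p ⊕ erase-Over v q
    erase-Over v (p ⊗ q)     = erase-Over v p ⊗ erase-Over v q
    erase-Over v (⊖ p)       = ⊖ erase-Over v p

    erase-Affine : ∀ {N} v → # v ≡ N → ∀ {t} → Affine (suc N) t → Affine N (erase v t)
    erase-Affine v e (small p)          = small (erase-Over v p)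
    erase-Affine v e (top {u} tu u<N) with u ≟ᵛ v
    ... | yes _ = small con
    ... | no ¬e = top tu (ℕ.≤∧≢⇒< (ℕ.≤-pred u<N) (λ f → ¬e (#-injective (≡.trans f (≡.sym e)))))
    erase-Affine v e (p ⊕ q)            = erase-Affine v e p ⊕ erase-Affine v e q
    erase-Affine v e (p ⊗ˡ q)           = erase-Over v p ⊗ˡ erase-Affine v e q
    erase-Affine v e (p ⊗ʳ q)           = erase-Affine v e p ⊗ʳ erase-Over v q
    erase-Affine v e (⊖ p)              = ⊖ erase-Affine v e p

    coefficient : ∀ {N t} → Var → Affine N t → Term
    coefficient v (small _)   = con K.0#
    coefficient v (top {u} _ _) with u ≟ᵛ v
    ... | yes _               = con K.1#
    ... | no _                = con K.0#
    coefficient v (p ⊕ q)     = coefficient v p ⊕ coefficient v q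
    coefficient v (_⊗ˡ_ {t = t} p q) = t ⊗ coefficient v q
    coefficient v (_⊗ʳ_ {u = u} p q) = coefficient v p ⊗ u
    coefficient v (⊖ p)       = ⊖ coefficient v p

    coefficient-Over : ∀ {N t} v (p : Affine N t) → Over Small (coefficient v p)
    coefficient-Over v (small _)   = con
    coefficient-Over v (top {u} _ _) with u ≟ᵛ v
    ... | yes _                    = con
    ... | no _                     = con
    coefficient-Over v (p ⊕ q)     = coefficient-Over v p ⊕ coefficient-Over v q
    coefficient-Over v (p ⊗ˡ q)    = p ⊗ coefficient-Over v q
    coefficient-Over v (p ⊗ʳ q)    = coefficient-Over v p ⊗ q
    coefficient-Over v (⊖ p)       = ⊖ coefficient-Over v p

    -- Stated over an arbitrary ring, because the same splitting is applied at a in L and at x in B.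
    module Split (A : CommutativeRing ℓ ℓ) {λᴬ : K.Carrier → CommutativeRing.Carrier A}
                 (isHom : IsRingHomomorphism K.rawRing (CommutativeRing.rawRing A) λᴬ)
                 (y : Var → CommutativeRing.Carrier A) where
      private
        module A = CommutativeRing A
        module E = Evaluation A isHom
        module S = RingSolver A
        module h = IsRingHomomorphism isHom
      open S using (_:=_; _:+_; _:*_; :-_; :0; :1)

      erased : Var → Var → A.Carrier
      erased v u with u ≟ᵛ v
      ... | yes _ = A.0#
      ... | no _  = y u

      eval-erase : ∀ v t → E.eval y (erase v t) A.≈ E.eval (erased v) t
      eval-erase v (con c) = A.refl
      eval-erase v (var u) with u ≟ᵛ v
      ... | yes _          = h.0#-homo
      ... | no _           = A.refl
      eval-erase v (t ⊕ u) = A.+-cong (eval-erase v t) (eval-erase v u)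
      eval-erase v (t ⊗ u) = A.*-cong (eval-erase v t) (eval-erase v u)
      eval-erase v (⊖ t)   = A.-‿cong (eval-erase v t)

      erased-agree : ∀ v u → u ≢ v → y u A.≈ erased v u
      erased-agree v u u≢v with u ≟ᵛ v
      ... | yes e = contradiction e u≢v
      ... | no _  = A.refl

      erased-zero : ∀ v → erased v v A.≈ A.0#
      erased-zero v with v ≟ᵛ v
      ... | yes _ = A.refl
      ... | no ¬e = contradiction ≡.refl ¬e

      erase-small : ∀ {v} → Top v → ∀ {t} → Over Small t → E.eval y t A.≈ E.eval y (erase v t)
      erase-small {v} tv {t} o = A.trans
        (E.eval-agree (λ u u-small → erased-agree v u (small≢top u-small tv)) o) (A.sym (eval-erase v t))

      split : ∀ {N v} → Top v → ∀ {t} (p : Affine N t) →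
              E.eval y t A.≈ E.eval y (erase v t) A.+ E.eval y (coefficient v p) A.* y v
      split tv (small p) = A.trans (erase-small tv p) (A.sym (A.trans
        (A.+-congˡ (A.trans (A.*-congʳ h.0#-homo) (A.zeroˡ _))) (A.+-identityʳ _)))
      split {v = v} tv (top {u} _ _) with u ≟ᵛ v
      ... | yes ≡.refl = A.sym (A.trans (A.+-cong h.0#-homo (A.*-congʳ h.1#-homo))
                           (S.solve 1 (λ w → :0 :+ :1 :* w := w) A.refl _))
      ... | no _       = A.sym (A.trans (A.+-congˡ (A.trans (A.*-congʳ h.0#-homo) (A.zeroˡ _))) (A.+-identityʳ _))
      split tv (p ⊕ q) = A.trans (A.+-cong (split tv p) (split tv q))
        (S.solve 5 (λ e c f d w → (e :+ c :* w) :+ (f :+ d :* w) := (e :+ f) :+ (c :+ d) :* w) A.refl _ _ _ _ _)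
      split tv (p ⊗ˡ q) = A.trans (A.*-congˡ (split tv q)) (A.trans
        (S.solve 4 (λ t f d w → t :* (f :+ d :* w) := t :* f :+ t :* d :* w) A.refl _ _ _ _)
        (A.+-congʳ (A.*-congʳ (erase-small tv p))))
      split tv (p ⊗ʳ q) = A.trans (A.*-congʳ (split tv p)) (A.trans
        (S.solve 4 (λ t f d w → (f :+ d :* w) :* t := f :* t :+ d :* t :* w) A.refl _ _ _ _)
        (A.+-congʳ (A.*-congˡ (erase-small tv q))))
      split tv (⊖ p) = A.trans (A.-‿cong (split tv p))
        (S.solve 3 (λ e c w → :- (e :+ c :* w) := :- e :+ :- c :* w) A.refl _ _ _)

      D-split : ∀ i v {t} → Over (_≤# v) t →
                E.eval y (D i t) A.≈ E.eval y (erase (v ↑ i) (D i t)) A.+ E.eval y (sep v t) A.* y (v ↑ i)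
      D-split i v {t} o = A.trans
        (E.D-leader i v (λ u u<v → erased-agree (v ↑ i) u λ { ≡.refl → ℕ.<-irrefl ≡.refl u<v }) (erased-zero (v ↑ i)) o)
        (A.+-congʳ (A.sym (eval-erase (v ↑ i) (D i t))))

    module Splitᴸ = Split L.commutativeRing ι.isRingHomomorphism a
    module Splitᴮ = Split B κ-isHom x

  open RingSolver B using (solve; _:=_; _:+_; _:*_; _:-_)

  private
    common-cover : ∀ v (k l : Cover v) → r ℕ.+ r < ord v → ∃ λ i → ∃ λ σ → ∃ λ (k′ : Cover σ) → ∃ λ (l′ : Cover σ) →
      v ≡ σ ↑ i × equation {v = v} k ∼ D i (equation {v = σ} k′) × equation {v = v} l ∼ D i (equation {v = σ} l′)
    common-cover (τ , h) k@((ρ , _) , (f , _) , ρ≤r , ρ≼τ , e) l@((ρ′ , _) , (f′ , _) , ρ′≤r , ρ′≼τ , e′) lt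
      with i , σ , ≡.refl , ρ≼σ , ρ′≼σ ← common-predecessor ρ≼τ ρ′≼τ (ℕ.≤-<-trans (ℕ.+-mono-≤ ρ≤r ρ′≤r) lt)
      = i , (σ , h) , (proj₁ k , proj₁ (proj₂ k) , ρ≤r , ρ≼σ , e) , (proj₁ l , proj₁ (proj₂ l) , ρ′≤r , ρ′≼σ , e′) ,
        ≡.refl , prolong-step i f ρ≼σ , prolong-step i f′ ρ′≼σ

    sep-self : ∀ v → evalᴸ a (sep v (var v)) L.≈ L.1#
    sep-self v with v ≟ᵛ v
    ... | yes _ = ι.1#-homo
    ... | no ¬e = contradiction ≡.refl ¬e

    -- Rewritten as its rest plus c · x_v, the relation has separant c, which is nonzero at a.
    leader-of : ∀ {N g} v → Top v → # v ≡ N → (p : Affine (suc N) g) → evalᴸ a g L.≈ L.0# →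
                ¬ evalᴸ a (coefficient v p) L.≈ L.0# → Leader v
    leader-of {g = g} v tv e p g≈0 c≉0 =
      erase v g ⊕ c ⊗ var v ,
      Over-map (λ _ → ℕ.<⇒≤) below-rest ⊕ Over-map (λ _ → ℕ.<⇒≤) below-c ⊗ var ℕ.≤-refl ,
      L.trans (L.sym (Splitᴸ.split tv p)) g≈0 ,
      λ s≈0 → c≉0 (L.trans (L.sym sep≈c) s≈0)
      where
      c = coefficient v p
      below-rest : Over (_<# v) (erase v g)
      below-rest = Affine-Over v tv e (erase-Affine v e p)
      below-c : Over (_<# v) c
      below-c = Affine-Over v tv e (small (coefficient-Over v p))
      avoid : ∀ u → u <# v → u ≢ v
      avoid u u<v ≡.refl = ℕ.<-irrefl ≡.refl u<v
      sep≈c : evalᴸ a (sep v (erase v g ⊕ c ⊗ var v)) L.≈ evalᴸ a c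
      sep≈c = L.trans
        (L.+-cong (Lᴱ.sep-free a v (Over-map avoid below-rest))
          (L.+-cong (L.*-congʳ (Lᴱ.sep-free a v (Over-map avoid below-c))) (L.*-congˡ (sep-self v))))
        (Lᴿ.solve 2 (λ w c → Lᴿ.:0 Lᴿ.:+ (Lᴿ.:0 Lᴿ.:* w Lᴿ.:+ c Lᴿ.:* Lᴿ.:1) Lᴿ.:= c) L.refl _ _)

    -- In characteristic p the values x of order r + r + 1 could violate a constraint on an inseparable
    -- variable of order r + r. They do not, because the constraints are affine, hold at a, and are
    -- eliminated by the equations of the leaders.
    affine-zero : ∀ N {g} → Affine N g → evalᴸ a g L.≈ L.0# → eval x g ≈ 0#
    affine-zero zero        p g≈0 = zero-small (Affine-0 p) g≈0
    affine-zero (suc N) {g} p g≈0 with decide (∃ λ v → Top v × # v ≡ N)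
    ... | no ¬v = affine-zero N (Affine-pred ¬v p) g≈0
    ... | yes (v , tv , e) = by-coefficient em
      where
      c = coefficient v p
      c-small = coefficient-Over v p
      rest-zero : evalᴸ a (erase v g) L.≈ L.0# → eval x (erase v g) ≈ 0#
      rest-zero = affine-zero N (erase-Affine v e p)
      large : r ℕ.+ r < ord v
      large = ℕ.≤-reflexive (≡.sym tv)
      eliminate : (k : Cover v) → eval x (equation {v = v} k) ≈ 0# → eval x g ≈ 0#
      -- Naming the same leader twice yields a predecessor σ of v above it. With f its equation at
      -- σ, D i f is linear in x_v with coefficient S, so S · g - C · D i f is free of x_v. This
      -- combination vanishes at a, hence at x by induction.
      eliminate k k≈0 with common-cover v k k large
      ... | i , σ , k′ , _ , ≡.refl , ∼D , _ = cancel (equation-sep {σ} k′) (begin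
        S * eval x g
          ≈⟨ *-congˡ (Splitᴮ.split tv p) ⟩
        S * (G + C * w)
          ≈⟨ solve 5 (λ S G C H w → S :* (G :+ C :* w) := (S :* G :- C :* H) :+ C :* (H :+ S :* w)) refl S G C H w ⟩
        (S * G - C * H) + C * (H + S * w)
          ≈⟨ +-cong combination (*-congˡ (trans (sym (Splitᴮ.D-split i σ under)) (trans (sym (eval-∼ x ∼D)) k≈0))) ⟩
        0# + C * 0#
          ≈⟨ trans (+-identityˡ _) (zeroʳ C) ⟩
        0# ∎)
        where
        open Relation.Binary.Reasoning.Setoid setoid
        f = equation {v = σ} k′
        under = equation-Over {σ} k′
        σ-order : ord σ ≡ r ℕ.+ r
        σ-order = ℕ.suc-injective (≡.trans (≡.sym (ord-↑ σ i)) tv)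
        S-small : Over Small (sep σ f)
        S-small = Over-sep σ (≤#-small {σ} (ℕ.≤-reflexive σ-order) under)
        w = x v
        S = eval x (sep σ f)
        C = eval x c
        G = eval x (erase v g)
        H = eval x (erase v (D i f))
        combinationᴸ : evalᴸ a (sep σ f) L.* evalᴸ a (erase v g) L.- evalᴸ a c L.* evalᴸ a (erase v (D i f)) L.≈ L.0#
        combinationᴸ = L.trans
          (Lᴿ.solve 5 (λ S G C H w → S Lᴿ.:* G Lᴿ.:- C Lᴿ.:* H Lᴿ.:= S Lᴿ.:* (G Lᴿ.:+ C Lᴿ.:* w) Lᴿ.:- C Lᴿ.:* (H Lᴿ.:+ S Lᴿ.:* w))
            L.refl _ _ _ _ (a v))
          (L.trans
            (L.+-cong
              (L.*-congˡ (L.trans (L.sym (Splitᴸ.split tv p)) g≈0))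
              (L.-‿cong (L.*-congˡ (L.trans (L.sym (Splitᴸ.D-split i σ under))
                (L.trans (L.sym (Lᴱ.eval-∼ a ∼D)) (equation-L {v} k (ℕ.≤-reflexive tv)))))))
            (Lᴿ.solve 2 (λ S C → S Lᴿ.:* Lᴿ.:0 Lᴿ.:- C Lᴿ.:* Lᴿ.:0 Lᴿ.:= Lᴿ.:0) L.refl _ _))
        D-affine : Affine N (erase v (D i f))
        D-affine = erase-Affine v e (≡.subst (λ M → Affine (suc M) (D i f)) e (Affine-D i σ σ-order under))
        combination : S * G - C * H ≈ 0#
        combination = affine-zero N ((S-small ⊗ˡ erase-Affine v e p) ⊕ (⊖ (c-small ⊗ˡ D-affine))) combinationᴸ
      by-coefficient : Dec (evalᴸ a c L.≈ L.0#) → eval x g ≈ 0#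
      by-coefficient (yes c≈0) = trans (Splitᴮ.split tv p)
        (trans (+-cong (rest-zero (L.trans (L.sym (L.trans (L.+-congˡ (L.trans (L.*-congʳ c≈0) (L.zeroˡ _))) (L.+-identityʳ _)))
                         (L.trans (L.sym (Splitᴸ.split tv p)) g≈0)))
                       (trans (*-congʳ (zero-small c-small c≈0)) (zeroˡ _)))
          (+-identityʳ 0#))
      -- A nonzero coefficient makes v a leader. Stability puts a leader of order at most r below
      -- it, and so some equation for x_v holds at x.
      by-coefficient (no c≉0) with solved v large (stable v (leader-of v tv e p g≈0 c≉0) (ℕ.≤-reflexive tv))
      ... | k , k≈0 = eliminate k k≈0

  EquationsHold : ℕ → Set ℓ
  EquationsHold N = ∀ v → # v < N → (c : Cover v) → eval x (equation {v = v} c) ≈ 0#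

  -- N bounds the variables after differentiation, so that this statement and `EquationsHold` at N
  -- involve the same values and can be proved together.
  DerivativesVanish : ℕ → Set ℓ
  DerivativesVanish N = ∀ i {t} → Over (λ u → # (u ↑ i) < N) t → eval x t ≈ 0# → eval x (D i t) ≈ 0#

  private
    closed : ∀ i {P t} → (∀ u → ¬ P u) → Over P t → ∃ λ c → eval x t ≈ emb ι.⟦ c ⟧ × eval x (D i t) ≈ emb ι.⟦ K.∂ i c ⟧
    closed i ¬P (con {c}) = c , refl , refl
    closed i ¬P (var p) = contradiction p (¬P _)
    closed i ¬P (p ⊕ q) with closed i ¬P p | closed i ¬P q
    ... | c , e , e′ | d , f , f′ = c K.+ d , trans (+-cong e f) (sym (κ.+-homo c d)) ,
      trans (+-cong e′ f′) (trans (sym (κ.+-homo _ _)) (κ.⟦⟧-cong (K.sym (+-rule c d))))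
      where open IsDerivation (K.isDerivation i)
    closed i ¬P (p ⊗ q) with closed i ¬P p | closed i ¬P q
    ... | c , e , e′ | d , f , f′ = c K.* d , trans (*-cong e f) (sym (κ.*-homo c d)) ,
      trans (+-cong (trans (*-cong e′ f) (sym (κ.*-homo _ _))) (trans (*-cong e f′) (sym (κ.*-homo _ _))))
        (trans (sym (κ.+-homo _ _)) (κ.⟦⟧-cong (K.sym (leibniz c d))))
      where open IsDerivation (K.isDerivation i)
    closed i ¬P (⊖ p) with closed i ¬P p
    ... | c , e , e′ = K.- c , trans (-‿cong e) (sym (κ.-‿homo c)) ,
      trans (-‿cong e′) (trans (sym (κ.-‿homo _)) (κ.⟦⟧-cong (K.sym (∂-neg c))))
      where open DerivationProperties K.commutativeRing (K.isDerivation i) using () renaming (D-neg to ∂-neg)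

    -- Without variables, t has the value of an element of K, and this element is zero because K
    -- embeds into B.
    vanish-0 : DerivativesVanish 0
    vanish-0 i {t} o t≈0 with closed i (λ _ ()) o
    ... | c , e , e′ = trans e′ (trans (κ.⟦⟧-cong (K.trans (D-cong′ c≈0) ∂0≈0)) κ.0#-homo)
      where
      open IsDerivation (K.isDerivation i) using () renaming (D-cong to D-cong′)
      open DerivationProperties K.commutativeRing (K.isDerivation i) using () renaming (D-0 to ∂0≈0)
      c≈0 : c K.≈ K.0#
      c≈0 = ι.injective (emb.injective (trans (sym e) (trans t≈0 (sym κ.0#-homo))))

    lower-vanish : ∀ {N} i σ → # (σ ↑ i) ≡ N → DerivativesVanish N →
                   ∀ {t} → Over (_<# σ) t → eval x t ≈ 0# → eval x (D i t) ≈ 0#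
    lower-vanish i σ e Q o = Q i (Over-map (λ u u<σ → ≡.subst (# (u ↑ i) <_) e (#-↑-mono-< i {u} {σ} u<σ)) o)

    -- A single polynomial with leader σ and nonzero separant decides for all: by `sep-proportional`
    -- its separant times any other derivative is a multiple of its own derivative.
    transfer : ∀ {N} i σ → # (σ ↑ i) ≡ N → DerivativesVanish N → (c : Cover σ) → eval x (equation {v = σ} c) ≈ 0# →
               eval x (D i (equation {v = σ} c)) ≈ 0# →
               ∀ {t} → Over (_≤# σ) t → eval x t ≈ 0# → eval x (D i t) ≈ 0#
    transfer i σ e Q c c≈0 Dc≈0 o t≈0 = cancel (equation-sep {σ} c) (trans
      (Univariate.sep-proportional K n B κ-isHom x σ i (lower-vanish i σ e Q) em domain (equation-Over {σ} c) o c≈0 t≈0)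
      (trans (*-congˡ Dc≈0) (zeroʳ _)))

    equations-suc : ∀ N → EquationsHold N → DerivativesVanish N → EquationsHold (suc N)
    equations-suc N C Q v v<N c with ℕ.m≤n⇒m<n∨m≡n (ℕ.≤-pred v<N)
    ... | inj₁ v<N′ = C v v<N′ c
    ... | inj₂ e with ord v ℕ.≤? r ℕ.+ r
    ... | yes v-small = zero-small (≤#-small {v} v-small (equation-Over {v} c)) (equation-L {v} c (ℕ.≤-trans v-small (ℕ.n≤1+n _)))
    ... | no v-large with solved v (ℕ.≰⇒> v-large) c
    ... | d , d≈0 with common-cover v c d (ℕ.≰⇒> v-large)
    -- The equation of d holds by the choice of x_v and is the derivative of the equation of d′ at
    -- σ; the equation of c′ also vanishes at σ and inherits the vanishing derivative.
    ... | i , σ , c′ , d′ , ≡.refl , ∼c , ∼d = trans (eval-∼ x ∼c)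
      (transfer i σ e Q d′ (C σ σ<N d′) (trans (sym (eval-∼ x ∼d)) d≈0) (equation-Over {σ} c′) (C σ σ<N c′))
      where
      σ<N : # σ < N
      σ<N = ≡.subst (# σ <_) e (#<#-↑ σ i)

    -- For the variable σ ↑ i numbered N, the order of σ decides. Below 2r, D i t is evaluated at
    -- given values only; at 2r, it is affine in the chosen values of order 2r + 1; above 2r, x_σ
    -- either has an equation or is transcendental.
    vanish-suc : ∀ N → EquationsHold N → EquationsHold (suc N) → DerivativesVanish N → DerivativesVanish (suc N)
    vanish-suc N C C′ Q i {t} o t≈0 with decide (∃ λ σ → # (σ ↑ i) ≡ N)
    ... | no ¬σ = Q i (Over-map (λ u u<N → ℕ.≤∧≢⇒< (ℕ.≤-pred u<N) (λ e → ¬σ (u , e))) o) t≈0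
    ... | yes (σ , e) = by-order (ℕ.<-cmp (ord σ) (r ℕ.+ r))
      where
      o′ : Over (_≤# σ) t
      o′ = Over-map (λ u u<N → #-↑-cancel-≤ i {u} {σ} (ℕ.≤-trans (ℕ.≤-pred u<N) (ℕ.≤-reflexive (≡.sym e)))) o
      by-cover : r ℕ.+ r < ord σ → Dec (Cover σ) → eval x (D i t) ≈ 0#
      -- `C′` is one stage ahead of `C`: the equation of σ ↑ i, which is the derivative of that of
      -- σ, has already been verified.
      by-cover _ (yes c) = transfer i σ e Q c (C σ (≡.subst (# σ <_) e (#<#-↑ σ i)) c)
        (trans (sym (eval-∼ x (equation-↑ {σ} i c))) (C′ (σ ↑ i) (s≤s (ℕ.≤-reflexive e)) (cover-↑ {σ} i c))) o′ t≈0
      by-cover large (no ¬c) = Univariate.transcendental-derivative K n B κ-isHom x σ i (lower-vanish i σ e Q)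
        (λ {cs} lows v≈0 → free σ large ¬c lows (trans (reflexive (horner≡value cs)) v≈0)) o′ t≈0
        where
        horner≡value : ∀ cs → horner B (List.map (eval x) cs) (x σ) ≡ Univariate.value K n B κ-isHom x σ i cs
        horner≡value []       = ≡.refl
        horner≡value (c ∷ cs) = ≡.cong (λ p → eval x c + x σ * p) (horner≡value cs)
      by-order : _ → eval x (D i t) ≈ 0#
      by-order (tri< σ< _ _) = zero-small
        (≤#-small {σ ↑ i} (≡.subst (_≤ r ℕ.+ r) (≡.sym (ord-↑ σ i)) σ<) (Over-D-≤ i σ o′))
        (prolongs i t-small (small-zero t-small t≈0))
        where t-small = ≤#-small {σ} (ℕ.<⇒≤ σ<) o′
      by-order (tri≈ _ σ≡ _) = affine-zero _ (Affine-D i σ σ≡ o′) (prolongs i t-small (small-zero t-small t≈0))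
        where t-small = ≤#-small {σ} (ℕ.≤-reflexive σ≡) o′
      by-order (tri> _ _ σ>) = by-cover σ> em

    both : ∀ N → EquationsHold N × DerivativesVanish N
    both zero    = (λ _ ()) , vanish-0
    both (suc N) with both N
    ... | C , Q = let C′ = equations-suc N C Q in C′ , vanish-suc N C C′ Q

    bound : ∀ i t → ∃ λ N → Over (λ u → # (u ↑ i) < N) t
    bound i (con c) = 0 , con
    bound i (var v) = _ , var ℕ.≤-refl
    bound i (t ⊕ u) with bound i t | bound i u
    ... | M , p | N , q = M ℕ.⊔ N , Over-map (λ _ h → ℕ.≤-trans h (ℕ.m≤m⊔n M N)) p ⊕ Over-map (λ _ h → ℕ.≤-trans h (ℕ.m≤n⊔m M N)) q
    bound i (t ⊗ u) with bound i t | bound i u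
    ... | M , p | N , q = M ℕ.⊔ N , Over-map (λ _ h → ℕ.≤-trans h (ℕ.m≤m⊔n M N)) p ⊗ Over-map (λ _ h → ℕ.≤-trans h (ℕ.m≤n⊔m M N)) q
    bound i (⊖ t) with bound i t
    ... | N , p = N , ⊖ p

  derivatives-vanish : ∀ i t → eval x t ≈ 0# → eval x (D i t) ≈ 0#
  derivatives-vanish i t with bound i t
  ... | N , o = proj₂ (both N) i o

-- The generic point

module _ {ℓ : Level} (em : ExcludedMiddle ℓ) (L : Field ℓ ℓ) where
  open Field L

  field-noZeroDivisors : NoZeroDivisors commutativeRing
  field-noZeroDivisors x y xy≈0 with em {x ≈ 0#}
  ... | yes x≈0 = inj₁ x≈0
  ... | no x≉0 with invertible x x≉0
  ... | x⁻¹ , x⁻¹x≈1 , _ = inj₂ (trans (sym (*-identityˡ y)) (trans (*-congʳ (sym x⁻¹x≈1))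
    (trans (*-assoc _ _ _) (trans (*-congˡ xy≈0) (zeroʳ _)))))

module GenericPoint {m : ℕ} {ℓ : Level} (em : ExcludedMiddle ℓ) (K : DifferentialField m ℓ) (n : ℕ)
    (L : Field ℓ ℓ) (ι : DifferentialField.underlying K ↪ L)
    (a : Variables.Var m n → Field.Carrier L) (r : ℕ)
    (T : FreeExtension (Field.commutativeRing L)) where
  open Variables m n
  open Numbering m n
  open DifferentialPolynomials K n
  open Kernel K n L ι a
  private
    module L = Field L
    module ι = _↪_ ι
    module Lᴱ = Evaluation L.commutativeRing ι.isRingHomomorphism
    module T = FreeExtension T

  private
    B : CommutativeRing ℓ ℓ
    B = T.ring

  open CommutativeRing B
  open T using (emb; emb-isMono; In-emb)

  private
    module emb′ = IsRingMonomorphism emb-isMono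

  κ-isHom : IsRingHomomorphism (DifferentialField.rawRing K) rawRing (emb ∘ ι.⟦_⟧)
  κ-isHom = ringHomomorphism (DifferentialField.commutativeRing K) B
    (λ e → emb′.⟦⟧-cong (ι.⟦⟧-cong e))
    (λ x y → trans (emb′.⟦⟧-cong (ι.+-homo x y)) (emb′.+-homo _ _))
    (λ x y → trans (emb′.⟦⟧-cong (ι.*-homo x y)) (emb′.*-homo _ _))
    (trans (emb′.⟦⟧-cong ι.1#-homo) emb′.1#-homo)

  open Evaluation B κ-isHom

  private
    Cover : Var → Set ℓ
    Cover = Covered Leader r

    separant⁻¹ : ∀ {v} → Cover v → L.Carrier
    separant⁻¹ (u , (_ , _ , _ , s) , _) = proj₁ (L.invertible _ s)

    -- y holds the values at the earlier variables, and 0 at v.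
    nextValue : (v : Var) → (Var → Carrier) → Dec (ord v ≤ r ℕ.+ r) → Dec (Cover v) → Carrier
    nextValue v y (yes _) _       = emb (a v)
    nextValue v y (no _)  (yes c) = - (emb (separant⁻¹ {v} c) * eval y (equation {v = v} c))
    nextValue v y (no _)  (no _)  = T.generator (# v)

    choose : ∀ N (v : Var) → (Var → Carrier) → Tri (# v < N) (# v ≡ N) (N < # v) → Carrier
    choose N v y (tri< _ _ _) = y v
    choose N v y (tri≈ _ _ _) = nextValue v y (ord v ℕ.≤? r ℕ.+ r) em
    choose N v y (tri> _ _ _) = 0#

    -- Recursion on N replaces recursion along the order. The value 0 at variables numbered N or
    -- higher is what `D-leader` asks for at the variable being solved.
    partial : ℕ → Var → Carrier
    partial zero    v = 0#
    partial (suc N) v = choose N v (partial N) (ℕ.<-cmp (# v) N)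

  point : Var → Carrier
  point v = nextValue v (partial (# v)) (ord v ℕ.≤? r ℕ.+ r) em

  private
    partial-point : ∀ N v → # v < N → partial N v ≡ point v
    partial-point (suc N) v v<N with ℕ.<-cmp (# v) N
    ... | tri< v<N′ _ _     = partial-point N v v<N′
    ... | tri≈ _ ≡.refl _   = ≡.refl
    ... | tri> _ _ N<v      = contradiction (ℕ.≤-pred v<N) (ℕ.<⇒≱ N<v)

    partial-zero : ∀ N v → N ≤ # v → partial N v ≡ 0#
    partial-zero zero    v _   = ≡.refl
    partial-zero (suc N) v N<v with ℕ.<-cmp (# v) N
    ... | tri< v<N _ _    = contradiction (ℕ.<-trans N<v v<N) (ℕ.<-irrefl ≡.refl)
    ... | tri≈ _ ≡.refl _ = contradiction N<v (ℕ.<-irrefl ≡.refl)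
    ... | tri> _ _ _      = ≡.refl

    In-0 : ∀ N → T.In N 0#
    In-0 N = T.In-resp emb′.0#-homo (In-emb N L.0#)

    In-eval : ∀ {P y} N → (∀ v → P v → T.In N (y v)) → ∀ {t} → Over P t → T.In N (eval y t)
    In-eval N y∈ con     = In-emb N _
    In-eval N y∈ (var p) = y∈ _ p
    In-eval N y∈ (p ⊕ q) = T.In-+ (In-eval N y∈ p) (In-eval N y∈ q)
    In-eval N y∈ (p ⊗ q) = T.In-* (In-eval N y∈ p) (In-eval N y∈ q)
    In-eval N y∈ (⊖ p)   = T.In-neg (In-eval N y∈ p)

    everything : ∀ t → Over (λ v → v ≡ v) t
    everything (con c) = con
    everything (var v) = var ≡.refl
    everything (t ⊕ u) = everything t ⊕ everything u
    everything (t ⊗ u) = everything t ⊗ everything u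
    everything (⊖ t)   = ⊖ everything t

    In-next : ∀ v y p q → (∀ u → T.In (# v) (y u)) → T.In (suc (# v)) (nextValue v y p q)
    In-next v y (yes _) _       y∈ = In-emb (suc (# v)) (a v)
    In-next v y (no _)  (yes c) y∈ = T.In-neg (T.In-* (In-emb (suc (# v)) _)
      (T.In-suc (In-eval (# v) (λ u _ → y∈ u) (everything (equation {v = v} c)))))
    In-next v y (no _)  (no _)  y∈ = T.In-generator (# v)

    -- The value at v uses either given elements, earlier values or the generator numbered `# v`, so
    -- the first N generators suffice for the variables numbered below N.
    In-partial : ∀ N v → T.In N (partial N v)
    In-partial zero    v = In-0 0
    In-partial (suc N) v with ℕ.<-cmp (# v) N
    ... | tri< _ _ _      = T.In-suc (In-partial N v)
    ... | tri≈ _ e _      = ≡.subst (λ M → T.In (suc M) (nextValue v (partial N) (ord v ℕ.≤? r ℕ.+ r) em)) e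
      (In-next v (partial N) (ord v ℕ.≤? r ℕ.+ r) em (λ u → ≡.subst (λ M → T.In M (partial N u)) (≡.sym e) (In-partial N u)))
    ... | tri> _ _ _      = In-0 (suc N)

    In-point : ∀ v N → # v < N → T.In N (point v)
    In-point v N v<N = ≡.subst (T.In N) (partial-point N v v<N) (In-partial N v)

  point-known : ∀ v → ord v ≤ r ℕ.+ r → point v ≈ emb (a v)
  point-known v p with ord v ℕ.≤? r ℕ.+ r
  ... | yes _ = refl
  ... | no ¬p = contradiction p ¬p

  -- The equation that holds is that of the leader returned by `em` in the definition of `point`,
  -- which need not be the one in the hypothesis; hence the existential conclusion.
  point-solved : ∀ v → r ℕ.+ r < ord v → Cover v → ∃ λ (c : Cover v) → eval point (equation {v = v} c) ≈ 0#
  point-solved v large d = from-next em ≡.refl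
    where
    separant-inverse : (c : Cover v) → eval point (sep (proj₁ c) (proj₁ (proj₁ (proj₂ c)))) * emb (separant⁻¹ {v} c) ≈ 1#
    separant-inverse c@(u , (f , o , _ , s) , u≤r , _) = trans
      (*-congʳ (eval-homo L.commutativeRing B ι.isRingHomomorphism κ-isHom emb′.isRingHomomorphism (λ _ → refl)
        (λ w w≤u → point-known w (ℕ.≤-trans (ℕ.≤-trans (#≤⇒ord≤ {w} {u} w≤u) u≤r) (ℕ.m≤m+n r r)))
        (Over-sep u o)))
      (trans (sym (emb′.*-homo _ _)) (trans (emb′.⟦⟧-cong (proj₂ (proj₂ (L.invertible _ s)))) emb′.1#-homo))
    root : ∀ {e s i} → s * i ≈ 1# → e + s * - (i * e) ≈ 0#
    root {e} {s} {i} si≈1 = trans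
      (solve 3 (λ e s i → e :+ s :* :- (i :* e) := e :- s :* i :* e) refl e s i)
      (trans (+-congˡ (-‿cong (*-congʳ si≈1))) (solve 1 (λ e → e :- :1 :* e := :0) refl e))
      where open RingSolver B using (solve; _:=_; _:+_; _:*_; :-_; _:-_; :0; :1)
    zero-at : (c : Cover v) → point v ≡ - (emb (separant⁻¹ {v} c) * eval (partial (# v)) (equation {v = v} c)) →
              eval point (equation {v = v} c) ≈ 0#
    zero-at c@((ρ , k) , (f , o , _ , _) , ρ≤r , ρ≼τ , ≡.refl) pv
      -- Bounding by 0 as well only asks for a last derivation i, through which F becomes linear in
      -- x_v.
      with common-predecessor ρ≼τ (0≼ (proj₁ v))
        (ℕ.≤-<-trans (ℕ.≤-reflexive (≡.trans (≡.cong (∣ ρ ∣ ℕ.+_) (∣0∣ m)) (ℕ.+-identityʳ _)))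
          (ℕ.≤-<-trans ρ≤r (ℕ.≤-<-trans (ℕ.m≤m+n r r) large)))
    ... | i , σ , ≡.refl , ρ≼σ , _ = begin
      eval point F
        ≈⟨ eval-∼ point step ⟩
      eval point (D i G)
        ≈⟨ D-leader i (σ , k)
             (λ u u<v → reflexive (≡.sym (partial-point (# v) u u<v)))
             (reflexive (partial-zero (# v) v ℕ.≤-refl)) (Over-prolong o σ ρ≼σ) ⟩
      eval (partial (# v)) (D i G) + eval point (sep (σ , k) G) * point v
        ≈⟨ +-cong (sym (eval-∼ (partial (# v)) step))
             (*-cong (sep-prolong point o σ ρ≼σ) (reflexive pv)) ⟩
      eval (partial (# v)) F + eval point (sep (ρ , k) f) * - (emb (separant⁻¹ {v} c) * eval (partial (# v)) F)
        ≈⟨ root (separant-inverse c) ⟩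
      0# ∎
      where
      open import Relation.Binary.Reasoning.Setoid setoid
      F = prolong ρ (σ ⊞ ε i) f
      G = prolong ρ σ f
      step : F ∼ D i G
      step = prolong-step i f ρ≼σ
    from-next : (q : Dec (Cover v)) → q ≡ em → ∃ λ (c : Cover v) → eval point (equation {v = v} c) ≈ 0#
    from-next (no ¬c) _ = contradiction d ¬c
    from-next (yes c) e = c , zero-at c (by (ord v ℕ.≤? r ℕ.+ r) ≡.refl)
      where
      by : (p : Dec (ord v ≤ r ℕ.+ r)) → p ≡ (ord v ℕ.≤? r ℕ.+ r) →
           point v ≡ - (emb (separant⁻¹ {v} c) * eval (partial (# v)) (equation {v = v} c))
      by (yes small) _  = contradiction small (ℕ.<⇒≱ large)
      by (no ¬p)     e′ = ≡.cong₂ (nextValue v (partial (# v))) (≡.sym e′) (≡.sym e)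

  -- The coefficients involve only variables before v, so their values use only generators before
  -- the one numbered `# v`.
  point-free : ∀ v → r ℕ.+ r < ord v → ¬ Cover v → ∀ {cs} → All (Over (_<# v)) cs →
               horner B (List.map (eval point) cs) (point v) ≈ 0# → All (λ c → eval point c ≈ 0#) cs
  point-free v large ¬c {cs} lows e = unmap cs (T.transcendental (# v) (in-map lows)
    (≡.subst (λ p → horner B (List.map (eval point) cs) p ≈ 0#) (by (ord v ℕ.≤? r ℕ.+ r) em) e))
    where
    by : ∀ p q → nextValue v (partial (# v)) p q ≡ T.generator (# v)
    by (yes small) _       = contradiction small (ℕ.<⇒≱ large)
    by (no _)      (yes c) = contradiction c ¬c
    by (no _)      (no _)  = ≡.refl
    in-map : ∀ {cs} → All (Over (_<# v)) cs → All (T.In (# v)) (List.map (eval point) cs)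
    in-map []       = []
    in-map (p ∷ ps) = In-eval (# v) (λ u u<v → In-point u (# v) u<v) p ∷ in-map ps
    unmap : ∀ cs → All (_≈ 0#) (List.map (eval point) cs) → All (λ c → eval point c ≈ 0#) cs
    unmap []       []       = []
    unmap (c ∷ cs) (z ∷ zs) = z ∷ unmap cs zs

-- The differential condition for terms

module PolynomialDerivatives {ℓ : Level} (K L : Field ℓ ℓ) (ι : K ↪ L)
    {∂ : Field.Carrier K → Field.Carrier K} (∂-isDerivation : IsDerivation (Field.commutativeRing K) ∂) where
  private
    module K = Field K
    module ι = _↪_ ι
    module ∂ = IsDerivation ∂-isDerivation
    module ∂′ = DerivationProperties K.commutativeRing ∂-isDerivation
    module K× = RawSemiringDefinitions (Semiring.rawSemiring K.semiring)
  open Field L hiding (zero)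
  open RawSemiringDefinitions (Semiring.rawSemiring semiring) using (sum; product; _^_) renaming (_×_ to _·_)
  open Algebra.Properties.Semiring.Exp semiring using (^-homo-*)
  open Algebra.Properties.Semiring.Mult semiring using (×-congʳ; ×-comm-*; ×-assoc-*)
  open Algebra.Properties.Semiring.Sum semiring using (*-distribˡ-sum; sum-cong-≋)
  open Algebra.Properties.CommutativeMonoid.Sum +-commutativeMonoid using (∑-distrib-+)
  open RingSolver commutativeRing using (solve; _:=_; _:+_; _:*_; :-_; _:-_; :0; :1)
  open Relation.Binary.Reasoning.Setoid setoid

  monomial : ∀ {N} → (Fin N → Carrier) → Vec ℕ N → Carrier
  monomial x e = product λ j → x j ^ lookup e j

  private
    -- The derivative of x ^ k, if the derivative of x is w.
    power′ : Carrier → Carrier → ℕ → Carrier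
    power′ x w zero    = 0#
    power′ x w (suc k) = w * x ^ k + x * power′ x w k

    power′-+ : ∀ x w k l → power′ x w (k ℕ.+ l) ≈ power′ x w k * x ^ l + x ^ k * power′ x w l
    power′-+ x w zero    l = solve 2 (λ p q → q := :0 :* p :+ :1 :* q) refl _ _
    power′-+ x w (suc k) l = trans (+-cong (*-congˡ (^-homo-* x k l)) (*-congˡ (power′-+ x w k l)))
      (solve 6 (λ x w p q p′ q′ → w :* (p :* q) :+ x :* (p′ :* q :+ p :* q′) := (w :* p :+ x :* p′) :* q :+ x :* p :* q′)
        refl _ _ _ _ _ _)

    power′-· : ∀ x w k → (k · x ^ ℕ.pred k) * w ≈ power′ x w k
    -- The junk power x ^ pred 0 is 1, but it is taken with multiplicity 0.
    power′-· x w zero    = zeroˡ w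
    power′-· x w (suc k) = begin
      (x ^ k + k · x ^ k) * w                 ≈⟨ *-congʳ (+-congˡ (shift k)) ⟩
      (x ^ k + x * (k · x ^ ℕ.pred k)) * w    ≈⟨ solve 4 (λ p x q w → (p :+ x :* q) :* w := w :* p :+ x :* (q :* w)) refl _ _ _ _ ⟩
      w * x ^ k + x * ((k · x ^ ℕ.pred k) * w) ≈⟨ +-congˡ (*-congˡ (power′-· x w k)) ⟩
      w * x ^ k + x * power′ x w k            ∎
      where
      shift : ∀ k → k · x ^ k ≈ x * (k · x ^ ℕ.pred k)
      shift zero    = sym (zeroʳ x)
      shift (suc k) = sym (×-comm-* (suc k) x (x ^ k))

    monomial′ : ∀ {N} → (Fin N → Carrier) → (Fin N → Carrier) → Vec ℕ N → Carrier
    monomial′ x w []      = 0#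
    monomial′ x w (k ∷ e) =
      power′ (x zero) (w zero) k * monomial (x ∘ suc) e + x zero ^ k * monomial′ (x ∘ suc) (w ∘ suc) e

    monomial-⊞ : ∀ {N} x (e f : Vec ℕ N) → monomial x (e ⊞ f) ≈ monomial x e * monomial x f
    monomial-⊞ x []      []      = sym (*-identityˡ 1#)
    monomial-⊞ x (k ∷ e) (l ∷ f) = trans (*-cong (^-homo-* (x zero) k l) (monomial-⊞ (x ∘ suc) e f))
      (solve 4 (λ p q r s → p :* q :* (r :* s) := p :* r :* (q :* s)) refl _ _ _ _)

    monomial′-⊞ : ∀ {N} x w (e f : Vec ℕ N) →
                  monomial′ x w (e ⊞ f) ≈ monomial′ x w e * monomial x f + monomial x e * monomial′ x w f
    monomial′-⊞ x w []      []      = solve 0 (:0 := :0 :* :1 :+ :1 :* :0) refl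
    monomial′-⊞ x w (k ∷ e) (l ∷ f) = trans
      (+-cong (*-cong (power′-+ (x zero) (w zero) k l) (monomial-⊞ (x ∘ suc) e f))
              (*-cong (^-homo-* (x zero) k l) (monomial′-⊞ (x ∘ suc) (w ∘ suc) e f)))
      (solve 8 (λ p p′ q q′ m m′ n n′ → (p′ :* q :+ p :* q′) :* (m :* n) :+ p :* q :* (m′ :* n :+ m :* n′) :=
        (p′ :* m :+ p :* m′) :* (q :* n) :+ p :* m :* (q′ :* n :+ q :* n′)) refl _ _ _ _ _ _ _ _)

    monomial-0 : ∀ {N} x → monomial {N} x (replicate N 0) ≈ 1#
    monomial-0 {zero}  x = refl
    monomial-0 {suc N} x = trans (*-identityˡ _) (monomial-0 (x ∘ suc))

    monomial′-0 : ∀ {N} x w → monomial′ {N} x w (replicate N 0) ≈ 0#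
    monomial′-0 {zero}  x w = refl
    monomial′-0 {suc N} x w = trans (+-cong (zeroˡ _) (*-congˡ (monomial′-0 (x ∘ suc) (w ∘ suc))))
      (solve 0 (:0 :+ :1 :* :0 := :0) refl)

    monomial-ε : ∀ {N} x (j : Fin N) → monomial x (ε j) ≈ x j
    monomial-ε x zero    = trans (*-congˡ (monomial-0 (x ∘ suc))) (solve 1 (λ a → a :* :1 :* :1 := a) refl _)
    monomial-ε x (suc j) = trans (*-identityˡ _) (monomial-ε (x ∘ suc) j)

    monomial′-ε : ∀ {N} x w (j : Fin N) → monomial′ x w (ε j) ≈ w j
    monomial′-ε x w zero    = trans (+-cong (*-congˡ (monomial-0 (x ∘ suc))) (*-congˡ (monomial′-0 (x ∘ suc) (w ∘ suc))))
      (solve 2 (λ x w → (w :* :1 :+ x :* :0) :* :1 :+ x :* :1 :* :0 := w) refl _ _)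
    monomial′-ε x w (suc j) = trans (+-cong (zeroˡ _) (*-congˡ (monomial′-ε (x ∘ suc) (w ∘ suc) j)))
      (solve 1 (λ w → :0 :+ :1 :* w := w) refl _)

    -- The product rule for monomials, with the sum over the variables split at the first one.
    gradient : ∀ {N} x w (e : Vec ℕ N) →
               sum (λ j → (lookup e j · monomial x (updateAt e j ℕ.pred)) * w j) ≈ monomial′ x w e
    gradient x w []      = refl
    gradient x w (k ∷ e) = +-cong
      (begin
        (k · (x zero ^ ℕ.pred k * M)) * w zero     ≈⟨ *-congʳ (sym (×-assoc-* k _ _)) ⟩
        (k · x zero ^ ℕ.pred k) * M * w zero       ≈⟨ solve 3 (λ a m w → a :* m :* w := a :* w :* m) refl _ _ _ ⟩
        (k · x zero ^ ℕ.pred k) * w zero * M       ≈⟨ *-congʳ (power′-· (x zero) (w zero) k) ⟩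
        power′ (x zero) (w zero) k * M             ∎)
      (begin
        sum (λ j → (lookup e j · (x zero ^ k * monomial (x ∘ suc) (updateAt e j ℕ.pred))) * w (suc j))
          ≈⟨ sum-cong-≋ (λ j → trans (*-congʳ (sym (×-comm-* (lookup e j) (x zero ^ k) (monomial (x ∘ suc) (updateAt e j ℕ.pred))))) (*-assoc _ _ _)) ⟩
        sum (λ j → x zero ^ k * ((lookup e j · monomial (x ∘ suc) (updateAt e j ℕ.pred)) * w (suc j)))
          ≈⟨ sym (*-distribˡ-sum (x zero ^ k) (λ j → (lookup e j · monomial (x ∘ suc) (updateAt e j ℕ.pred)) * w (suc j))) ⟩
        x zero ^ k * sum (λ j → (lookup e j · monomial (x ∘ suc) (updateAt e j ℕ.pred)) * w (suc j))
          ≈⟨ *-congˡ (gradient (x ∘ suc) (w ∘ suc) e) ⟩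
        x zero ^ k * monomial′ (x ∘ suc) (w ∘ suc) e ∎)
      where M = monomial (x ∘ suc) e

    ι-· : ∀ k c → ι.⟦ k K×.× c ⟧ ≈ k · ι.⟦ c ⟧
    ι-· zero    c = ι.0#-homo
    ι-· (suc k) c = trans (ι.+-homo c _) (+-congˡ (ι-· k c))

  module _ {N : ℕ} (x w : Fin N → Carrier) where

    private
      Poly : Set ℓ
      Poly = Polynomial K.Carrier N

    value : Poly → Carrier
    value f = evaluate L (mapCoefficients ι.⟦_⟧ f) x

    derivative : Poly → Carrier
    derivative f = sum (λ j → value (partialDerivative K j f) * w j) + value (mapCoefficients ∂ f)

    private
      -- The total derivative summed over the terms of the polynomial instead of over its variables;
      -- in this form it is compatible with sums and products of polynomials.
      termwise : Poly → Carrier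
      termwise []            = 0#
      termwise ((c , e) ∷ f) = (ι.⟦ c ⟧ * monomial′ x w e + ι.⟦ ∂ c ⟧ * monomial x e) + termwise f

      derivative≈termwise : ∀ f → derivative f ≈ termwise f
      derivative≈termwise [] = trans (+-identityʳ _) (sum-zero w)
        where
        sum-zero : ∀ {N} (w : Fin N → Carrier) → sum (λ j → 0# * w j) ≈ 0#
        sum-zero {zero}  w = refl
        sum-zero {suc N} w = trans (+-cong (zeroˡ _) (sum-zero (w ∘ suc))) (+-identityʳ 0#)
      derivative≈termwise ((c , e) ∷ f) = begin
        sum (λ j → (ι.⟦ lookup e j K×.× c ⟧ * m j + v j) * w j) + (ι.⟦ ∂ c ⟧ * monomial x e + value (mapCoefficients ∂ f))
          ≈⟨ +-congʳ (sum-cong-≋ λ j → trans (*-congʳ (+-congʳ (entry j))) (distrib′ ι.⟦ c ⟧ (lookup e j · m j) (v j) (w j))) ⟩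
        sum (λ j → ι.⟦ c ⟧ * ((lookup e j · m j) * w j) + v j * w j) + (ι.⟦ ∂ c ⟧ * monomial x e + value (mapCoefficients ∂ f))
          ≈⟨ +-congʳ (∑-distrib-+ (λ j → ι.⟦ c ⟧ * ((lookup e j · m j) * w j)) (λ j → v j * w j)) ⟩
        (sum (λ j → ι.⟦ c ⟧ * ((lookup e j · m j) * w j)) + sum (λ j → v j * w j)) + (ι.⟦ ∂ c ⟧ * monomial x e + value (mapCoefficients ∂ f))
          ≈⟨ +-congʳ (+-congʳ (trans (sym (*-distribˡ-sum ι.⟦ c ⟧ (λ j → (lookup e j · m j) * w j))) (*-congˡ (gradient x w e)))) ⟩
        (ι.⟦ c ⟧ * monomial′ x w e + sum (λ j → v j * w j)) + (ι.⟦ ∂ c ⟧ * monomial x e + value (mapCoefficients ∂ f))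
          ≈⟨ solve 4 (λ a s b v → (a :+ s) :+ (b :+ v) := (a :+ b) :+ (s :+ v)) refl _ _ _ _ ⟩
        (ι.⟦ c ⟧ * monomial′ x w e + ι.⟦ ∂ c ⟧ * monomial x e) + derivative f
          ≈⟨ +-congˡ (derivative≈termwise f) ⟩
        termwise ((c , e) ∷ f) ∎
        where
        m : Fin N → Carrier
        m j = monomial x (updateAt e j ℕ.pred)
        v : Fin N → Carrier
        v j = value (partialDerivative K j f)
        entry : ∀ j → ι.⟦ lookup e j K×.× c ⟧ * m j ≈ ι.⟦ c ⟧ * (lookup e j · m j)
        entry j = trans (*-congʳ (ι-· (lookup e j) c)) (trans (×-assoc-* (lookup e j) _ _) (sym (×-comm-* (lookup e j) _ _)))
        distrib′ : ∀ a b v w → (a * b + v) * w ≈ a * (b * w) + v * w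
        distrib′ = solve 4 (λ a b v w → (a :* b :+ v) :* w := a :* (b :* w) :+ v :* w) refl

      value-++ : ∀ f g → value (f ++ g) ≈ value f + value g
      value-++ []      g = sym (+-identityˡ _)
      value-++ (_ ∷ f) g = trans (+-congˡ (value-++ f g)) (sym (+-assoc _ _ _))

      termwise-++ : ∀ f g → termwise (f ++ g) ≈ termwise f + termwise g
      termwise-++ []      g = sym (+-identityˡ _)
      termwise-++ (_ ∷ f) g = trans (+-congˡ (termwise-++ f g)) (sym (+-assoc _ _ _))

      scale : K.Carrier × Vec ℕ N → Poly → Poly
      scale (c , e) = List.map λ (d , f) → c K.* d , e ⊞ f

      value-scale : ∀ c e g → value (scale (c , e) g) ≈ ι.⟦ c ⟧ * monomial x e * value g
      value-scale c e []            = sym (zeroʳ _)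
      value-scale c e ((d , f) ∷ g) = trans
        (+-cong (*-cong (ι.*-homo c d) (monomial-⊞ x e f)) (value-scale c e g))
        (solve 5 (λ c d m n v → c :* d :* (m :* n) :+ c :* m :* v := c :* m :* (d :* n :+ v)) refl _ _ _ _ _)

      termwise-scale : ∀ c e g → termwise (scale (c , e) g) ≈
        (ι.⟦ c ⟧ * monomial′ x w e + ι.⟦ ∂ c ⟧ * monomial x e) * value g + ι.⟦ c ⟧ * monomial x e * termwise g
      termwise-scale c e []            = solve 2 (λ a b → :0 := a :* :0 :+ b :* :0) refl _ _
      termwise-scale c e ((d , f) ∷ g) = trans
        (+-cong (+-cong (*-cong (ι.*-homo c d) (monomial′-⊞ x w e f))
                        (*-cong (trans (ι.⟦⟧-cong (∂.leibniz c d)) (trans (ι.+-homo _ _) (+-cong (ι.*-homo _ _) (ι.*-homo _ _))))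
                                (monomial-⊞ x e f)))
                (termwise-scale c e g))
        (solve 10 (λ c c′ d d′ m m′ n n′ v t →
          (c :* d :* (m′ :* n :+ m :* n′) :+ (c′ :* d :+ c :* d′) :* (m :* n)) :+ ((c :* m′ :+ c′ :* m) :* v :+ c :* m :* t) :=
          (c :* m′ :+ c′ :* m) :* (d :* n :+ v) :+ c :* m :* ((d :* n′ :+ d′ :* n) :+ t)) refl _ _ _ _ _ _ _ _ _ _)

    times : Poly → Poly → Poly
    times []      g = []
    times (t ∷ f) g = scale t g ++ times f g

    private
      value-times : ∀ f g → value (times f g) ≈ value f * value g
      value-times []            g = sym (zeroˡ _)
      value-times ((c , e) ∷ f) g = trans (value-++ (scale (c , e) g) (times f g))
        (trans (+-cong (value-scale c e g) (value-times f g)) (sym (distribʳ _ _ _)))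

      termwise-times : ∀ f g → termwise (times f g) ≈ termwise f * value g + value f * termwise g
      termwise-times []            g = solve 2 (λ a b → :0 := :0 :* a :+ :0 :* b) refl _ _
      termwise-times ((c , e) ∷ f) g = trans (termwise-++ (scale (c , e) g) (times f g))
        (trans (+-cong (termwise-scale c e g) (termwise-times f g))
          (solve 6 (λ p q v t f f′ → (p :* v :+ q :* t) :+ (f′ :* v :+ f :* t) := (p :+ f′) :* v :+ (q :+ f) :* t)
            refl _ _ _ _ _ _))

    -- Value and derivative are carried together because the product rule needs both; terms can then
    -- be translated into polynomials by recursion.
    Represents : Poly → Carrier → Carrier → Set ℓ
    Represents f u u′ = value f ≈ u × derivative f ≈ u′

    private
      from-termwise : ∀ {u′} f → termwise f ≈ u′ → derivative f ≈ u′
      from-termwise f = trans (derivative≈termwise f)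
      to-termwise : ∀ {u′} f → derivative f ≈ u′ → termwise f ≈ u′
      to-termwise f = trans (sym (derivative≈termwise f))

    represents-constant : ∀ c → Represents ((c , replicate N 0) ∷ []) ι.⟦ c ⟧ ι.⟦ ∂ c ⟧
    represents-constant c =
      trans (+-identityʳ _) (trans (*-congˡ (monomial-0 x)) (*-identityʳ _)) ,
      from-termwise ((c , replicate N 0) ∷ []) (trans (+-identityʳ _) (trans (+-cong (*-congˡ (monomial′-0 x w)) (*-congˡ (monomial-0 x)))
        (solve 2 (λ c d → c :* :0 :+ d :* :1 := d) refl _ _)))

    represents-variable : ∀ j → Represents ((K.1# , ε j) ∷ []) (x j) (w j)
    represents-variable j =
      trans (+-identityʳ _) (trans (*-cong ι.1#-homo (monomial-ε x j)) (*-identityˡ _)) ,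
      from-termwise ((K.1# , ε j) ∷ []) (trans (+-identityʳ _)
        (trans (+-cong (*-cong ι.1#-homo (monomial′-ε x w j)) (*-congʳ (trans (ι.⟦⟧-cong ∂′.D-1) ι.0#-homo)))
          (solve 2 (λ w m → :1 :* w :+ :0 :* m := w) refl _ _)))

    represents-+ : ∀ f g {u u′ v v′} → Represents f u u′ → Represents g v v′ → Represents (f ++ g) (u + v) (u′ + v′)
    represents-+ f g (p , p′) (q , q′) = trans (value-++ f g) (+-cong p q) ,
      from-termwise (f ++ g) (trans (termwise-++ f g) (+-cong (to-termwise f p′) (to-termwise g q′)))

    represents-* : ∀ f g {u u′ v v′} → Represents f u u′ → Represents g v v′ →
                   Represents (times f g) (u * v) (u′ * v + u * v′)
    represents-* f g (p , p′) (q , q′) = trans (value-times f g) (*-cong p q) ,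
      from-termwise (times f g) (trans (termwise-times f g)
        (+-cong (*-cong (to-termwise f p′) q) (*-cong p (to-termwise g q′))))

    represents-resp : ∀ f {u u′ v v′} → u ≈ v → u′ ≈ v′ → Represents f u u′ → Represents f v v′
    represents-resp f e e′ (p , p′) = trans p e , trans p′ e′

    -- Negation is multiplication by the constant -1, whose derivative is 0.
    represents-neg : ∀ f {u u′} → Represents f u u′ → Represents (times ((K.- K.1# , replicate N 0) ∷ []) f) (- u) (- u′)
    represents-neg f {u} {u′} p = represents-resp (times ((K.- K.1# , replicate N 0) ∷ []) f)
      (trans (*-congʳ ι-1) (solve 1 (λ u → :- :1 :* u := :- u) refl u))
      (trans (+-cong (*-congʳ ∂-1) (*-congʳ ι-1)) (solve 2 (λ u u′ → :0 :* u :+ :- :1 :* u′ := :- u′) refl u u′))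
      (represents-* ((K.- K.1# , replicate N 0) ∷ []) f (represents-constant (K.- K.1#)) p)
      where
      ι-1 : ι.⟦ K.- K.1# ⟧ ≈ - 1#
      ι-1 = trans (ι.-‿homo K.1#) (-‿cong ι.1#-homo)
      ∂-1 : ι.⟦ ∂ (K.- K.1#) ⟧ ≈ 0#
      ∂-1 = trans (ι.⟦⟧-cong (K.trans (∂′.D-neg K.1#) (K.-‿cong ∂′.D-1)))
        (trans (ι.-‿homo K.0#) (trans (-‿cong ι.0#-homo) (solve 0 (:- :0 := :0) refl)))

module DifferentialConditions {m : ℕ} {ℓ : Level} (K : DifferentialField m ℓ) (n : ℕ)
    (L : Field ℓ ℓ) (ι : DifferentialField.underlying K ↪ L)
    {s : ℕ} (a : Index m n s → Field.Carrier L) where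
  open Variables m n
  open Numbering m n
  open DifferentialPolynomials K n
  private
    module K = DifferentialField K
    module ι = _↪_ ι
    module Lᴱ = Evaluation (Field.commutativeRing L) ι.isRingHomomorphism
  open Field L using (Carrier; 0#; _≈_; refl; sym; trans; reflexive)

  -- The 0 beyond order s is a filler. Leaders of such order may be artefacts of it, but stability
  -- is asked for only up to order 2r′ + 1 ≤ s.
  extend : Var → Carrier
  extend (ξ , h) with ∣ ξ ∣ ℕ.≤? s
  ... | yes p = a (index ξ h p)
  ... | no _  = 0#

  extend-index : ∀ ξ h (p : ∣ ξ ∣ ≤ s) → extend (ξ , h) ≡ a (index ξ h p)
  extend-index ξ h p with ∣ ξ ∣ ℕ.≤? s
  ... | yes _ = ≡.refl
  ... | no ¬p = contradiction p ¬p

  private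
    module _ (i : Fin m) {N : ℕ} (x w : Fin N → Carrier) {P : Var → Set}
             (position : ∀ {u} → P u → ∃ λ j → x j ≈ extend u × w j ≈ extend (u ↑ i)) where
      open PolynomialDerivatives K.underlying L ι (K.isDerivation i)

      polynomial : ∀ {t} → Over P t → ∃ λ f → Represents x w f (Lᴱ.eval extend t) (Lᴱ.eval extend (D i t))
      polynomial (con {c}) = ((c , replicate _ 0) ∷ []) , represents-constant x w c
      polynomial (var p) with position p
      ... | j , x≈ , w≈ = ((K.1# , ε j) ∷ []) , represents-resp x w ((K.1# , ε j) ∷ []) x≈ w≈ (represents-variable x w j)
      polynomial (o ⊕ q) with polynomial o | polynomial q
      ... | f , F | g , G = f ++ g , represents-+ x w f g F G
      polynomial (o ⊗ q) with polynomial o | polynomial q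
      ... | f , F | g , G = times x w f g , represents-* x w f g F G
      polynomial (⊖ o) with polynomial o
      ... | f , F = times x w ((K.- K.1# , replicate _ 0) ∷ []) f , represents-neg x w f F

    module _ (i : Fin m) (σ : Vec ℕ m) (k : Fin n) (p : ∣ σ ∣ ℕ.+ 1 ≤ s) where

      position : ∀ {u} → u ≤# (σ , k) → ∃ λ j → a (below-index σ k p j) ≈ extend u × a (shifted-below-index σ k p i j) ≈ extend (u ↑ i)
      position {u} u≤v = j ,
        reflexive (≡.sym (≡.trans (≡.cong extend (Any.lookup-index u∈)) (extend-index _ _ (ℕ.≤-trans (ℕ.m≤m+n _ 1) bound)))) ,
        reflexive (≡.sym (≡.trans (≡.cong (λ v → extend (v ↑ i)) (Any.lookup-index u∈))
          (extend-index _ _ (ℕ.≤-trans (ℕ.≤-reflexive (∣⊞ε∣ (proj₁ v) i)) bound))))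
        where
        u∈ : u ∈ below (σ , k)
        u∈ = ∈-below⁺ (#≤⇒⊴ u≤v)
        j = Any.index u∈
        v = List.lookup (below (σ , k)) j
        bound : ord v ℕ.+ 1 ≤ s
        bound = ℕ.≤-trans (ℕ.+-monoˡ-≤ 1
          (≡.subst (λ v → ord v ≤ ∣ σ ∣) (Any.lookup-index u∈) (#≤⇒ord≤ {u} {σ , k} u≤v))) p

      vanishes : DifferentialCondition K ι a → ∀ {t} → Over (_≤# (σ , k)) t →
                 Lᴱ.eval extend t ≈ 0# → Lᴱ.eval extend (D i t) ≈ 0#
      vanishes condition o t≈0 with polynomial i (a ∘ below-index σ k p) (a ∘ shifted-below-index σ k p i) position o
      ... | f , V , V′ = trans (sym V′) (condition i k σ p f (trans V t≈0))

    -- `DifferentialCondition` speaks of polynomials in the variables up to one (σ , k), so a term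
    -- needs a largest variable; v is the default when the term has none.
    largest : ∀ {P} v → P v → ∀ {t} → Over P t → ∃ λ u → P u × Over (_≤# u) t
    largest v p con         = v , p , con
    largest v p (var {u} q) = u , q , var ℕ.≤-refl
    largest v p (q ⊕ q′) with largest v p q | largest v p q′
    ... | u , Pu , o | u′ , Pu′ , o′ with ℕ.≤-total (# u) (# u′)
    ... | inj₁ u≤u′ = u′ , Pu′ , Over-map (λ _ h → ℕ.≤-trans h u≤u′) o ⊕ o′
    ... | inj₂ u′≤u = u , Pu , o ⊕ Over-map (λ _ h → ℕ.≤-trans h u′≤u) o′
    largest v p (q ⊗ q′) with largest v p q | largest v p q′
    ... | u , Pu , o | u′ , Pu′ , o′ with ℕ.≤-total (# u) (# u′)
    ... | inj₁ u≤u′ = u′ , Pu′ , Over-map (λ _ h → ℕ.≤-trans h u≤u′) o ⊗ o′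
    ... | inj₂ u′≤u = u , Pu , o ⊗ Over-map (λ _ h → ℕ.≤-trans h u′≤u) o′
    largest v p (⊖ q) with largest v p q
    ... | u , Pu , o = u , Pu , ⊖ o

  condition⇒prolongs : DifferentialCondition K ι a → ∀ v₀ → suc (ord v₀) ≤ s →
    ∀ i {t} → Over (λ v → suc (ord v) ≤ s) t → Lᴱ.eval extend t ≈ 0# → Lᴱ.eval extend (D i t) ≈ 0#
  condition⇒prolongs condition v₀ p₀ i o with largest {λ v → suc (ord v) ≤ s} v₀ p₀ o
  ... | (σ , k) , p , o′ = vanishes i σ k (≡.subst (_≤ s) (ℕ.+-comm 1 ∣ σ ∣) p) condition o′

-- Fields of fractions

module Fractions {ℓ : Level} (R : CommutativeRing ℓ ℓ) (domain : NoZeroDivisors R)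
                 (1≉0 : ¬ CommutativeRing._≈_ R (CommutativeRing.1# R) (CommutativeRing.0# R)) where
  open CommutativeRing R
  open RingSolver R using (solve; _:=_; _:+_; _:*_; :-_; _:-_; :0; :1)
  open Algebra.Properties.Group +-group using (x∙y⁻¹≈ε⇒x≈y; x≈y⇒x∙y⁻¹≈ε)

  record Fraction : Set ℓ where
    constructor frac
    field
      num den : Carrier
      nonzero : ¬ den ≈ 0#
  open Fraction public

  infix 4 _≃_
  record _≃_ (p q : Fraction) : Set ℓ where
    constructor cross
    field uncross : num p * den q ≈ num q * den p
  open _≃_ public

  cancel : ∀ {x y z} → ¬ x ≈ 0# → x * y ≈ x * z → y ≈ z
  cancel {x} {y} {z} x≉0 e with domain x (y - z) (trans
    (solve 3 (λ x y z → x :* (y :- z) := x :* y :- x :* z) refl x y z) (x≈y⇒x∙y⁻¹≈ε e))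
  ... | inj₁ x≈0   = contradiction x≈0 x≉0
  ... | inj₂ y-z≈0 = x∙y⁻¹≈ε⇒x≈y y z y-z≈0

  *-nonzero : ∀ {x y} → ¬ x ≈ 0# → ¬ y ≈ 0# → ¬ x * y ≈ 0#
  *-nonzero {x} {y} x≉0 y≉0 e with domain x y e
  ... | inj₁ x≈0 = x≉0 x≈0
  ... | inj₂ y≈0 = y≉0 y≈0

  private
    ≃-trans : ∀ {p q r} → p ≃ q → q ≃ r → p ≃ r
    ≃-trans {frac n d _} {frac n′ d′ d′≉0} {frac n″ d″ _} (cross e) (cross f) = cross (cancel d′≉0
      (trans (solve 3 (λ n d′ d″ → d′ :* (n :* d″) := n :* d′ :* d″) refl n d′ d″)
        (trans (*-congʳ e)
          (trans (solve 3 (λ n′ d d″ → n′ :* d :* d″ := n′ :* d″ :* d) refl n′ d d″)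
            (trans (*-congʳ f) (solve 3 (λ n″ d d′ → n″ :* d′ :* d := d′ :* (n″ :* d)) refl n″ d d′))))))

    _+ᶠ_ _*ᶠ_ : Fraction → Fraction → Fraction
    p +ᶠ q = frac (num p * den q + num q * den p) (den p * den q) (*-nonzero (nonzero p) (nonzero q))
    p *ᶠ q = frac (num p * num q) (den p * den q) (*-nonzero (nonzero p) (nonzero q))

    -ᶠ_ : Fraction → Fraction
    -ᶠ p = frac (- num p) (den p) (nonzero p)

  fraction : Carrier → Fraction
  fraction x = frac x 1# 1≉0

  private
    +ᶠ-cong : ∀ {p q r s} → p ≃ q → r ≃ s → p +ᶠ r ≃ q +ᶠ s
    +ᶠ-cong {frac n d _} {frac n′ d′ _} {frac k e _} {frac k′ e′ _} (cross f) (cross g) = cross (trans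
      (solve 6 (λ n d k e d′ e′ → (n :* e :+ k :* d) :* (d′ :* e′) := n :* d′ :* (e :* e′) :+ k :* e′ :* (d :* d′))
        refl n d k e d′ e′)
      (trans (+-cong (*-congʳ f) (*-congʳ g))
        (solve 6 (λ n′ d k′ e d′ e′ → n′ :* d :* (e :* e′) :+ k′ :* e :* (d :* d′) := (n′ :* e′ :+ k′ :* d′) :* (d :* e))
          refl n′ d k′ e d′ e′)))

    *ᶠ-cong : ∀ {p q r s} → p ≃ q → r ≃ s → p *ᶠ r ≃ q *ᶠ s
    *ᶠ-cong {frac n d _} {frac n′ d′ _} {frac k e _} {frac k′ e′ _} (cross f) (cross g) = cross (trans
      (solve 4 (λ n k d′ e′ → n :* k :* (d′ :* e′) := n :* d′ :* (k :* e′)) refl n k d′ e′)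
      (trans (*-cong f g) (solve 4 (λ n′ d k′ e → n′ :* d :* (k′ :* e) := n′ :* k′ :* (d :* e)) refl n′ d k′ e)))

  commutativeRing : CommutativeRing ℓ ℓ
  commutativeRing = record
    { Carrier = Fraction
    ; _≈_ = _≃_
    ; _+_ = _+ᶠ_
    ; _*_ = _*ᶠ_
    ; -_  = -ᶠ_
    ; 0#  = fraction 0#
    ; 1#  = fraction 1#
    ; isCommutativeRing = record
      { isRing = record
        { +-isAbelianGroup = record
          { isGroup = record
            { isMonoid = record
              { isSemigroup = record
                { isMagma = record
                  { isEquivalence = record
                    { refl  = cross refl
                    ; sym   = λ (cross e) → cross (sym e)
                    ; trans = ≃-trans
                    }
                  ; ∙-cong = +ᶠ-cong
                  }
                ; assoc = λ p q r → cross (solve 6 (λ a b c d e f →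
                    ((a :* d :+ c :* b) :* f :+ e :* (b :* d)) :* (b :* (d :* f)) :=
                    (a :* (d :* f) :+ (c :* f :+ e :* d) :* b) :* (b :* d :* f))
                    refl (num p) (den p) (num q) (den q) (num r) (den r))
                }
              ; identity = (λ p → cross (solve 2 (λ a b → (:0 :* b :+ a :* :1) :* b := a :* (:1 :* b)) refl (num p) (den p)))
                         , (λ p → cross (solve 2 (λ a b → (a :* :1 :+ :0 :* b) :* b := a :* (b :* :1)) refl (num p) (den p)))
              }
            ; inverse = (λ p → cross (solve 2 (λ a b → (:- a :* b :+ a :* b) :* :1 := :0 :* (b :* b)) refl (num p) (den p)))
                      , (λ p → cross (solve 2 (λ a b → (a :* b :+ :- a :* b) :* :1 := :0 :* (b :* b)) refl (num p) (den p)))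
            ; ⁻¹-cong = λ {p} {q} (cross e) → cross (trans
                (solve 2 (λ a b → :- a :* b := :- (a :* b)) refl (num p) (den q))
                (trans (-‿cong e) (solve 2 (λ a b → :- (a :* b) := :- a :* b) refl (num q) (den p))))
            }
          ; comm = λ p q → cross (solve 4 (λ a b c d → (a :* d :+ c :* b) :* (d :* b) := (c :* b :+ a :* d) :* (b :* d))
              refl (num p) (den p) (num q) (den q))
          }
        ; *-cong     = *ᶠ-cong
        ; *-assoc    = λ p q r → cross (solve 6 (λ a b c d e f → a :* c :* e :* (b :* (d :* f)) := a :* (c :* e) :* (b :* d :* f))
            refl (num p) (den p) (num q) (den q) (num r) (den r))
        ; *-identity = (λ p → cross (solve 2 (λ a b → :1 :* a :* b := a :* (:1 :* b)) refl (num p) (den p)))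
                     , (λ p → cross (solve 2 (λ a b → a :* :1 :* b := a :* (b :* :1)) refl (num p) (den p)))
        ; distrib    = (λ p q r → cross (solve 6 (λ a b c d e f →
                           a :* (c :* f :+ e :* d) :* (b :* d :* (b :* f)) :=
                           (a :* c :* (b :* f) :+ a :* e :* (b :* d)) :* (b :* (d :* f)))
                           refl (num p) (den p) (num q) (den q) (num r) (den r)))
                     , (λ p q r → cross (solve 6 (λ a b c d e f →
                           (c :* f :+ e :* d) :* a :* (d :* b :* (f :* b)) :=
                           (c :* a :* (f :* b) :+ e :* a :* (d :* b)) :* (d :* f :* b))
                           refl (num p) (den p) (num q) (den q) (num r) (den r)))
        }
      ; *-comm = λ p q → cross (solve 4 (λ a b c d → a :* c :* (d :* b) := c :* a :* (b :* d)) refl (num p) (den p) (num q) (den q))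
      }
    }

  field-of-fractions : Field ℓ ℓ
  field-of-fractions = record
    { commutativeRing = commutativeRing
    ; 0≉1        = λ (cross e) → 1≉0 (trans (sym (*-identityˡ 1#)) (trans (sym e) (zeroˡ 1#)))
    ; invertible = λ p p≉0 →
        let n≉0 = λ n≈0 → p≉0 (cross (trans (*-congʳ n≈0) (trans (zeroˡ 1#) (sym (zeroˡ (den p))))))
        in frac (den p) (num p) n≉0
         , cross (solve 2 (λ a b → b :* a :* :1 := :1 :* (a :* b)) refl (num p) (den p))
         , cross (solve 2 (λ a b → a :* b :* :1 := :1 :* (b :* a)) refl (num p) (den p))
    }

  fraction-isMono : IsRingMonomorphism rawRing (Field.rawRing field-of-fractions) fraction
  fraction-isMono = record
    { isRingHomomorphism = ringHomomorphism R commutativeRing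
        (λ e → cross (*-congʳ e))
        (λ x y → cross (solve 2 (λ x y → (x :+ y) :* (:1 :* :1) := (x :* :1 :+ y :* :1) :* :1) refl x y))
        (λ x y → cross (solve 2 (λ x y → x :* y :* (:1 :* :1) := x :* y :* :1) refl x y))
        (cross refl)
    ; injective = λ (cross e) → trans (sym (*-identityʳ _)) (trans e (*-identityʳ _))
    }

  module _ {D : Carrier → Carrier} (isDerivation : IsDerivation R D) where
    open IsDerivation isDerivation
    open DerivationProperties R isDerivation

    quotientRule : Fraction → Fraction
    quotientRule p = frac (D (num p) * den p - num p * D (den p)) (den p * den p) (*-nonzero (nonzero p) (nonzero p))

    quotientRule-fraction : ∀ x → quotientRule (fraction x) ≃ fraction (D x)
    quotientRule-fraction x = cross (trans (*-congʳ (+-congˡ (-‿cong (*-congˡ D-1))))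
      (solve 2 (λ x x′ → (x′ :* :1 :- x :* :0) :* :1 := x′ :* (:1 :* :1)) refl x (D x)))

    quotientRule-isDerivation : IsDerivation commutativeRing quotientRule
    quotientRule-isDerivation = record
      { D-cong  = λ {p} {q} (cross e) → cross (quotient-cong (num p) (den p) (num q) (den q) e
          (trans (sym (leibniz (num p) (den q))) (trans (D-cong e) (leibniz (num q) (den p)))))
      ; +-rule  = λ p q → cross (trans
          (*-congʳ (+-cong (*-congʳ (trans (+-rule _ _) (+-cong (leibniz _ _) (leibniz _ _)))) (-‿cong (*-congˡ (leibniz _ _)))))
          (solve 8 (λ a b c d a′ b′ c′ d′ →
            (((a′ :* d :+ a :* d′) :+ (c′ :* b :+ c :* b′)) :* (b :* d) :- (a :* d :+ c :* b) :* (b′ :* d :+ b :* d′)) :* (b :* b :* (d :* d)) :=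
            ((a′ :* b :- a :* b′) :* (d :* d) :+ (c′ :* d :- c :* d′) :* (b :* b)) :* (b :* d :* (b :* d)))
            refl (num p) (den p) (num q) (den q) (D (num p)) (D (den p)) (D (num q)) (D (den q))))
      ; leibniz = λ p q → cross (trans
          (*-congʳ (+-cong (*-congʳ (leibniz _ _)) (-‿cong (*-congˡ (leibniz _ _)))))
          (solve 8 (λ a b c d a′ b′ c′ d′ →
            ((a′ :* c :+ a :* c′) :* (b :* d) :- a :* c :* (b′ :* d :+ b :* d′)) :* (b :* b :* d :* (b :* (d :* d))) :=
            ((a′ :* b :- a :* b′) :* c :* (b :* (d :* d)) :+ a :* (c′ :* d :- c :* d′) :* (b :* b :* d)) :* (b :* d :* (b :* d)))
            refl (num p) (den p) (num q) (den q) (D (num p)) (D (den p)) (D (num q)) (D (den q))))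
      }
      where
      -- Equality of the two fractions enters twice, as a d = c b and as the derivative of this
      -- equation.
      quotient-cong : ∀ a b c d → a * d ≈ c * b → D a * d + a * D d ≈ D c * b + c * D b →
                      (D a * b - a * D b) * (d * d) ≈ (D c * d - c * D d) * (b * b)
      quotient-cong a b c d e e′ = trans
        (solve 6 (λ a b d a′ b′ d′ → (a′ :* b :- a :* b′) :* (d :* d) :=
          b :* d :* (a′ :* d :+ a :* d′) :- b :* d′ :* (a :* d) :- b′ :* d :* (a :* d)) refl a b d (D a) (D b) (D d))
        (trans (+-cong (+-cong (*-congˡ e′) (-‿cong (*-congˡ e))) (-‿cong (*-congˡ e)))
          (solve 6 (λ b c d b′ c′ d′ → b :* d :* (c′ :* b :+ c :* b′) :- b :* d′ :* (c :* b) :- b′ :* d :* (c :* b) :=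
            (c′ :* d :- c :* d′) :* (b :* b)) refl b c d (D b) (D c) (D d)))

  module _ {D E : Carrier → Carrier} (isDerivationᴰ : IsDerivation R D) (isDerivationᴱ : IsDerivation R E)
           (commute : ∀ x → D (E x) ≈ E (D x)) where
    private
      module D = IsDerivation isDerivationᴰ
      module E = IsDerivation isDerivationᴱ
      module D′ = DerivationProperties R isDerivationᴰ
      module E′ = DerivationProperties R isDerivationᴱ

      second : ∀ {D E : Carrier → Carrier} (d : IsDerivation R D) (a b : Carrier) →
               D (E a * b - a * E b) ≈ (D (E a) * b + E a * D b) - (D a * E b + a * D (E b))
      second d a b = trans (+-rule _ _) (+-cong (leibniz _ _) (trans (D-neg _) (-‿cong (leibniz _ _))))
        where
        open IsDerivation d
        open DerivationProperties R d

    -- Both iterated quotients have the same denominator, and the numerators are symmetric in D and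
    -- E up to the mixed second derivatives of a and b.
    quotientRule-comm : ∀ p → quotientRule isDerivationᴰ (quotientRule isDerivationᴱ p) ≃
                              quotientRule isDerivationᴱ (quotientRule isDerivationᴰ p)
    quotientRule-comm p = cross (*-congʳ (trans
      (+-cong (*-congʳ (second {E = E} isDerivationᴰ a b)) (-‿cong (*-congˡ (D.leibniz b b))))
      (trans
        (solve 8 (λ a b a₁ b₁ a₂ b₂ a₃ b₃ →
          ((a₃ :* b :+ a₂ :* b₁) :- (a₁ :* b₂ :+ a :* b₃)) :* (b :* b) :- (a₂ :* b :- a :* b₂) :* (b₁ :* b :+ b :* b₁) :=
          ((a₃ :* b :+ a₁ :* b₂) :- (a₂ :* b₁ :+ a :* b₃)) :* (b :* b) :- (a₁ :* b :- a :* b₁) :* (b₂ :* b :+ b :* b₂))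
          refl a b (D a) (D b) (E a) (E b) (D (E a)) (D (E b)))
        (sym (+-cong (*-congʳ (trans (second {E = D} isDerivationᴱ a b)
            (+-cong (+-congʳ (*-congʳ (sym (commute a)))) (-‿cong (+-congˡ (*-congˡ (sym (commute b))))))))
          (-‿cong (*-congˡ (E.leibniz b b))))))))
      where
      a = num p
      b = den p

-- The differential field of values

module ValueField {m : ℕ} {ℓ : Level} (K : DifferentialField m ℓ) (n : ℕ)
    (B : CommutativeRing ℓ ℓ) (domain : NoZeroDivisors B)
    (1≉0 : ¬ CommutativeRing._≈_ B (CommutativeRing.1# B) (CommutativeRing.0# B))
    {κ : DifferentialField.Carrier K → CommutativeRing.Carrier B}
    (κ-isMono : IsRingMonomorphism (DifferentialField.rawRing K) (CommutativeRing.rawRing B) κ)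
    (x : Variables.Var m n → CommutativeRing.Carrier B)
    (vanish : ∀ i t →
      CommutativeRing._≈_ B
        (DifferentialPolynomials.Evaluation.eval K n B (IsRingMonomorphism.isRingHomomorphism κ-isMono) x t)
        (CommutativeRing.0# B) →
      CommutativeRing._≈_ B
        (DifferentialPolynomials.Evaluation.eval K n B (IsRingMonomorphism.isRingHomomorphism κ-isMono) x
          (DifferentialPolynomials.D K n i t))
        (CommutativeRing.0# B)) where
  open DifferentialPolynomials K n
  open CommutativeRing B
  private
    module K = DifferentialField K
    module κ = IsRingMonomorphism κ-isMono
  open Evaluation B κ.isRingHomomorphism
  open RingSolver B using (solve; _:=_; _:+_; _:*_; :-_; _:-_; :0; :1)

  infix 4 _≋_
  record _≋_ (t u : Term) : Set ℓ where
    constructor equal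
    field values : eval x t ≈ eval x u
  open _≋_

  private
    rawTerms : RawRing ℓ ℓ
    rawTerms = record
      { Carrier = Term ; _≈_ = _≋_ ; _+_ = _⊕_ ; _*_ = _⊗_ ; -_ = ⊖_ ; 0# = con K.0# ; 1# = con K.1# }

    eval-isMono : IsRingMonomorphism rawTerms rawRing (eval x)
    eval-isMono = record
      { isRingHomomorphism = record
        { isSemiringHomomorphism = record
          { isNearSemiringHomomorphism = record
            { +-isMonoidHomomorphism = record
              { isMagmaHomomorphism = record { isRelHomomorphism = record { cong = values } ; homo = λ _ _ → refl }
              ; ε-homo = κ.0#-homo }
            ; *-homo = λ _ _ → refl }
          ; 1#-homo = κ.1#-homo }
        ; -‿homo = λ _ → refl }
      ; injective = equal
      }

  terms : CommutativeRing ℓ ℓ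
  terms = record { isCommutativeRing = RingMonomorphism.isCommutativeRing eval-isMono isCommutativeRing }

  -- The sum and product rules hold by the definition of `D`. Well-definedness is where `vanish`
  -- enters, applied to t ⊕ ⊖ u.
  D-isDerivation : ∀ i → IsDerivation terms (D i)
  D-isDerivation i = record
    { D-cong  = λ {t} {u} (equal e) → equal (trans (solve 2 (λ a b → a := (a :+ :- b) :+ b) refl _ _)
        (trans (+-congʳ (vanish i (t ⊕ ⊖ u) (trans (+-congʳ e) (-‿inverseʳ _)))) (+-identityˡ _)))
    ; +-rule  = λ t u → equal refl
    ; leibniz = λ t u → equal refl
    }

  private
    terms-domain : NoZeroDivisors terms
    terms-domain t u (equal e) = Sum.map
      (λ t≈0 → equal (trans t≈0 (sym κ.0#-homo))) (λ u≈0 → equal (trans u≈0 (sym κ.0#-homo)))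
      (domain _ _ (trans e κ.0#-homo))

    terms-1≉0 : ¬ con K.1# ≋ con K.0#
    terms-1≉0 (equal e) = 1≉0 (trans (sym κ.1#-homo) (trans e κ.0#-homo))

  module F = Fractions terms terms-domain terms-1≉0

  valueField : DifferentialField m ℓ
  valueField = record
    { underlying   = F.field-of-fractions
    ; ∂            = λ i → F.quotientRule (D-isDerivation i)
    ; isDerivation = λ i → F.quotientRule-isDerivation (D-isDerivation i)
    ; ∂-comm       = λ i j → F.quotientRule-comm (D-isDerivation i) (D-isDerivation j) (λ t → equal (eval-∼ x (D-comm i j t)))
    }

  private
    module fraction = IsRingMonomorphism F.fraction-isMono
    module M = DifferentialField valueField

  constants : K ↪ᵈ valueField
  constants = record
    { embedding = record
      { ⟦_⟧ = λ c → F.fraction (con c)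
      ; isRingMonomorphism = record
        { isRingHomomorphism = ringHomomorphism K.commutativeRing M.commutativeRing
            (λ e → fraction.⟦⟧-cong (equal (κ.⟦⟧-cong e)))
            (λ c d → M.trans (fraction.⟦⟧-cong (equal (κ.+-homo c d))) (fraction.+-homo _ _))
            (λ c d → M.trans (fraction.⟦⟧-cong (equal (κ.*-homo c d))) (fraction.*-homo _ _))
            M.refl
        ; injective = λ e → κ.injective (values (fraction.injective e))
        }
      }
    ; extends = λ i c → F.quotientRule-fraction (D-isDerivation i) (con c)
    }

-- Embedding K(a) into the differential field

module Realisation {m : ℕ} {ℓ : Level} (em : ExcludedMiddle ℓ) (K : DifferentialField m ℓ) {n r s : ℕ} (r≤s : r ≤ s)
    (h₀ : Fin n) (L : Field ℓ ℓ) (ι : DifferentialField.underlying K ↪ L) (a : Index m n s → Field.Carrier L)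
    (condition : DifferentialCondition K ι a)
    (r′ : ℕ) (r≤r′ : r ≤ r′) (r′-bound : suc (r′ ℕ.+ r′) ≤ s)
    (stable : ∀ v → Kernel.Leader K n L ι (DifferentialConditions.extend K n L ι a) v →
      Variables.ord m n v ≤ suc (r′ ℕ.+ r′) →
      Variables.Covered m n (Kernel.Leader K n L ι (DifferentialConditions.extend K n L ι a)) r′ v)
    (T : FreeExtension (Field.commutativeRing L)) where
  open Variables m n
  open DifferentialPolynomials K n
  private
    module K = DifferentialField K
    module L = Field L
    module ι = _↪_ ι
    module T = FreeExtension T
    module emb = IsRingMonomorphism T.emb-isMono
    module B = CommutativeRing T.ring
    module Lᴱ = Evaluation L.commutativeRing ι.isRingHomomorphism
    module C = DifferentialConditions K n L ι a
    module G = GenericPoint em K n L ι C.extend r′ T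
    module Bᴱ = Evaluation T.ring G.κ-isHom

    v₀ : Var
    v₀ = replicate m 0 , h₀

    prolongs : ∀ i {t} → Over (λ v → ord v ≤ r′ ℕ.+ r′) t → Lᴱ.eval C.extend t L.≈ L.0# → Lᴱ.eval C.extend (D i t) L.≈ L.0#
    prolongs i o = C.condition⇒prolongs condition v₀
      (ℕ.≤-trans (s≤s (ℕ.≤-trans (ℕ.≤-reflexive (∣0∣ m)) z≤n)) r′-bound) i
      (Over-map (λ _ v≤ → ℕ.≤-trans (s≤s v≤) r′-bound) o)

    vanish : ∀ i t → Bᴱ.eval G.point t B.≈ B.0# → Bᴱ.eval G.point (D i t) B.≈ B.0#
    vanish = Consistency.derivatives-vanish em K n L ι C.extend r′ prolongs stable T.ring T.noZeroDivisors
      T.emb-isMono G.κ-isHom G.point G.point-known G.point-solved G.point-free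

    κ-isMono : IsRingMonomorphism K.rawRing B.rawRing (T.emb ∘ ι.⟦_⟧)
    κ-isMono = record { isRingHomomorphism = G.κ-isHom ; injective = ι.injective ∘ emb.injective }

    B-1≉0 : ¬ B.1# B.≈ B.0#
    B-1≉0 e = L.0≉1 (L.sym (emb.injective (B.trans emb.1#-homo (B.trans e (B.sym emb.0#-homo)))))

    module V = ValueField K n T.ring T.noZeroDivisors B-1≉0 κ-isMono G.point vanish
    module M = DifferentialField V.valueField

    Small : Var → Set
    Small v = ord v ≤ r

    value-small : ∀ {t} → Over Small t → Bᴱ.eval G.point t B.≈ T.emb (Lᴱ.eval C.extend t)
    value-small = eval-homo L.commutativeRing T.ring ι.isRingHomomorphism G.κ-isHom emb.isRingHomomorphism (λ _ → B.refl)
      (λ v v≤r → G.point-known v (ℕ.≤-trans v≤r (ℕ.≤-trans r≤r′ (ℕ.m≤m+n r′ r′))))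

    L-domain : NoZeroDivisors L.commutativeRing
    L-domain = field-noZeroDivisors em L

    -- M consists of formal fractions, so an element of K(a) has to be written as one, with
    -- variables of order at most r, before it can be mapped.
    record Represented (y : L.Carrier) : Set ℓ where
      field
        num den   : Term
        num-small : Over Small num
        den-small : Over Small den
        nonzero   : ¬ Lᴱ.eval C.extend den L.≈ L.0#
        value     : Lᴱ.eval C.extend num L.≈ y L.* Lᴱ.eval C.extend den
    open Represented

    toFraction : ∀ {y} → Represented y → M.Carrier
    toFraction p = V.F.frac (num p) (den p) λ (V.equal e) → nonzero p (emb.injective
      (B.trans (B.sym (value-small (den-small p))) (B.trans e (B.trans (Bᴱ.eval-∼ G.point (con K.refl)) (emb.⟦⟧-cong ι.0#-homo)))))

    open RingSolver L.commutativeRing using (solve; _:=_; _:+_; _:*_; :-_; _:-_; :0; :1)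

    L-nonzero : ∀ {x y} → ¬ x L.≈ L.0# → ¬ y L.≈ L.0# → ¬ x L.* y L.≈ L.0#
    L-nonzero x≉0 y≉0 e = Sum.[ x≉0 , y≉0 ]′ (L-domain _ _ e)

    ι1≉0 : ¬ ι.⟦ K.1# ⟧ L.≈ L.0#
    ι1≉0 e = L.0≉1 (L.sym (L.trans (L.sym ι.1#-homo) e))

    over-1 : ∀ y → y L.≈ y L.* ι.⟦ K.1# ⟧
    over-1 y = L.sym (L.trans (L.*-congˡ ι.1#-homo) (L.*-identityʳ y))

    represent : ∀ {y} → Generated ι (a ∘ weaken r≤s) y → Represented y
    represent (base c) = record
      { num = con c ; den = con K.1# ; num-small = con ; den-small = con ; nonzero = ι1≉0 ; value = over-1 _ }
    represent (gen (index ξ h p)) = record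
      { num = var (ξ , h) ; den = con K.1# ; num-small = var ξ≤r ; den-small = con ; nonzero = ι1≉0
      ; value = L.trans (L.reflexive (C.extend-index ξ h (ℕ.≤-trans ξ≤r r≤s))) (over-1 _) }
      where
      ξ≤r : ∣ ξ ∣ ≤ r
      -- The bound stored in an `Index` is irrelevant; a proof is recovered by deciding it.
      ξ≤r = recompute (∣ ξ ∣ ℕ.≤? r) p
    represent (add {x} {y} g h) = record
      { num = num p ⊗ den q ⊕ num q ⊗ den p ; den = den p ⊗ den q
      ; num-small = num-small p ⊗ den-small q ⊕ num-small q ⊗ den-small p ; den-small = den-small p ⊗ den-small q
      ; nonzero = L-nonzero (nonzero p) (nonzero q)
      ; value = L.trans (L.+-cong (L.*-congʳ (value p)) (L.*-congʳ (value q)))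
          (solve 4 (λ x y d e → x :* d :* e :+ y :* e :* d := (x :+ y) :* (d :* e)) L.refl x y _ _) }
      where
      p = represent g
      q = represent h
    represent (neg {x} g) = record
      { num = ⊖ num p ; den = den p ; num-small = ⊖ num-small p ; den-small = den-small p ; nonzero = nonzero p
      ; value = L.trans (L.-‿cong (value p)) (solve 2 (λ x d → :- (x :* d) := :- x :* d) L.refl x _) }
      where p = represent g
    represent (mul {x} {y} g h) = record
      { num = num p ⊗ num q ; den = den p ⊗ den q
      ; num-small = num-small p ⊗ num-small q ; den-small = den-small p ⊗ den-small q
      ; nonzero = L-nonzero (nonzero p) (nonzero q)
      ; value = L.trans (L.*-cong (value p) (value q))
          (solve 4 (λ x y d e → x :* d :* (y :* e) := x :* y :* (d :* e)) L.refl x y _ _) }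
      where
      p = represent g
      q = represent h
    represent (inv {x} {y} g xy≈1) = record
      { num = den p ; den = num p ; num-small = den-small p ; den-small = num-small p
      -- The old denominator is y times the old numerator, so a zero numerator would make it zero
      -- too.
      ; nonzero = λ n≈0 → nonzero p (L.trans den≈y*num (L.trans (L.*-congˡ n≈0) (L.zeroʳ y)))
      ; value = den≈y*num }
      where
      p = represent g
      den≈y*num : Lᴱ.eval C.extend (den p) L.≈ y L.* Lᴱ.eval C.extend (num p)
      den≈y*num = L.sym (L.trans (L.*-congˡ (value p)) (L.trans (solve 3 (λ x y d → y :* (x :* d) := x :* y :* d) L.refl x y _)
        (L.trans (L.*-congʳ xy≈1) (L.*-identityˡ _))))
    represent (resp x≈y g) = record
      { num = num p ; den = den p ; num-small = num-small p ; den-small = den-small p ; nonzero = nonzero p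
      ; value = L.trans (value p) (L.*-congʳ x≈y) }
      where p = represent g

    -- An element can be generated in many ways; the fractions obtained agree because their values
    -- at x are images of values in L.
    toFraction-cong : ∀ {y z} (p : Represented y) (q : Represented z) → y L.≈ z → toFraction p M.≈ toFraction q
    toFraction-cong {y} {z} p q y≈z = V.F.cross (V.equal (B.trans (value-small (num-small p ⊗ den-small q))
      (B.trans (emb.⟦⟧-cong (L.trans (L.*-congʳ (value p)) (L.trans (L.*-congʳ (L.*-congʳ y≈z))
          (L.trans (solve 3 (λ z d e → z :* d :* e := z :* e :* d) L.refl z _ _) (L.*-congʳ (L.sym (value q)))))))
        (B.sym (value-small (num-small q ⊗ den-small p))))))

    toFraction-injective : ∀ {y z} (p : Represented y) (q : Represented z) → toFraction p M.≈ toFraction q → y L.≈ z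
    toFraction-injective {y} {z} p q (V.F.cross (V.equal e)) = Fraction.cancel (L-nonzero (nonzero p) (nonzero q)) (begin
      d L.* e′ L.* y   ≈⟨ solve 3 (λ y d e → d :* e :* y := y :* d :* e) L.refl y d e′ ⟩
      y L.* d L.* e′   ≈⟨ L.*-congʳ (L.sym (value p)) ⟩
      _                ≈⟨ emb.injective (B.trans (B.sym (value-small (num-small p ⊗ den-small q)))
                            (B.trans e (value-small (num-small q ⊗ den-small p)))) ⟩
      _                ≈⟨ L.*-congʳ (value q) ⟩
      z L.* e′ L.* d   ≈⟨ solve 3 (λ z d e → z :* e :* d := d :* e :* z) L.refl z d e′ ⟩
      d L.* e′ L.* z   ∎)
      where
      open import Relation.Binary.Reasoning.Setoid L.setoid
      module Fraction = Fractions L.commutativeRing L-domain (L.0≉1 ∘ L.sym)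
      d  = Lᴱ.eval C.extend (den p)
      e′ = Lᴱ.eval C.extend (den q)

  realisation : Σ[ M ∈ DifferentialField m ℓ ] Σ[ κ ∈ K ↪ᵈ M ] Compatible K ι κ (a ∘ weaken r≤s)
  realisation = V.valueField , V.constants , record
    { embedding = record
      { ⟦_⟧ = λ (_ , g) → toFraction (represent g)
      ; isRingMonomorphism = record
        { isRingHomomorphism = ringHomomorphism (Field.commutativeRing (adjoin ι (a ∘ weaken r≤s))) M.commutativeRing
            (λ {(_ , g)} {(_ , h)} → toFraction-cong (represent g) (represent h))
            -- `represent` forms sums and products exactly as fractions do, so both sides have the
            -- same value by computation.
            (λ _ _ → V.F.cross (V.equal B.refl))
            (λ _ _ → V.F.cross (V.equal B.refl))
            (V.F.cross (V.equal B.refl))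
        ; injective = λ {(_ , g)} {(_ , h)} → toFraction-injective (represent g) (represent h)
        }
      }
    ; over-K = λ _ → V.F.cross (V.equal B.refl)
    -- `D i (var (σ , k))` is by definition the variable with exponent σ ⊞ ε i.
    ; shifts = λ i k σ _ → V.F.cross (V.F.uncross (V.F.quotientRule-fraction (V.D-isDerivation i) (var (σ , k))))
    }

theorem4p10 : {ℓ : Level} → ExcludedMiddle (lsuc ℓ) →
    (m : ℕ) → .{{_ : NonZero m}} → (K : DifferentialField m ℓ) →
    (r n : ℕ) → .{{_ : NonZero r}} → .{{_ : NonZero n}} →
    ∃[ s ] Σ[ r≤s ∈ r ≤ s ]
      ((L : Field ℓ ℓ) (ι : DifferentialField.underlying K ↪ L) (a : Index m n s → Field.Carrier L) →
       DifferentialCondition K ι a →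
       Σ[ M ∈ DifferentialField m ℓ ] Σ[ κ ∈ K ↪ᵈ M ]
         Compatible K ι κ (a ∘ weaken r≤s))
-- The bound is fixed before L and a are given; joining it with r makes r ≤ s evident.
theorem4p10 {ℓ} em⁺ m K r (suc n) = s ℕ.⊔ r , ℕ.m≤n⊔m s r , λ L ι a condition → realise L ι a condition
  where
  em : ExcludedMiddle ℓ
  em {P} with em⁺ {Lift _ P}
  ... | yes (lift p) = yes p
  ... | no ¬p        = no (¬p ∘ lift)
  bound = Variables.stability-bound m (suc n) em r
  s = proj₁ bound
  realise : ∀ L ι (a : Index m (suc n) (s ℕ.⊔ r) → Field.Carrier L) → DifferentialCondition K ι a → _
  realise L ι a condition with proj₂ bound (Kernel.Leader K (suc n) L ι (DifferentialConditions.extend K (suc n) L ι a))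
  ... | r′ , r≤r′ , r′-bound , stable = Realisation.realisation em K (ℕ.m≤n⊔m s r) zero L ι a condition
    r′ r≤r′ (ℕ.≤-trans r′-bound (ℕ.m≤m⊔n s r)) stable (freeExtension em (Field.commutativeRing L) (field-noZeroDivisors em L))
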